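{- There is a polynomial-time algorithm for \textsc{ReachFast} on temporal graphs of the following form: the underlying graph consists of several internally vertex-disjoint paths between two common endpoints $A$ and $B$, and the source set is exactly $\{A,B\}$. The algorithm computes a solution of minimum value.
   Context: A temporal graph has static graph $G=(V,E)$ and edge sets $E_1,\dots,E_{t_{\max}}$ with $E=\bigcup_i E_i$; an edge has label $i$ if it lies in $E_i$. A temporal path uses edges with strictly increasing labels, and its arrival time is its last label. $\mathrm{reachtime}(v,\mathcal{G})$ is the least $t$ such that $v$ reaches every vertex by time $t$. Delaying a label $i$ by a positive integer $\delta$ replaces it by $i+\delta$, and the new label may exceed $t_{\max}$. A solution for sources $S$ is a temporal graph obtained by delaying any number of labels such that every source reaches every vertex. Its value is $\max_{v\in S}\mathrm{reachtime}(v,\cdot)$. -}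

module Defs where

open import Data.Nat using (ℕ; suc; _+_; _≤_; _<_)
open import Data.Nat.Logarithm using (⌊log₂_⌋)
open import Data.Fin using (Fin; toℕ) renaming (_<_ to _<ᶠ_)
open import Data.List using (List; []; _∷_; _++_; _∷ʳ_; foldr; map)
open import Data.List.Membership.Propositional using (_∈_; _∉_)
open import Data.List.Relation.Binary.Disjoint.Propositional using (Disjoint)
open import Data.List.Relation.Unary.All using (All)
open import Data.List.Relation.Unary.AllPairs using (AllPairs)
open import Data.List.Relation.Unary.Any using (Any)
open import Data.List.Relation.Unary.Linked using (Linked)
open import Data.List.Relation.Unary.Unique.Propositional using (Unique)
open import Data.Maybe using (Maybe; just; nothing)
open import Data.Product using (_×_; _,_; ∃-syntax; Σ-syntax)
open import Data.Sum using (_⊎_)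
open import Data.Vec using (Vec; []; _∷_; lookup)
open import Function.Bundles using (_⇔_)
open import Relation.Binary.PropositionalEquality using (_≡_; _≢_)
open import Relation.Nullary using (¬_)

-- Model of computation: first-order recursive programs over
-- S-expressions with natural numbers at the leaves; running time is the number of evaluation rules applied.
-- This is polynomially equivalent to Turing machines.  The only
-- arithmetic is successor and comparison, so after t steps every number
-- is at most t plus the largest number in the input or the program, and
-- every unit-cost operation can be simulated in time polynomial in t and
-- the binary length of the input.  Pairs are built and taken apart by
-- reference (no copying), and there is no comparison of whole trees.

data Val : Set where
  num : ℕ → Val
  _∙_ : Val → Val → Val

infixr 5 _∙_

-- Numbers are measured in binary.
size : Val → ℕ
size (num i) = suc ⌊log₂ i ⌋
size (a ∙ b) = suc (size a + size b)

-- Expressions with m free variables (de Bruijn), which may call k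
-- functions of the given arities.
data Expr {k : ℕ} (arity : Fin k → ℕ) (m : ℕ) : Set where
  var   : Fin m → Expr arity m
  nat   : ℕ → Expr arity m
  succ  : Expr arity m → Expr arity m
  pair  : Expr arity m → Expr arity m → Expr arity m
  -- The second branch binds the first component as variable 0 and the
  -- second component as variable 1.
  case  : Expr arity m → Expr arity m → Expr arity (2 + m) → Expr arity m
  if≤   : (e₁ e₂ yes no : Expr arity m) → Expr arity m
  let′  : Expr arity m → Expr arity (1 + m) → Expr arity m
  call  : (f : Fin k) → Vec (Expr arity m) (arity f) → Expr arity m

record Program : Set where
  field
    functions : ℕ
    arity     : Fin functions → ℕ
    body      : (f : Fin functions) → Expr arity (arity f)
    main      : Expr arity 1

module Semantics (P : Program) where
  open Program P

  infix 4 _⊢_⇓_∣_ _⊢*_⇓_∣_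

  -- ρ ⊢ e ⇓ v ∣ t : in environment ρ, e evaluates to v in t steps.
  mutual
    data _⊢_⇓_∣_ {m : ℕ} (ρ : Vec Val m) : Expr arity m → Val → ℕ → Set where
      ⇓var   : ∀ {x} → ρ ⊢ var x ⇓ lookup ρ x ∣ 1
      ⇓nat   : ∀ {i} → ρ ⊢ nat i ⇓ num i ∣ 1
      ⇓succ  : ∀ {e i t} → ρ ⊢ e ⇓ num i ∣ t → ρ ⊢ succ e ⇓ num (suc i) ∣ suc t
      ⇓pair  : ∀ {e₁ e₂ v₁ v₂ t₁ t₂} →
               ρ ⊢ e₁ ⇓ v₁ ∣ t₁ → ρ ⊢ e₂ ⇓ v₂ ∣ t₂ →
               ρ ⊢ pair e₁ e₂ ⇓ v₁ ∙ v₂ ∣ suc (t₁ + t₂)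
      ⇓case₀ : ∀ {e e₀ e₁ i v t t′} →
               ρ ⊢ e ⇓ num i ∣ t → ρ ⊢ e₀ ⇓ v ∣ t′ →
               ρ ⊢ case e e₀ e₁ ⇓ v ∣ suc (t + t′)
      ⇓case₁ : ∀ {e e₀ e₁ a b v t t′} →
               ρ ⊢ e ⇓ a ∙ b ∣ t → (a ∷ b ∷ ρ) ⊢ e₁ ⇓ v ∣ t′ →
               ρ ⊢ case e e₀ e₁ ⇓ v ∣ suc (t + t′)
      ⇓yes   : ∀ {e₁ e₂ e e′ i j v t₁ t₂ t} →
               ρ ⊢ e₁ ⇓ num i ∣ t₁ → ρ ⊢ e₂ ⇓ num j ∣ t₂ → i ≤ j →
               ρ ⊢ e ⇓ v ∣ t →
               ρ ⊢ if≤ e₁ e₂ e e′ ⇓ v ∣ suc (t₁ + t₂ + t)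
      ⇓no    : ∀ {e₁ e₂ e e′ i j v t₁ t₂ t} →
               ρ ⊢ e₁ ⇓ num i ∣ t₁ → ρ ⊢ e₂ ⇓ num j ∣ t₂ → j < i →
               ρ ⊢ e′ ⇓ v ∣ t →
               ρ ⊢ if≤ e₁ e₂ e e′ ⇓ v ∣ suc (t₁ + t₂ + t)
      ⇓let   : ∀ {e e′ u v t t′} →
               ρ ⊢ e ⇓ u ∣ t → (u ∷ ρ) ⊢ e′ ⇓ v ∣ t′ →
               ρ ⊢ let′ e e′ ⇓ v ∣ suc (t + t′)
      ⇓call  : ∀ {f es vs v t t′} →
               ρ ⊢* es ⇓ vs ∣ t → vs ⊢ body f ⇓ v ∣ t′ →
               ρ ⊢ call f es ⇓ v ∣ suc (t + t′)

    data _⊢*_⇓_∣_ {m : ℕ} (ρ : Vec Val m) :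
                  ∀ {l} → Vec (Expr arity m) l → Vec Val l → ℕ → Set where
      ⇓[] : ρ ⊢* [] ⇓ [] ∣ 0
      ⇓∷  : ∀ {l e v t t′} {es : Vec (Expr arity m) l} {vs : Vec Val l} →
            ρ ⊢ e ⇓ v ∣ t → ρ ⊢* es ⇓ vs ∣ t′ →
            ρ ⊢* (e ∷ es) ⇓ (v ∷ vs) ∣ (t + t′)

_on_outputs_within_ : Program → Val → Val → ℕ → Set
P on input outputs output within b =
  ∃[ t ] (t ≤ b × (input ∷ []) ⊢ Program.main P ⇓ output ∣ t)
  where open Semantics P

TimeEdge : ℕ → Set
TimeEdge n = Fin n × Fin n × ℕ

-- A temporal graph on the vertex set Fin n.  The sequence E₁, E₂, … is
-- stored as the finite set of triples (u , v , i) with uv ∈ Eᵢ, an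
-- undirected edge being written with its smaller endpoint first.
record TemporalGraph (n : ℕ) : Set where
  field
    timeEdges : List (TimeEdge n)
    oriented  : All (λ (u , v , _) → u <ᶠ v) timeEdges
    positive  : All (λ (_ , _ , i) → 1 ≤ i) timeEdges
    unique    : Unique timeEdges

open TemporalGraph public

module _ {n : ℕ} where

  HasLabel : TemporalGraph n → Fin n → Fin n → ℕ → Set
  HasLabel G u v i = (u , v , i) ∈ timeEdges G ⊎ (v , u , i) ∈ timeEdges G

  -- Adjacency in the underlying static graph, E = ⋃ᵢ Eᵢ.
  Adjacent : TemporalGraph n → Fin n → Fin n → Set
  Adjacent G u v = ∃[ i ] HasLabel G u v i

  -- TemporalPath G s v t vs : a temporal path from s to v with arrival
  -- time t, whose vertices are vs in reverse order.  The trivial path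
  -- arrives at time 0; labels being positive, this does not constrain
  -- the first edge of a longer path.
  data TemporalPath (G : TemporalGraph n) (s : Fin n) :
                    Fin n → ℕ → List (Fin n) → Set where
    start : TemporalPath G s s 0 (s ∷ [])
    step  : ∀ {u v t i vs} →
            TemporalPath G s u t vs → HasLabel G u v i → t < i → v ∉ vs →
            TemporalPath G s v i (v ∷ vs)

  ReachesBy : TemporalGraph n → Fin n → ℕ → Fin n → Set
  ReachesBy G s t v = ∃[ a ] ∃[ vs ] (TemporalPath G s v a vs × a ≤ t)

  Reaches : TemporalGraph n → Fin n → Fin n → Set
  Reaches G s v = ∃[ a ] ∃[ vs ] TemporalPath G s v a vs

  IsReachtime : TemporalGraph n → Fin n → ℕ → Set
  IsReachtime G s t =
    (∀ v → ReachesBy G s t v) × (∀ t′ → (∀ v → ReachesBy G s t′ v) → t ≤ t′)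

  -- Every label i of every edge is delayed by its own amount, 0 meaning
  -- that it is left alone.  Labels of one edge may be delayed to the same
  -- value, in which case they merge.
  _DelaysTo_ : TemporalGraph n → TemporalGraph n → Set
  G DelaysTo H = Σ[ δ ∈ (TimeEdge n → ℕ) ] (∀ u v j →
    (u , v , j) ∈ timeEdges H ⇔
    (∃[ i ] ((u , v , i) ∈ timeEdges G × j ≡ i + δ (u , v , i))))

record Instance : Set where
  field
    order         : ℕ
    graph         : TemporalGraph order
    sources       : List (Fin order)
    uniqueSources : Unique sources

open Instance public

IsSolution : (I : Instance) → TemporalGraph (order I) → Set
IsSolution I H = graph I DelaysTo H × All (λ s → ∀ v → Reaches H s v) (sources I)

IsValue : (I : Instance) → TemporalGraph (order I) → ℕ → Set
IsValue I H t =
  All (λ s → ∃[ r ] (IsReachtime H s r × r ≤ t)) (sources I) ×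
  Any (λ s → IsReachtime H s t) (sources I)

IsOptimalSolution : (I : Instance) → TemporalGraph (order I) → Set
IsOptimalSolution I H =
  IsSolution I H ×
  ∃[ t ] (IsValue I H t × (∀ H′ t′ → IsSolution I H′ → IsValue I H′ t′ → t ≤ t′))

-- An instance may have no solution at all (e.g. a single path with three
-- vertices and one label per edge); the answer is then nothing.
IsCorrectAnswer : (I : Instance) → Maybe (TemporalGraph (order I)) → Set
IsCorrectAnswer I (just H) = IsOptimalSolution I H
IsCorrectAnswer I nothing  = ∀ H → ¬ IsSolution I H

encodeList : List Val → Val
encodeList = foldr _∙_ (num 0)

encodeVertex : ∀ {n} → Fin n → Val
encodeVertex v = num (toℕ v)

encodeTimeEdge : ∀ {n} → TimeEdge n → Val
encodeTimeEdge (u , v , i) = encodeVertex u ∙ encodeVertex v ∙ num i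

encodeGraph : ∀ {n} → TemporalGraph n → Val
encodeGraph {n} G = num n ∙ encodeList (map encodeTimeEdge (timeEdges G))

encodeInstance : Instance → Val
encodeInstance I = encodeGraph (graph I) ∙ encodeList (map encodeVertex (sources I))

encodeAnswer : ∀ {n} → Maybe (TemporalGraph n) → Val
encodeAnswer (just H) = encodeGraph H
encodeAnswer nothing  = num 0

Consecutive : ∀ {n} → Fin n → Fin n → List (Fin n) → Set
Consecutive u v vs = ∃[ xs ] ∃[ ys ] (vs ≡ xs ++ u ∷ v ∷ ys)

-- Each path is given by the list of its internal vertices, in order from
-- A to B; the empty list is the edge AB.
record IsDisjointPathsBetween {n : ℕ} (G : TemporalGraph n) (A B : Fin n)
                              (interiors : List (List (Fin n))) : Set where
  route : List (Fin n) → List (Fin n)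
  route p = A ∷ (p ∷ʳ B)

  field
    nonempty          : interiors ≢ []
    simple            : All (λ p → Unique (route p)) interiors
    paths             : All (λ p → Linked (Adjacent G) (route p)) interiors
    disjoint          : AllPairs Disjoint interiors
    coversAllVertices : ∀ v → Any (λ p → v ∈ route p) interiors
    coversAllEdges    : ∀ u v → Adjacent G u v →
      Any (λ p → Consecutive u v (route p) ⊎ Consecutive v u (route p)) interiors

ConsistsOfDisjointPathsBetween : ∀ {n} → TemporalGraph n → Fin n → Fin n → Set
ConsistsOfDisjointPathsBetween G A B =
  ∃[ interiors ] IsDisjointPathsBetween G A B interiors

{-# OPTIONS --safe #-}
module Submission where

-- A solution may be described by the earliest arrival times α and β from A and from B: every vertex v other
-- than the source has a neighbour u that is reached earlier and an edge uv whose label is delayed to the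
-- arrival time at v.  On each edge this uses at most two labels, and on a path the conditions couple only
-- consecutive edges, so that an optimal (α , β) can be found by dynamic programming along the paths, one after
-- the other, given the arrival time at B from A, the arrival time at A from B, and the deadline.  Times may be
-- restricted to the sums l + j where l is 0 or a label and j is at most the number of labels, since all times
-- of a solution can be slid down to such values without changing their order or passing below a label.
--
-- For the running time, all programs are terms of a small language of list comprehensions in which the only
-- recursion adds at most one element of fixed size per round.  An interpreter for this language runs in
-- polynomial time on each fixed term.

open import Defs
open import Algebra.Properties.CommutativeSemigroup using (interchange)
open import Data.Bool using (Bool; true; false; T; if_then_else_)
open import Data.Empty using (⊥; ⊥-elim)
open import Data.Fin using (Fin; zero; suc; toℕ; fromℕ<; #_)
open import Data.Fin.Properties as Fin using (toℕ-injective; toℕ<n; fromℕ<-toℕ; any?; all?)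
open import Data.List using (List; []; _∷_; _++_; _∷ʳ_; concatMap; foldr; length; map)
open import Data.List.Membership.DecPropositional using () renaming (_∈?_ to member?)
open import Data.List.Membership.Propositional using (_∈_; _∉_; find; lose)
open import Data.List.Membership.Propositional.Properties using (∈-∃++; ∈-++⁺ˡ; ∈-++⁺ʳ; ∈-++⁻; ∈-map⁺; ∈-map⁻)
open import Data.List.Properties using (length-++; length-map)
open import Data.List.Relation.Binary.Disjoint.Propositional using (Disjoint)
open import Data.List.Relation.Binary.Subset.Propositional using (_⊆_)
open import Data.List.Relation.Unary.All as All using (All; []; _∷_)
open import Data.List.Relation.Unary.All.Properties using (¬Any⇒All¬)
open import Data.List.Relation.Unary.AllPairs using (AllPairs; []; _∷_)
open import Data.List.Relation.Unary.Any as Any using (Any; here; there)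
import Data.List.Relation.Unary.Any.Properties as AnyP
open import Data.List.Relation.Unary.Linked using (Linked; _∷_)
open import Data.List.Relation.Unary.Unique.Propositional using (Unique)
import Data.List.Relation.Unary.Unique.Propositional.Properties as UniqueP
open import Data.Maybe using (Maybe; just; nothing)
open import Data.Nat
open import Data.Nat.Induction using (<-rec; <-wellFounded)
open import Data.Nat.Properties
open import Data.Nat.Tactic.RingSolver using (solve-∀)
open import Data.Product using (_×_; _,_; proj₁; proj₂; ∃-syntax; Σ-syntax)
open import Data.Product.Properties using (≡-dec)
open import Data.Sum using (_⊎_; inj₁; inj₂)
open import Data.Unit using (tt)
open import Data.Vec using (Vec; []; _∷_; lookup)
open import Function.Bundles using (Equivalence; mk⇔)
open import Induction.WellFounded using (Acc) renaming (acc to accessible)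
open import Relation.Binary.PropositionalEquality using (_≡_; _≢_; refl; sym; trans; cong; cong₂; subst; subst₂)
open import Relation.Nullary using (¬_; Dec; yes; no)
open import Relation.Nullary.Decidable using (True; ¬?; _×-dec_; _⊎-dec_)
open import Relation.Nullary.Reflects using (Reflects; ofʸ; ofⁿ; ¬-reflects; _×-reflects_; _⊎-reflects_)

-- Polynomials

-- The input does not name the paths, so a walk through the graph has to recover them. The paths
-- interact only at `A` and `B`: a temporal path from `A` may pass through `B` and enter another
-- path from its far end, so inside a path each arrival may be caused from either side. Guessing the
-- arrival times at the opposite endpoints and the deadline, and handing these on unchanged,
-- decouples the paths. What remains global is that one path really brings about the guessed arrival
-- at `B` and one the arrival at `A`; two flags record this. The times in the tables need not be
-- earliest. It suffices that each has a cause: a strictly earlier time at a neighbour and a label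
-- equal to the time itself. A solution supplies such times through its earliest arrivals;
-- conversely, induction on time turns causes into temporal paths. Thus the table contains a final
-- fact with deadline at most `t` for every solution of value `t`, and each traced final fact yields
-- a solution whose value is at most its deadline. Labels that cause nothing keep their place.

infixl 6 _⊞_
infixl 7 _⊠_
infixr 9 _⊙_

data Poly : Set where
  κ   : ℕ → Poly
  χ   : Poly
  _⊞_ _⊠_ _⊙_ : Poly → Poly → Poly

_at_ : Poly → ℕ → ℕ
κ c at s = c
χ at s = s
(p ⊞ q) at s = p at s + q at s
(p ⊠ q) at s = p at s * q at s
(p ⊙ q) at s = p at (q at s)

at-mono : ∀ p {s s′} → s ≤ s′ → p at s ≤ p at s′
at-mono (κ c)   _ = ≤-refl
at-mono χ       h = h
at-mono (p ⊞ q) h = +-mono-≤ (at-mono p h) (at-mono q h)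
at-mono (p ⊠ q) h = *-mono-≤ (at-mono p h) (at-mono q h)
at-mono (p ⊙ q) h = at-mono p (at-mono q h)

^-distribʳ-* : ∀ d m n → (m * n) ^ d ≡ m ^ d * n ^ d
^-distribʳ-* zero    m n = refl
^-distribʳ-* (suc d) m n rewrite ^-distribʳ-* d m n = lemma m n (m ^ d) (n ^ d)
  where
  lemma : ∀ a b c e → (a * b) * (c * e) ≡ (a * c) * (b * e)
  lemma = solve-∀

monomial-bound : ∀ p → ∃[ c ] ∃[ d ] (∀ s → 1 ≤ s → p at s ≤ c * s ^ d)
monomial-bound (κ c) = c , 0 , λ s _ → ≤-reflexive (sym (*-identityʳ c))
monomial-bound χ = 1 , 1 , λ s _ → ≤-reflexive (sym (trans (*-identityˡ (s ^ 1)) (^-identityʳ s)))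
monomial-bound (p ⊞ q) with monomial-bound p | monomial-bound q
... | c , d , hp | c′ , d′ , hq = c + c′ , d + d′ , bound
  where
  bound : ∀ s → 1 ≤ s → p at s + q at s ≤ (c + c′) * s ^ (d + d′)
  bound s@(suc _) 1≤s = begin
    p at s + q at s                        ≤⟨ +-mono-≤ (hp s 1≤s) (hq s 1≤s) ⟩
    c * s ^ d + c′ * s ^ d′                ≤⟨ +-mono-≤ (*-monoʳ-≤ c (^-monoʳ-≤ s (m≤m+n d d′)))
          (*-monoʳ-≤ c′ (^-monoʳ-≤ s (m≤n+m d′ d))) ⟩
    c * s ^ (d + d′) + c′ * s ^ (d + d′)   ≡⟨ *-distribʳ-+ (s ^ (d + d′)) c c′ ⟨
    (c + c′) * s ^ (d + d′)                ∎
    where open ≤-Reasoning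
monomial-bound (p ⊠ q) with monomial-bound p | monomial-bound q
... | c , d , hp | c′ , d′ , hq = c * c′ , d + d′ , bound
  where
  lemma : ∀ a b x y → (a * x) * (b * y) ≡ (a * b) * (x * y)
  lemma = solve-∀
  bound : ∀ s → 1 ≤ s → p at s * q at s ≤ (c * c′) * s ^ (d + d′)
  bound s 1≤s = begin
    p at s * q at s                 ≤⟨ *-mono-≤ (hp s 1≤s) (hq s 1≤s) ⟩
    (c * s ^ d) * (c′ * s ^ d′)     ≡⟨ lemma c c′ (s ^ d) (s ^ d′) ⟩
    (c * c′) * (s ^ d * s ^ d′)     ≡⟨ cong (c * c′ *_) (^-distribˡ-+-* s d d′) ⟨
    (c * c′) * s ^ (d + d′)         ∎
    where open ≤-Reasoning
monomial-bound (p ⊙ q) with monomial-bound p | monomial-bound q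
... | c , d , hp | c′ , d′ , hq = c * suc c′ ^ d , d′ * d , bound
  where
  bound : ∀ s → 1 ≤ s → p at (q at s) ≤ (c * suc c′ ^ d) * s ^ (d′ * d)
  bound s@(suc _) 1≤s = begin
    -- Enlarging `c′` to `suc c′` makes the argument of `p` positive, as the bound for `p` requires.
    p at (q at s)                        ≤⟨ at-mono p (≤-trans (hq s 1≤s) (*-monoˡ-≤ (s ^ d′) (n≤1+n c′))) ⟩
    p at (suc c′ * s ^ d′)               ≤⟨ hp _ (*-mono-≤ (s≤s (z≤n {c′})) (m^n>0 s d′)) ⟩
    c * (suc c′ * s ^ d′) ^ d            ≡⟨ cong (c *_) (^-distribʳ-* d (suc c′) (s ^ d′)) ⟩
    c * (suc c′ ^ d * (s ^ d′) ^ d)      ≡⟨ *-assoc c (suc c′ ^ d) _ ⟨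
    c * suc c′ ^ d * (s ^ d′) ^ d        ≡⟨ cong (c * suc c′ ^ d *_) (^-*-assoc s d′ d) ⟩
    c * suc c′ ^ d * s ^ (d′ * d)        ∎
    where open ≤-Reasoning

-- A total first-order language

infixr 7 _⊗_

data Ty : Set where
  natᵗ boolᵗ : Ty
  _⊗_        : Ty → Ty → Ty
  listᵗ      : Ty → Ty
  optᵗ       : Ty → Ty → Ty

⟦_⟧ᵗ : Ty → Set
⟦ natᵗ ⟧ᵗ = ℕ
⟦ boolᵗ ⟧ᵗ = Bool
⟦ σ ⊗ τ ⟧ᵗ = ⟦ σ ⟧ᵗ × ⟦ τ ⟧ᵗ
⟦ listᵗ τ ⟧ᵗ = List ⟦ τ ⟧ᵗ
⟦ optᵗ σ τ ⟧ᵗ = Maybe (⟦ σ ⟧ᵗ × ⟦ τ ⟧ᵗ)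

enc : ∀ τ → ⟦ τ ⟧ᵗ → Val
enc natᵗ       n            = num n
enc boolᵗ      true         = num 1
enc boolᵗ      false        = num 0
enc (σ ⊗ τ)    (a , b)      = enc σ a ∙ enc τ b
enc (listᵗ τ)  []           = num 0
enc (listᵗ τ)  (x ∷ xs)     = enc τ x ∙ enc (listᵗ τ) xs
enc (optᵗ σ τ) nothing      = num 0
enc (optᵗ σ τ) (just (a , b)) = enc σ a ∙ enc τ b

data Env : List Ty → Set where
  []  : Env []
  _∷_ : ∀ {τ Γ} → ⟦ τ ⟧ᵗ → Env Γ → Env (τ ∷ Γ)

encEnv : ∀ {Γ} → Env Γ → Val
encEnv []              = num 0
encEnv (_∷_ {τ} x ρ)   = enc τ x ∙ encEnv ρ

isFlat : Ty → Bool
isFlat natᵗ    = true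
isFlat (σ ⊗ τ) = if isFlat σ then isFlat τ else false
isFlat _       = false

-- Only lists of flat elements can be accumulated by chain, and only one element per
-- round: this keeps all intermediate results polynomial.
data Tm : List Ty → Ty → Set where
  v₀     : ∀ {Γ τ} → Tm (τ ∷ Γ) τ
  wk     : ∀ {Γ σ τ} → Tm Γ τ → Tm (σ ∷ Γ) τ
  lit    : ∀ {Γ} → ℕ → Tm Γ natᵗ
  bool   : ∀ {Γ} → Bool → Tm Γ boolᵗ
  nil    : ∀ {Γ τ} → Tm Γ (listᵗ τ)
  none   : ∀ {Γ σ τ} → Tm Γ (optᵗ σ τ)
  inc    : ∀ {Γ} → Tm Γ natᵗ → Tm Γ natᵗ
  ⟨_,_⟩  : ∀ {Γ σ τ} → Tm Γ σ → Tm Γ τ → Tm Γ (σ ⊗ τ)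
  some   : ∀ {Γ σ τ} → Tm Γ σ → Tm Γ τ → Tm Γ (optᵗ σ τ)
  cons   : ∀ {Γ τ} → Tm Γ τ → Tm Γ (listᵗ τ) → Tm Γ (listᵗ τ)
  fst    : ∀ {Γ σ τ} → Tm Γ (σ ⊗ τ) → Tm Γ σ
  snd    : ∀ {Γ σ τ} → Tm Γ (σ ⊗ τ) → Tm Γ τ
  leq    : ∀ {Γ} → Tm Γ natᵗ → Tm Γ natᵗ → Tm Γ boolᵗ
  ite    : ∀ {Γ τ} → Tm Γ boolᵗ → Tm Γ τ → Tm Γ τ → Tm Γ τ
  caseˡ  : ∀ {Γ σ τ} → Tm Γ (listᵗ σ) → Tm Γ τ → Tm (σ ∷ listᵗ σ ∷ Γ) τ → Tm Γ τ
  for    : ∀ {Γ σ τ} → Tm Γ (listᵗ σ) → Tm (σ ∷ Γ) (listᵗ τ) → Tm Γ (listᵗ τ)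
  chain  : ∀ {Γ σ τ} {flat : T (isFlat τ)} →
           Tm Γ (listᵗ σ) → Tm (listᵗ τ ∷ σ ∷ Γ) (listᵗ τ) → Tm Γ (listᵗ τ)
  lets   : ∀ {Γ σ τ} → Tm Γ σ → Tm (σ ∷ Γ) τ → Tm Γ τ

caseList : ∀ {X Y : Set} → List X → Y → (X → List X → Y) → Y
caseList []       n c = n
caseList (x ∷ xs) n c = c x xs

push : ∀ {X : Set} → List X → List X → List X
push []      acc = acc
push (y ∷ _) acc = y ∷ acc

-- As a right fold it works from the end of the list, and the newest element is the head of the
-- result. The order in which facts are decided relies on this.
chainList : ∀ {X Y : Set} → (List Y → X → List Y) → List X → List Y
chainList f = foldr (λ x acc → push (f acc x) acc) []

⟦_⟧ : ∀ {Γ τ} → Tm Γ τ → Env Γ → ⟦ τ ⟧ᵗ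
⟦ v₀ ⟧ (x ∷ ρ)   = x
⟦ wk t ⟧ (x ∷ ρ) = ⟦ t ⟧ ρ
⟦ lit n ⟧ ρ      = n
⟦ bool b ⟧ ρ     = b
⟦ nil ⟧ ρ        = []
⟦ none ⟧ ρ       = nothing
⟦ inc t ⟧ ρ      = suc (⟦ t ⟧ ρ)
⟦ ⟨ t , u ⟩ ⟧ ρ  = ⟦ t ⟧ ρ , ⟦ u ⟧ ρ
⟦ some t u ⟧ ρ   = just (⟦ t ⟧ ρ , ⟦ u ⟧ ρ)
⟦ cons t u ⟧ ρ   = ⟦ t ⟧ ρ ∷ ⟦ u ⟧ ρ
⟦ fst t ⟧ ρ      = proj₁ (⟦ t ⟧ ρ)
⟦ snd t ⟧ ρ      = proj₂ (⟦ t ⟧ ρ)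
⟦ leq t u ⟧ ρ    = ⟦ t ⟧ ρ ≤ᵇ ⟦ u ⟧ ρ
⟦ ite t u w ⟧ ρ  = if ⟦ t ⟧ ρ then ⟦ u ⟧ ρ else ⟦ w ⟧ ρ
⟦ caseˡ t u w ⟧ ρ = caseList (⟦ t ⟧ ρ) (⟦ u ⟧ ρ) (λ x xs → ⟦ w ⟧ (x ∷ xs ∷ ρ))
⟦ for t u ⟧ ρ    = concatMap (λ x → ⟦ u ⟧ (x ∷ ρ)) (⟦ t ⟧ ρ)
⟦ chain t u ⟧ ρ  = chainList (λ acc x → ⟦ u ⟧ (acc ∷ x ∷ ρ)) (⟦ t ⟧ ρ)
⟦ lets t u ⟧ ρ   = ⟦ u ⟧ (⟦ t ⟧ ρ ∷ ρ)

-- Result sizes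

-- Unlike `size`, this counts every number as 1. Evaluation rules charge nothing for large numbers,
-- so times can be bounded by nodes, and values of a flat type have constantly many of them.
nodes : Val → ℕ
nodes (num _) = 1
nodes (a ∙ b) = suc (nodes a + nodes b)

nodes≤size : ∀ v → nodes v ≤ size v
nodes≤size (num i) = s≤s z≤n
nodes≤size (a ∙ b) = s≤s (+-mono-≤ (nodes≤size a) (nodes≤size b))

1≤nodes : ∀ v → 1 ≤ nodes v
1≤nodes (num _) = ≤-refl
1≤nodes (_ ∙ _) = s≤s z≤n

flatNodes : Ty → ℕ
flatNodes (σ ⊗ τ) = suc (flatNodes σ + flatNodes τ)
flatNodes _       = 1

nodes-flat : ∀ τ → T (isFlat τ) → (x : ⟦ τ ⟧ᵗ) → nodes (enc τ x) ≡ flatNodes τ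
nodes-flat natᵗ    _ x = refl
nodes-flat (σ ⊗ τ) h (x , y) with isFlat σ in eq
... | true = cong suc (cong₂ _+_ (nodes-flat σ (subst T (sym eq) tt) x) (nodes-flat τ h y))

encL : ∀ τ → List ⟦ τ ⟧ᵗ → Val
encL τ = enc (listᵗ τ)

nodes-++ : ∀ τ xs ys → nodes (encL τ (xs ++ ys)) ≤ nodes (encL τ xs) + nodes (encL τ ys)
nodes-++ τ []       ys = n≤1+n _
nodes-++ τ (x ∷ xs) ys = s≤s (begin
  nodes (enc τ x) + nodes (encL τ (xs ++ ys))                    ≤⟨ +-monoʳ-≤ (nodes (enc τ x)) (nodes-++ τ xs ys) ⟩
  nodes (enc τ x) + (nodes (encL τ xs) + nodes (encL τ ys))      ≡⟨ +-assoc (nodes (enc τ x)) _ _ ⟨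
  nodes (enc τ x) + nodes (encL τ xs) + nodes (encL τ ys)        ∎)
  where open ≤-Reasoning

head-nodes : ∀ {τ} x xs → nodes (enc τ x) ≤ nodes (encL τ (x ∷ xs))
head-nodes x xs = m≤n⇒m≤1+n (m≤m+n _ _)

tail-nodes : ∀ {τ} x xs → nodes (encL τ xs) ≤ nodes (encL τ (x ∷ xs))
tail-nodes {τ} x xs = m≤n⇒m≤1+n (m≤n+m _ (nodes (enc τ x)))

-- The function is controlled only on elements no larger than the bound for the whole list; this is
-- what a monotone bound for the body of a `for` provides.
concatMap-nodes : ∀ {σ τ} (f : ⟦ σ ⟧ᵗ → List ⟦ τ ⟧ᵗ) xs {L S} → nodes (encL σ xs) ≤ L →
  (∀ x → nodes (enc σ x) ≤ L → nodes (encL τ (f x)) ≤ S) →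
  nodes (encL τ (concatMap f xs)) ≤ nodes (encL σ xs) * suc S
concatMap-nodes f [] _ _ = s≤s z≤n
concatMap-nodes {σ} {τ} f (x ∷ xs) {L} {S} xs≤L f≤S = begin
  nodes (encL τ (f x ++ concatMap f xs))                   ≤⟨ nodes-++ τ (f x) _ ⟩
  nodes (encL τ (f x)) + nodes (encL τ (concatMap f xs))   ≤⟨ +-mono-≤ (f≤S x (≤-trans (head-nodes {σ} x xs) xs≤L))
        (concatMap-nodes {σ} {τ} f xs (≤-trans (tail-nodes {σ} x xs) xs≤L) f≤S) ⟩
  S + nodes (encL σ xs) * suc S                            ≤⟨ n≤1+n _ ⟩
  suc (nodes (encL σ xs)) * suc S                          ≤⟨ *-monoˡ-≤ (suc S) (s≤s (m≤n+m _ (nodes (enc σ x)))) ⟩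
  nodes (encL σ (x ∷ xs)) * suc S                          ∎
  where open ≤-Reasoning

push-nodes : ∀ {τ} → T (isFlat τ) → ∀ ys acc → nodes (encL τ (push ys acc)) ≤ suc (flatNodes τ) + nodes (encL τ acc)
push-nodes {τ} fl []       acc = m≤n+m _ (suc (flatNodes τ))
push-nodes {τ} fl (y ∷ ys) acc rewrite nodes-flat τ fl y = ≤-refl

chain-nodes : ∀ {σ τ} → T (isFlat τ) → (f : List ⟦ τ ⟧ᵗ → ⟦ σ ⟧ᵗ → List ⟦ τ ⟧ᵗ) → ∀ xs →
  nodes (encL τ (chainList f xs)) ≤ nodes (encL σ xs) * suc (flatNodes τ)
chain-nodes fl f [] = s≤s z≤n
chain-nodes {σ} {τ} fl f (x ∷ xs) = begin
  nodes (encL τ (push (f acc x) acc))                        ≤⟨ push-nodes {τ} fl (f acc x) acc ⟩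
  suc (flatNodes τ) + nodes (encL τ acc)                     ≤⟨ +-monoʳ-≤ (suc (flatNodes τ)) (chain-nodes {σ} {τ} fl f xs) ⟩
  suc (nodes (encL σ xs)) * suc (flatNodes τ)                ≤⟨ *-monoˡ-≤ (suc (flatNodes τ)) (s≤s (m≤n+m _ (nodes (enc σ x)))) ⟩
  nodes (encL σ (x ∷ xs)) * suc (flatNodes τ)                ∎
  where
  open ≤-Reasoning
  acc = chainList f xs

-- The recurring `κ 1 ⊞ (sizeᵖ t ⊞ χ)` is the environment extended by the value of `t`. In `chain`
-- the body does not enter: each round adds at most `suc (flatNodes τ)` nodes, however large the
-- list it proposes.
sizeᵖ : ∀ {Γ τ} → Tm Γ τ → Poly
sizeᵖ v₀          = χ
sizeᵖ (wk t)      = sizeᵖ t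
sizeᵖ (lit _)     = κ 1
sizeᵖ (bool _)    = κ 1
sizeᵖ nil         = κ 1
sizeᵖ none        = κ 1
sizeᵖ (inc _)     = κ 1
sizeᵖ ⟨ t , u ⟩   = κ 1 ⊞ (sizeᵖ t ⊞ sizeᵖ u)
sizeᵖ (some t u)  = κ 1 ⊞ (sizeᵖ t ⊞ sizeᵖ u)
sizeᵖ (cons t u)  = κ 1 ⊞ (sizeᵖ t ⊞ sizeᵖ u)
sizeᵖ (fst t)     = sizeᵖ t
sizeᵖ (snd t)     = sizeᵖ t
sizeᵖ (leq _ _)   = κ 1
sizeᵖ (ite _ u w) = sizeᵖ u ⊞ sizeᵖ w
sizeᵖ (caseˡ t u w) = sizeᵖ u ⊞ sizeᵖ w ⊙ (κ 1 ⊞ (sizeᵖ t ⊞ χ))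
sizeᵖ (for t u)   = sizeᵖ t ⊠ (κ 1 ⊞ sizeᵖ u ⊙ (κ 1 ⊞ (sizeᵖ t ⊞ χ)))
sizeᵖ (chain {τ = τ} t u) = sizeᵖ t ⊠ κ (suc (flatNodes τ))
sizeᵖ (lets t u)  = sizeᵖ u ⊙ (κ 1 ⊞ (sizeᵖ t ⊞ χ))

∣_∣ᵉ : ∀ {Γ} → Env Γ → ℕ
∣ ρ ∣ᵉ = nodes (encEnv ρ)

size-bound : ∀ {Γ τ} (t : Tm Γ τ) (ρ : Env Γ) → nodes (enc τ (⟦ t ⟧ ρ)) ≤ sizeᵖ t at ∣ ρ ∣ᵉ
size-bound {τ = τ} v₀ (x ∷ ρ) = m≤n⇒m≤1+n (m≤m+n _ _)
size-bound (wk t) (_∷_ {σ} x ρ) = ≤-trans (size-bound t ρ) (at-mono (sizeᵖ t) (m≤n⇒m≤1+n (m≤n+m _ (nodes (enc σ x)))))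
size-bound (lit _)  ρ = ≤-refl
size-bound (bool true)  ρ = ≤-refl
size-bound (bool false) ρ = ≤-refl
size-bound nil      ρ = ≤-refl
size-bound none     ρ = ≤-refl
size-bound (inc _)  ρ = ≤-refl
size-bound ⟨ t , u ⟩ ρ = s≤s (+-mono-≤ (size-bound t ρ) (size-bound u ρ))
size-bound (some t u) ρ = s≤s (+-mono-≤ (size-bound t ρ) (size-bound u ρ))
size-bound (cons t u) ρ = s≤s (+-mono-≤ (size-bound t ρ) (size-bound u ρ))
size-bound (fst t)  ρ = ≤-trans (m≤n⇒m≤1+n (m≤m+n _ _)) (size-bound t ρ)
size-bound (snd {σ = σ} t)  ρ = ≤-trans (m≤n⇒m≤1+n (m≤n+m _ (nodes (enc σ (proj₁ (⟦ t ⟧ ρ)))))) (size-bound t ρ)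
size-bound (leq t u) ρ with ⟦ t ⟧ ρ ≤ᵇ ⟦ u ⟧ ρ
... | true  = ≤-refl
... | false = ≤-refl
size-bound (ite t u w) ρ with ⟦ t ⟧ ρ
... | true  = ≤-trans (size-bound u ρ) (m≤m+n _ _)
... | false = ≤-trans (size-bound w ρ) (m≤n+m _ (sizeᵖ u at ∣ ρ ∣ᵉ))
size-bound (caseˡ {σ = σ} t u w) ρ with ⟦ t ⟧ ρ | size-bound t ρ
... | []     | _ = ≤-trans (size-bound u ρ) (m≤m+n _ _)
-- Two entries `x` and `xs` take exactly as many nodes in the environment as the single entry
-- `x ∷ xs`, hence the same polynomial as for a `lets`.
... | x ∷ xs | h = ≤-trans (size-bound w (x ∷ xs ∷ ρ))
                  (≤-trans (at-mono (sizeᵖ w) (s≤s (≤-trans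
                        (≤-reflexive (trans (+-suc _ _) (cong suc (sym (+-assoc (nodes (enc σ x)) _ _)))))
                        (+-monoˡ-≤ ∣ ρ ∣ᵉ h))))
                           (m≤n+m _ (sizeᵖ u at ∣ ρ ∣ᵉ)))
size-bound (for {σ = σ} {τ} t u) ρ =
  ≤-trans (concatMap-nodes {σ} {τ} _ (⟦ t ⟧ ρ) (size-bound t ρ)
        (λ x h → ≤-trans (size-bound u (x ∷ ρ)) (at-mono (sizeᵖ u) (s≤s (+-monoˡ-≤ ∣ ρ ∣ᵉ h)))))
          (*-monoˡ-≤ _ (size-bound t ρ))
size-bound (chain {σ = σ} {τ} {flat} t u) ρ =
  ≤-trans (chain-nodes {σ} {τ} flat _ (⟦ t ⟧ ρ)) (*-monoˡ-≤ (suc (flatNodes τ)) (size-bound t ρ))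
size-bound (lets t u) ρ = ≤-trans (size-bound u (⟦ t ⟧ ρ ∷ ρ)) (at-mono (sizeᵖ u) (s≤s (+-monoˡ-≤ ∣ ρ ∣ᵉ (size-bound t ρ))))

-- The interpreter

arities : Fin 4 → ℕ
arities zero             = 2
arities (suc zero)       = 2
arities (suc (suc _))    = 3

E : ℕ → Set
E = Expr arities

infix 30 $_
$_ : ∀ {m} (i : ℕ) {i<m : True (i <? m)} → E m
($ i) {i<m} = var (#_ i {m<n = i<m})

eval : ∀ {m} → E m → E m → E m
eval c r = call zero (c ∷ r ∷ [])

append : ∀ {m} → E m → E m → E m
append xs ys = call (suc zero) (xs ∷ ys ∷ [])

forLoop chainLoop : ∀ {m} → E m → E m → E m → E m
forLoop   xs d r = call (suc (suc zero)) (xs ∷ d ∷ r ∷ [])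
chainLoop xs d r = call (suc (suc (suc zero))) (xs ∷ d ∷ r ∷ [])

-- The default `nat 0` is also the encoding of the empty list, so the two loops return the right
-- value at the end of their list.
unpair : ∀ {m} → E m → E (2 + m) → E m
unpair e = case e (nat 0)

-- Variables: 0 the tag, 1 the arguments, 2 the code, 3 the environment.
branches : Vec (E 4) 13
branches =
  unpair ($ 3) ($ 0) ∷
  unpair ($ 3) (eval ($ 3) ($ 1)) ∷
  $ 1 ∷
  succ (eval ($ 1) ($ 3)) ∷
  unpair ($ 1) (pair (eval ($ 0) ($ 5)) (eval ($ 1) ($ 5))) ∷
  unpair (eval ($ 1) ($ 3)) ($ 0) ∷
  unpair (eval ($ 1) ($ 3)) ($ 1) ∷
  unpair ($ 1) (if≤ (eval ($ 0) ($ 5)) (eval ($ 1) ($ 5)) (nat 1) (nat 0)) ∷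
  unpair ($ 1) (unpair ($ 1) (if≤ (nat 1) (eval ($ 2) ($ 7)) (eval ($ 0) ($ 7)) (eval ($ 1) ($ 7)))) ∷
  unpair ($ 1) (unpair ($ 1) (case (eval ($ 2) ($ 7)) (eval ($ 0) ($ 7)) (eval ($ 3) (pair ($ 0) (pair ($ 1) ($ 9)))))) ∷
  unpair ($ 1) (forLoop (eval ($ 0) ($ 5)) ($ 1) ($ 5)) ∷
  unpair ($ 1) (chainLoop (eval ($ 0) ($ 5)) ($ 1) ($ 5)) ∷
  unpair ($ 1) (eval ($ 1) (pair (eval ($ 0) ($ 5)) ($ 5))) ∷
  []

-- Smaller tags have been dealt with before, so `if≤` acts as a test for equality.
switch : ∀ {m l} → ℕ → Vec (E (suc m)) l → E (suc m)
switch k []       = nat 0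
switch k (e ∷ es) = if≤ ($ 0) (nat k) e (switch (suc k) es)

bodies : (f : Fin 4) → E (arities f)
bodies zero                = unpair ($ 0) (switch 0 branches)
bodies (suc zero)          = case ($ 0) ($ 1) (pair ($ 0) (append ($ 1) ($ 3)))
bodies (suc (suc zero))    = unpair ($ 0) (append (eval ($ 3) (pair ($ 0) ($ 4))) (forLoop ($ 1) ($ 3) ($ 4)))
bodies (suc (suc (suc _))) =
  unpair ($ 0)
    (let′ (chainLoop ($ 1) ($ 3) ($ 4))
    (let′ (eval ($ 4) (pair ($ 0) (pair ($ 1) ($ 5))))
    (case ($ 0) ($ 1) (pair ($ 0) ($ 3)))))

quoteV : ∀ {m} → Val → E m
quoteV (num i) = nat i
quoteV (a ∙ b) = pair (quoteV a) (quoteV b)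

interpreterOf : Val → Program
interpreterOf c = record
  { functions = 4
  ; arity     = arities
  ; body      = bodies
  ; main      = eval (quoteV c) (pair ($ 0) (nat 0))
  }

-- Constructs with the same effect on encodings share a tag: all constants quote a number, and
-- pairs, `some` and `cons` all build one `∙`.
code : ∀ {Γ τ} → Tm Γ τ → Val
code v₀            = num 0 ∙ num 0
code (wk t)        = num 1 ∙ code t
code (lit n)       = num 2 ∙ num n
code (bool b)      = num 2 ∙ enc boolᵗ b
code nil           = num 2 ∙ num 0
code none          = num 2 ∙ num 0
code (inc t)       = num 3 ∙ code t
code ⟨ t , u ⟩     = num 4 ∙ code t ∙ code u
code (some t u)    = num 4 ∙ code t ∙ code u
code (cons t u)    = num 4 ∙ code t ∙ code u
code (fst t)       = num 5 ∙ code t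
code (snd t)       = num 6 ∙ code t
code (leq t u)     = num 7 ∙ code t ∙ code u
code (ite t u w)   = num 8 ∙ code t ∙ code u ∙ code w
code (caseˡ t u w) = num 9 ∙ code t ∙ code u ∙ code w
code (for t u)     = num 10 ∙ code t ∙ code u
code (chain t u)   = num 11 ∙ code t ∙ code u
code (lets t u)    = num 12 ∙ code t ∙ code u

module Interpreter (c₀ : Val) where
  open Semantics (interpreterOf c₀)

  -- The bound is split as k + b so that k is a closed numeral in every use.
  record Ev {m} (ρ : Vec Val m) (e : E m) (v : Val) (k b : ℕ) : Set where
    constructor within
    field
      {steps}    : ℕ
      steps≤     : steps ≤ k + b
      derivation : ρ ⊢ e ⇓ v ∣ steps

  record Ev* {m l} (ρ : Vec Val m) (es : Vec (E m) l) (vs : Vec Val l) (k b : ℕ) : Set where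
    constructor within
    field
      {steps}    : ℕ
      steps≤     : steps ≤ k + b
      derivation : ρ ⊢* es ⇓ vs ∣ steps

  add-bounds : ∀ {t t′} k b k′ b′ → t ≤ k + b → t′ ≤ k′ + b′ → t + t′ ≤ (k + k′) + (b + b′)
  add-bounds k b k′ b′ h h′ = ≤-trans (+-mono-≤ h h′) (≤-reflexive (interchange +-commutativeSemigroup k b k′ b′))

  ev-var : ∀ {m} {ρ : Vec Val m} {x} → Ev ρ (var x) (lookup ρ x) 1 0
  ev-var = within ≤-refl ⇓var

  ev-nat : ∀ {m} {ρ : Vec Val m} {i} → Ev ρ (nat i) (num i) 1 0
  ev-nat = within ≤-refl ⇓nat

  ev-succ : ∀ {m} {ρ : Vec Val m} {e i k b} → Ev ρ e (num i) k b → Ev ρ (succ e) (num (suc i)) (suc k) b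
  ev-succ (within h d) = within (s≤s h) (⇓succ d)

  module _ {m} {ρ : Vec Val m} {k b k′ b′ : ℕ} where

    ev-pair : ∀ {e₁ e₂ v₁ v₂} → Ev ρ e₁ v₁ k b → Ev ρ e₂ v₂ k′ b′ → Ev ρ (pair e₁ e₂) (v₁ ∙ v₂) (suc (k + k′)) (b + b′)
    ev-pair (within h d) (within h′ d′) = within (s≤s (add-bounds k b k′ b′ h h′)) (⇓pair d d′)

    ev-case₀ : ∀ {e e₀ e₁ i v} → Ev ρ e (num i) k b → Ev ρ e₀ v k′ b′ → Ev ρ (case e e₀ e₁) v (suc (k + k′)) (b + b′)
    ev-case₀ (within h d) (within h′ d′) = within (s≤s (add-bounds k b k′ b′ h h′)) (⇓case₀ d d′)

    ev-case₁ : ∀ {e e₀ e₁ x y v} → Ev ρ e (x ∙ y) k b → Ev (x ∷ y ∷ ρ) e₁ v k′ b′ → Ev ρ (case e e₀ e₁) v (suc (k + k′)) (b + b′)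
    ev-case₁ (within h d) (within h′ d′) = within (s≤s (add-bounds k b k′ b′ h h′)) (⇓case₁ d d′)

    ev-let : ∀ {e e′ u v} → Ev ρ e u k b → Ev (u ∷ ρ) e′ v k′ b′ → Ev ρ (let′ e e′) v (suc (k + k′)) (b + b′)
    ev-let (within h d) (within h′ d′) = within (s≤s (add-bounds k b k′ b′ h h′)) (⇓let d d′)

    ev-call : ∀ {f es vs v} → Ev* ρ es vs k b → Ev vs (bodies f) v k′ b′ → Ev ρ (call f es) v (suc (k + k′)) (b + b′)
    ev-call (within h d) (within h′ d′) = within (s≤s (add-bounds k b k′ b′ h h′)) (⇓call d d′)

    infixr 5 _ev∷_
    _ev∷_ : ∀ {l e v} {es : Vec (E m) l} {vs} → Ev ρ e v k b → Ev* ρ es vs k′ b′ → Ev* ρ (e ∷ es) (v ∷ vs) (k + k′) (b + b′)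
    (within h d) ev∷ (within h′ d′) = within (add-bounds k b k′ b′ h h′) (⇓∷ d d′)

    module _ {k″ b″ : ℕ} where

      ev-yes : ∀ {e₁ e₂ e e′ i j v} → Ev ρ e₁ (num i) k b → Ev ρ e₂ (num j) k′ b′ → i ≤ j → Ev ρ e v k″ b″ →
               Ev ρ (if≤ e₁ e₂ e e′) v (suc ((k + k′) + k″)) ((b + b′) + b″)
      ev-yes (within h d) (within h′ d′) i≤j (within h″ d″) =
        within (s≤s (add-bounds (k + k′) (b + b′) k″ b″ (add-bounds k b k′ b′ h h′) h″)) (⇓yes d d′ i≤j d″)

      ev-no : ∀ {e₁ e₂ e e′ i j v} → Ev ρ e₁ (num i) k b → Ev ρ e₂ (num j) k′ b′ → j < i → Ev ρ e′ v k″ b″ →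
              Ev ρ (if≤ e₁ e₂ e e′) v (suc ((k + k′) + k″)) ((b + b′) + b″)
      ev-no (within h d) (within h′ d′) j<i (within h″ d″) =
        within (s≤s (add-bounds (k + k′) (b + b′) k″ b″ (add-bounds k b k′ b′ h h′) h″)) (⇓no d d′ j<i d″)

  ev[] : ∀ {m} {ρ : Vec Val m} → Ev* ρ [] [] 0 0
  ev[] = within z≤n ⇓[]

  ev-weaken : ∀ {m} {ρ : Vec Val m} {e v k b k′ b′} → k + b ≤ k′ + b′ → Ev ρ e v k b → Ev ρ e v k′ b′
  ev-weaken h (within h′ d) = within (≤-trans h′ h) (d)

  ev-quote : ∀ {m} {ρ : Vec Val m} v → Ev ρ (quoteV v) v (nodes v) 0
  ev-quote (num i) = ev-nat
  ev-quote (a ∙ b) = ev-pair (ev-quote a) (ev-quote b)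

  ev-switch : ∀ {m l} {ρ : Vec Val m} {i v k b} (es : Vec (E (suc m)) l) (j : Fin l) n → i ≡ n + toℕ j →
              Ev (num i ∷ ρ) (lookup es j) v k b → Ev (num i ∷ ρ) (switch n es) v (3 * suc (toℕ j) + k) b
  ev-switch (e ∷ es) zero n refl h =
    ev-yes ev-var ev-nat (≤-reflexive (+-identityʳ n)) h
  ev-switch {i = i} {k = k} {b = b} (e ∷ es) (suc j) n eq h =
    ev-weaken (≤-reflexive (cong (λ z → z + k + b) (sym (*-suc 3 (suc (toℕ j))))))
      (ev-no ev-var ev-nat n<i (ev-switch es j (suc n) (trans eq (+-suc n (toℕ j))) h))
    where
    n<i : n < i
    n<i = ≤-trans (m≤m+n (suc n) (toℕ j)) (≤-reflexive (sym (trans eq (+-suc n (toℕ j)))))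

  Evals : Val → Val → Val → ℕ → Set
  Evals c r v b = Ev (c ∷ r ∷ []) (bodies zero) v 0 b

  ev-eval : ∀ {m} {ρ : Vec Val m} {e₁ e₂ c r v k b k′ b′ b″} → Ev ρ e₁ c k b → Ev ρ e₂ r k′ b′ → Evals c r v b″ →
            Ev ρ (eval e₁ e₂) v (suc (k + (k′ + 0) + 0)) (b + (b′ + 0) + b″)
  ev-eval h₁ h₂ h = ev-call (h₁ ev∷ h₂ ev∷ ev[]) h

  -- Finding branch `j` costs 3 steps per comparison and `k` is the overhead of the branch itself;
  -- both are closed, so 98 is checked by computation. Two more steps take the code apart. The value
  -- 100 is merely a round bound for all branches.
  tagged : (j : Fin 13) → ∀ {args r v k b b′} →
           Ev (num (toℕ j) ∷ args ∷ (num (toℕ j) ∙ args) ∷ r ∷ []) (lookup branches j) v k b →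
           {T (3 * suc (toℕ j) + k ≤ᵇ 98)} → b ≤ b′ → Evals (num (toℕ j) ∙ args) r v (100 + b′)
  tagged j {k = k} h {k≤} b≤b′ =
    ev-weaken (s≤s (s≤s (+-mono-≤ (≤ᵇ⇒≤ (3 * suc (toℕ j) + k) 98 k≤) b≤b′))) (ev-case₁ ev-var (ev-switch branches j 0 refl h))

  -- An element costs 7 steps, rounded up to 10; in the two loops below the overheads 12 and 20 are
  -- rounded up to 30.
  ev-append : ∀ {τ} xs ys → Ev (encL τ xs ∷ encL τ ys ∷ []) (bodies (# 1)) (encL τ (xs ++ ys)) 0 (nodes (encL τ xs) * 10)
  ev-append []       ys = ev-weaken (s≤s (s≤s (s≤s z≤n))) (ev-case₀ ev-var ev-var)
  ev-append {τ} (x ∷ xs) ys = ev-weaken (+-mono-≤ {7} {10} (≤ᵇ⇒≤ 7 10 tt)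
        (*-monoˡ-≤ 10 (m≤n+m (nodes (encL τ xs)) (nodes (enc τ x)))))
    (ev-case₁ ev-var (ev-pair ev-var (ev-call (ev-var ev∷ ev-var ev∷ ev[]) (ev-append {τ} xs ys))))

  module _ {σ τ : Ty} {d r : Val} {L M S : ℕ} (f : ⟦ σ ⟧ᵗ → List ⟦ τ ⟧ᵗ)
           (evals : ∀ x → nodes (enc σ x) ≤ L → Evals d (enc σ x ∙ r) (encL τ (f x)) M)
           (small : ∀ x → nodes (enc σ x) ≤ L → nodes (encL τ (f x)) ≤ S) where

    ev-for : ∀ xs → nodes (encL σ xs) ≤ L →
             Ev (encL σ xs ∷ d ∷ r ∷ []) (bodies (# 2)) (encL τ (concatMap f xs)) 0 (nodes (encL σ xs) * (30 + (M + S * 10)))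
    ev-for [] _ = ev-weaken (s≤s (s≤s (s≤s z≤n))) (ev-case₀ ev-var ev-nat)
    ev-for (x ∷ xs) xs≤L = ev-weaken bound
      (ev-case₁ ev-var (ev-call (ev-eval ev-var (ev-pair ev-var ev-var) (evals x x≤L) ev∷
                                 ev-call (ev-var ev∷ ev-var ev∷ ev-var ev∷ ev[])
                                       (ev-for xs (≤-trans (tail-nodes {σ} x xs) xs≤L)) ev∷ ev[])
                                (ev-append {τ} (f x) (concatMap f xs))))
      where
      x≤L = ≤-trans (head-nodes {σ} x xs) xs≤L
      n = nodes (encL σ xs)
      Q = 30 + (M + S * 10)
      bound : 12 + (0 + (M + (n * Q + 0) + nodes (encL τ (f x)) * 10)) ≤ 0 + nodes (encL σ (x ∷ xs)) * Q
      bound = begin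
        12 + (M + (n * Q + 0) + nodes (encL τ (f x)) * 10)   ≤⟨ +-mono-≤ {12} {30} (≤ᵇ⇒≤ 12 30 tt)
              (+-monoʳ-≤ (M + (n * Q + 0)) (*-monoˡ-≤ 10 (small x x≤L))) ⟩
        30 + (M + (n * Q + 0) + S * 10)                      ≡⟨ cong (λ z → 30 + (M + z + S * 10)) (+-identityʳ _) ⟩
        30 + (M + n * Q + S * 10)                            ≡⟨ cong (30 +_)
              (trans (+-assoc M _ _) (trans (cong (M +_) (+-comm (n * Q) _)) (sym (+-assoc M _ _)))) ⟩
        30 + (M + S * 10 + n * Q)                            ≡⟨ +-assoc 30 (M + S * 10) (n * Q) ⟨
        suc n * Q                                            ≤⟨ *-monoˡ-≤ Q (s≤s (m≤n+m n (nodes (enc σ x)))) ⟩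
        nodes (encL σ (x ∷ xs)) * Q                          ∎
        where open ≤-Reasoning

  module _ {σ τ : Ty} {d r : Val} {L M : ℕ} (flat : T (isFlat τ)) (f : List ⟦ τ ⟧ᵗ → ⟦ σ ⟧ᵗ → List ⟦ τ ⟧ᵗ)
           (evals : ∀ acc x → nodes (encL τ acc) ≤ L * suc (flatNodes τ) → nodes (enc σ x) ≤ L → Evals d
                 (encL τ acc ∙ enc σ x ∙ r) (encL τ (f acc x)) M) where

    ev-chain : ∀ xs → nodes (encL σ xs) ≤ L →
               Ev (encL σ xs ∷ d ∷ r ∷ []) (bodies (# 3)) (encL τ (chainList f xs)) 0 (nodes (encL σ xs) * (30 + M))
    ev-chain [] _ = ev-weaken (s≤s (s≤s (s≤s z≤n))) (ev-case₀ ev-var ev-nat)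
    ev-chain (x ∷ xs) xs≤L = ev-weaken bound
      (ev-case₁ ev-var (ev-let (ev-call (ev-var ev∷ ev-var ev∷ ev-var ev∷ ev[])
            (ev-chain xs (≤-trans (tail-nodes {σ} x xs) xs≤L)))
                       (ev-let (ev-eval ev-var (ev-pair ev-var (ev-pair ev-var ev-var))
                             (evals acc x acc≤ (≤-trans (head-nodes {σ} x xs) xs≤L)))
                               (ev-push (f acc x)))))
      where
      acc = chainList f xs
      acc≤ : nodes (encL τ acc) ≤ L * suc (flatNodes τ)
      acc≤ = ≤-trans (chain-nodes {σ} {τ} flat f xs) (*-monoˡ-≤ (suc (flatNodes τ)) (≤-trans (tail-nodes {σ} x xs) xs≤L))
      ev-push : ∀ {m} {ρ : Vec Val m} ys → Ev (encL τ ys ∷ encL τ acc ∷ ρ) (case ($ 0) ($ 1) (pair ($ 0) ($ 3)))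
            (encL τ (push ys acc)) 5 0
      ev-push []      = ev-weaken (s≤s (s≤s (s≤s z≤n))) (ev-case₀ ev-var ev-var)
      ev-push (y ∷ _) = ev-case₁ ev-var (ev-pair ev-var ev-var)
      n = nodes (encL σ xs)
      Q = 30 + M
      bound : 20 + (n * Q + (M + 0)) ≤ 0 + nodes (encL σ (x ∷ xs)) * Q
      bound = begin
        20 + (n * Q + (M + 0))         ≤⟨ +-mono-≤ {20} {30} (≤ᵇ⇒≤ 20 30 tt)
              (≤-reflexive (trans (cong (n * Q +_) (+-identityʳ M)) (+-comm (n * Q) M))) ⟩
        30 + (M + n * Q)               ≡⟨ +-assoc 30 M (n * Q) ⟨
        suc n * Q                      ≤⟨ *-monoˡ-≤ Q (s≤s (m≤n+m n (nodes (enc σ x)))) ⟩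
        nodes (encL σ (x ∷ xs)) * Q    ∎
        where open ≤-Reasoning

-- Running times of terms

timeᵖ : ∀ {Γ τ} → Tm Γ τ → Poly
timeᵖ v₀          = κ 100 ⊞ κ 0
timeᵖ (wk t)      = κ 100 ⊞ timeᵖ t
timeᵖ (lit _)     = κ 100 ⊞ κ 0
timeᵖ (bool _)    = κ 100 ⊞ κ 0
timeᵖ nil         = κ 100 ⊞ κ 0
timeᵖ none        = κ 100 ⊞ κ 0
timeᵖ (inc t)     = κ 100 ⊞ timeᵖ t
timeᵖ ⟨ t , u ⟩   = κ 100 ⊞ (timeᵖ t ⊞ timeᵖ u)
timeᵖ (some t u)  = κ 100 ⊞ (timeᵖ t ⊞ timeᵖ u)
timeᵖ (cons t u)  = κ 100 ⊞ (timeᵖ t ⊞ timeᵖ u)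
timeᵖ (fst t)     = κ 100 ⊞ timeᵖ t
timeᵖ (snd t)     = κ 100 ⊞ timeᵖ t
timeᵖ (leq t u)   = κ 100 ⊞ (timeᵖ t ⊞ timeᵖ u)
timeᵖ (ite t u w) = κ 100 ⊞ (timeᵖ t ⊞ (timeᵖ u ⊞ timeᵖ w))
timeᵖ (caseˡ t u w) = κ 100 ⊞ (timeᵖ t ⊞ (timeᵖ u ⊞ timeᵖ w ⊙ (κ 1 ⊞ (sizeᵖ t ⊞ χ))))
timeᵖ (for t u)   = κ 100 ⊞ (timeᵖ t ⊞ sizeᵖ t ⊠ (κ 30 ⊞
      (timeᵖ u ⊙ (κ 1 ⊞ (sizeᵖ t ⊞ χ)) ⊞ sizeᵖ u ⊙ (κ 1 ⊞ (sizeᵖ t ⊞ χ)) ⊠ κ 10)))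
timeᵖ (chain {τ = τ} t u) =
  κ 100 ⊞ (timeᵖ t ⊞ sizeᵖ t ⊠ (κ 30 ⊞ timeᵖ u ⊙ (κ 1 ⊞ (sizeᵖ t ⊠ κ (suc (flatNodes τ)) ⊞ (κ 1 ⊞ (sizeᵖ t ⊞ χ))))))
timeᵖ (lets t u)  = κ 100 ⊞ (timeᵖ t ⊞ timeᵖ u ⊙ (κ 1 ⊞ (sizeᵖ t ⊞ χ)))

module Correctness (c₀ : Val) where
  open Interpreter c₀

  run : ∀ {Γ τ} (t : Tm Γ τ) (ρ : Env Γ) → Evals (code t) (encEnv ρ) (enc τ (⟦ t ⟧ ρ)) (timeᵖ t at ∣ ρ ∣ᵉ)

  runUnder : ∀ {Γ σ τ} (u : Tm (σ ∷ Γ) τ) (ρ : Env Γ) x {L} → nodes (enc σ x) ≤ L →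
             Evals (code u) (enc σ x ∙ encEnv ρ) (enc τ (⟦ u ⟧ (x ∷ ρ))) (timeᵖ u at suc (L + ∣ ρ ∣ᵉ))
  runUnder u ρ x h = ev-weaken (at-mono (timeᵖ u) (s≤s (+-monoˡ-≤ ∣ ρ ∣ᵉ h))) (run u (x ∷ ρ))

  loop-bound : ∀ a {m n} q → m ≤ n → a + 0 + m * q ≤ a + n * q
  loop-bound a q m≤n = +-mono-≤ (≤-reflexive (+-identityʳ a)) (*-monoˡ-≤ q m≤n)

  run v₀ (x ∷ ρ) = tagged (# 0) (ev-case₁ ev-var ev-var) z≤n
  run (wk t) (_∷_ {σ} x ρ) =
    tagged (# 1) (ev-case₁ ev-var (ev-eval ev-var ev-var (run t ρ))) (at-mono (timeᵖ t) (m≤n⇒m≤1+n (m≤n+m _ (nodes (enc σ x)))))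
  run (lit n)      ρ = tagged (# 2) ev-var z≤n
  run (bool true)  ρ = tagged (# 2) ev-var z≤n
  run (bool false) ρ = tagged (# 2) ev-var z≤n
  run nil          ρ = tagged (# 2) ev-var z≤n
  run none         ρ = tagged (# 2) ev-var z≤n
  run (inc t)      ρ = tagged (# 3) (ev-succ (ev-eval ev-var ev-var (run t ρ))) ≤-refl
  run ⟨ t , u ⟩    ρ = tagged (# 4) (ev-case₁ ev-var (ev-pair (ev-eval ev-var ev-var (run t ρ))
        (ev-eval ev-var ev-var (run u ρ)))) ≤-refl
  run (some t u)   ρ = tagged (# 4) (ev-case₁ ev-var (ev-pair (ev-eval ev-var ev-var (run t ρ))
        (ev-eval ev-var ev-var (run u ρ)))) ≤-refl
  run (cons t u)   ρ = tagged (# 4) (ev-case₁ ev-var (ev-pair (ev-eval ev-var ev-var (run t ρ))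
        (ev-eval ev-var ev-var (run u ρ)))) ≤-refl
  run (fst t)      ρ = tagged (# 5) (ev-case₁ (ev-eval ev-var ev-var (run t ρ)) ev-var) (≤-reflexive (+-identityʳ _))
  run (snd t)      ρ = tagged (# 6) (ev-case₁ (ev-eval ev-var ev-var (run t ρ)) ev-var) (≤-reflexive (+-identityʳ _))
  run (leq t u)    ρ with ⟦ t ⟧ ρ ≤ᵇ ⟦ u ⟧ ρ | ≤ᵇ-reflects-≤ (⟦ t ⟧ ρ) (⟦ u ⟧ ρ)
  ... | true  | ofʸ i≤j = tagged (# 7) (ev-case₁ ev-var (ev-yes (ev-eval ev-var ev-var (run t ρ))
        (ev-eval ev-var ev-var (run u ρ)) i≤j ev-nat)) (≤-reflexive (+-identityʳ _))
  ... | false | ofⁿ i≰j = tagged (# 7) (ev-case₁ ev-var (ev-no (ev-eval ev-var ev-var (run t ρ))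
        (ev-eval ev-var ev-var (run u ρ)) (≰⇒> i≰j) ev-nat)) (≤-reflexive (+-identityʳ _))
  run (ite t u w)  ρ with ⟦ t ⟧ ρ | run t ρ
  ... | true  | h = tagged (# 8) (ev-case₁ ev-var (ev-case₁ ev-var
        (ev-yes ev-nat (ev-eval ev-var ev-var h) ≤-refl (ev-eval ev-var ev-var (run u ρ)))))
        (+-monoʳ-≤ (timeᵖ t at ∣ ρ ∣ᵉ) (m≤m+n _ _))
  ... | false | h = tagged (# 8) (ev-case₁ ev-var (ev-case₁ ev-var
        (ev-no ev-nat (ev-eval ev-var ev-var h) ≤-refl (ev-eval ev-var ev-var (run w ρ)))))
        (+-monoʳ-≤ (timeᵖ t at ∣ ρ ∣ᵉ) (m≤n+m _ (timeᵖ u at ∣ ρ ∣ᵉ)))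
  run (caseˡ {σ = σ} t u w) ρ with ⟦ t ⟧ ρ | run t ρ | size-bound t ρ
  ... | []     | h | _ = tagged (# 9) (ev-case₁ ev-var (ev-case₁ ev-var
        (ev-case₀ (ev-eval ev-var ev-var h) (ev-eval ev-var ev-var (run u ρ)))))
        (+-monoʳ-≤ (timeᵖ t at ∣ ρ ∣ᵉ) (m≤m+n _ _))
  ... | x ∷ xs | h | s = tagged (# 9) (ev-case₁ ev-var (ev-case₁ ev-var
        (ev-case₁ (ev-eval ev-var ev-var h) (ev-eval ev-var (ev-pair ev-var (ev-pair ev-var ev-var))
        (run w (x ∷ xs ∷ ρ))))))
      (+-monoʳ-≤ (timeᵖ t at ∣ ρ ∣ᵉ) (≤-trans (at-mono (timeᵖ w)
            (s≤s (≤-trans (≤-reflexive (trans (+-suc _ _) (cong suc (sym (+-assoc (nodes (enc σ x)) _ _)))))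
            (+-monoˡ-≤ ∣ ρ ∣ᵉ s)))) (m≤n+m _ (timeᵖ u at ∣ ρ ∣ᵉ))))
  run (for {σ = σ} {τ} t u) ρ =
    tagged (# 10) (ev-case₁ ev-var (ev-call (ev-eval ev-var ev-var (run t ρ) ev∷ ev-var ev∷ ev-var ev∷ ev[])
        (ev-for {σ} {τ} (λ x → ⟦ u ⟧ (x ∷ ρ)) (λ x → runUnder u ρ x)
              (λ x h → ≤-trans (size-bound u (x ∷ ρ)) (at-mono (sizeᵖ u) (s≤s (+-monoˡ-≤ ∣ ρ ∣ᵉ h)))) (⟦ t ⟧ ρ)
              (size-bound t ρ))))
      (loop-bound (timeᵖ t at ∣ ρ ∣ᵉ) _ (size-bound t ρ))
  run (chain {σ = σ} {τ} {flat} t u) ρ =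
    tagged (# 11) (ev-case₁ ev-var (ev-call (ev-eval ev-var ev-var (run t ρ) ev∷ ev-var ev∷ ev-var ev∷ ev[])
        (ev-chain {σ} {τ} flat (λ acc x → ⟦ u ⟧ (acc ∷ x ∷ ρ))
              (λ acc x hacc hx → ev-weaken (at-mono (timeᵖ u) (s≤s (+-mono-≤ hacc (s≤s (+-monoˡ-≤ ∣ ρ ∣ᵉ hx)))))
              (run u (acc ∷ x ∷ ρ))) (⟦ t ⟧ ρ) (size-bound t ρ))))
      (loop-bound (timeᵖ t at ∣ ρ ∣ᵉ) _ (size-bound t ρ))
  run (lets t u) ρ =
    tagged (# 12) (ev-case₁ ev-var (ev-eval ev-var (ev-pair (ev-eval ev-var ev-var (run t ρ)) ev-var)
          (runUnder u ρ (⟦ t ⟧ ρ) (size-bound t ρ))))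
      (+-monoˡ-≤ _ (≤-reflexive (trans (+-identityʳ (timeᵖ t at ∣ ρ ∣ᵉ + 0)) (+-identityʳ _))))

programOf : ∀ {σ τ} → Tm (σ ∷ []) τ → Program
programOf t = interpreterOf (code t)

abstract
  -- The input and output are given up to equations because the encodings of instances and answers
  -- agree with `enc` only propositionally. The constants stay abstract, so that they are never
  -- computed for the actual algorithm.
  polynomial-time : ∀ {σ τ} (t : Tm (σ ∷ []) τ) → ∃[ c ] ∃[ d ]
        (∀ {input output} x → input ≡ enc σ x → enc τ (⟦ t ⟧ (x ∷ [])) ≡ output →
    programOf t on input outputs output within (c * size input ^ d))
  polynomial-time {σ} {τ} t = c , d , λ { x refl refl → Ev.steps (ev x) , ≤-trans (Ev.steps≤ (ev x)) (bound x) ,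
        Ev.derivation (ev x) }
    where
    open Interpreter (code t)
    open Correctness (code t)
    k : ℕ
    k = suc (nodes (code t) + (3 + 0) + 0)
    p : Poly
    -- Here `k` pays for quoting the code and setting up the call; the inner polynomial is the size
    -- of the environment that holds only the input.
    p = κ k ⊞ timeᵖ t ⊙ (κ 1 ⊞ (χ ⊞ κ 1))
    c : ℕ
    c = proj₁ (monomial-bound p)
    d : ℕ
    d = proj₁ (proj₂ (monomial-bound p))
    ev : ∀ x → Ev (enc σ x ∷ []) (Program.main (programOf t)) (enc τ (⟦ t ⟧ (x ∷ []))) k (timeᵖ t at suc (nodes (enc σ x) + 1))
    ev x = ev-eval (ev-quote (code t)) (ev-pair ev-var ev-nat) (run t (x ∷ []))
    bound : ∀ x → k + timeᵖ t at suc (nodes (enc σ x) + 1) ≤ c * size (enc σ x) ^ d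
    bound x = ≤-trans (+-monoʳ-≤ k (at-mono (timeᵖ t) (s≤s (+-monoˡ-≤ 1 (nodes≤size (enc σ x))))))
                      (proj₂ (proj₂ (monomial-bound p)) (size (enc σ x)) (≤-trans (1≤nodes (enc σ x)) (nodes≤size (enc σ x))))

v₁ : ∀ {Γ τ σ} → Tm (σ ∷ τ ∷ Γ) τ
v₁ = wk v₀
v₂ : ∀ {Γ τ σ₀ σ₁} → Tm (σ₀ ∷ σ₁ ∷ τ ∷ Γ) τ
v₂ = wk v₁
v₃ : ∀ {Γ τ σ₀ σ₁ σ₂} → Tm (σ₀ ∷ σ₁ ∷ σ₂ ∷ τ ∷ Γ) τ
v₃ = wk v₂
v₄ : ∀ {Γ τ σ₀ σ₁ σ₂ σ₃} → Tm (σ₀ ∷ σ₁ ∷ σ₂ ∷ σ₃ ∷ τ ∷ Γ) τ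
v₄ = wk v₃
v₅ : ∀ {Γ τ σ₀ σ₁ σ₂ σ₃ σ₄} → Tm (σ₀ ∷ σ₁ ∷ σ₂ ∷ σ₃ ∷ σ₄ ∷ τ ∷ Γ) τ
v₅ = wk v₄
v₆ : ∀ {Γ τ σ₀ σ₁ σ₂ σ₃ σ₄ σ₅} → Tm (σ₀ ∷ σ₁ ∷ σ₂ ∷ σ₃ ∷ σ₄ ∷ σ₅ ∷ τ ∷ Γ) τ
v₆ = wk v₅
v₇ : ∀ {Γ τ σ₀ σ₁ σ₂ σ₃ σ₄ σ₅ σ₆} → Tm (σ₀ ∷ σ₁ ∷ σ₂ ∷ σ₃ ∷ σ₄ ∷ σ₅ ∷ σ₆ ∷ τ ∷ Γ) τ
v₇ = wk v₆
v₈ : ∀ {Γ τ σ₀ σ₁ σ₂ σ₃ σ₄ σ₅ σ₆ σ₇} → Tm (σ₀ ∷ σ₁ ∷ σ₂ ∷ σ₃ ∷ σ₄ ∷ σ₅ ∷ σ₆ ∷ σ₇ ∷ τ ∷ Γ) τ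
v₈ = wk v₇

-- Formulas

infix  8 _≼_ _≐_
infixr 7 _∧ᶠ_
infixr 6 _∨ᶠ_

-- All tests of the algorithm are written as formulas, so that `test-reflects` replaces every
-- Boolean computation by the proposition `Holds`, which unfolds to ordinary statements about
-- numbers.
data Fm (Γ : List Ty) : Set where
  _≼_ _≐_   : Tm Γ natᵗ → Tm Γ natᵗ → Fm Γ
  _∧ᶠ_ _∨ᶠ_ : Fm Γ → Fm Γ → Fm Γ
  ¬ᶠ_       : Fm Γ → Fm Γ
  ∃ᶠ        : ∀ {σ} → Tm Γ (listᵗ σ) → Fm (σ ∷ Γ) → Fm Γ

Holds : ∀ {Γ} → Fm Γ → Env Γ → Set
Holds (t ≼ u) ρ  = ⟦ t ⟧ ρ ≤ ⟦ u ⟧ ρ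
Holds (t ≐ u) ρ  = ⟦ t ⟧ ρ ≡ ⟦ u ⟧ ρ
Holds (φ ∧ᶠ ψ) ρ = Holds φ ρ × Holds ψ ρ
Holds (φ ∨ᶠ ψ) ρ = Holds φ ρ ⊎ Holds ψ ρ
Holds (¬ᶠ φ) ρ   = ¬ Holds φ ρ
Holds (∃ᶠ t φ) ρ = Any (λ x → Holds φ (x ∷ ρ)) (⟦ t ⟧ ρ)

test : ∀ {Γ} → Fm Γ → Tm Γ boolᵗ
test (t ≼ u)  = leq t u
test (t ≐ u)  = ite (leq t u) (leq u t) (bool false)
test (φ ∧ᶠ ψ) = ite (test φ) (test ψ) (bool false)
test (φ ∨ᶠ ψ) = ite (test φ) (bool true) (test ψ)
test (¬ᶠ φ)   = ite (test φ) (bool false) (bool true)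
test (∃ᶠ t φ) = caseˡ (for t (ite (test φ) (cons v₀ nil) nil)) (bool false) (bool true)

test-reflects : ∀ {Γ} (φ : Fm Γ) (ρ : Env Γ) → Reflects (Holds φ ρ) (⟦ test φ ⟧ ρ)
test-reflects (t ≼ u)  ρ = ≤ᵇ-reflects-≤ (⟦ t ⟧ ρ) (⟦ u ⟧ ρ)
test-reflects (t ≐ u)  ρ with ⟦ t ⟧ ρ ≤ᵇ ⟦ u ⟧ ρ | ≤ᵇ-reflects-≤ (⟦ t ⟧ ρ) (⟦ u ⟧ ρ) | ⟦ u ⟧ ρ ≤ᵇ ⟦ t ⟧ ρ |
      ≤ᵇ-reflects-≤ (⟦ u ⟧ ρ) (⟦ t ⟧ ρ)
... | true  | ofʸ h | true  | ofʸ h′ = ofʸ (≤-antisym h h′)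
... | true  | _     | false | ofⁿ h  = ofⁿ λ eq → h (≤-reflexive (sym eq))
... | false | ofⁿ h | _     | _      = ofⁿ λ eq → h (≤-reflexive eq)
test-reflects (φ ∧ᶠ ψ) ρ with ⟦ test φ ⟧ ρ | test-reflects φ ρ
... | true  | ofʸ a = ofʸ a ×-reflects test-reflects ψ ρ
... | false | ofⁿ a = ofⁿ a ×-reflects test-reflects ψ ρ
test-reflects (φ ∨ᶠ ψ) ρ with ⟦ test φ ⟧ ρ | test-reflects φ ρ
... | true  | ofʸ a = ofʸ a ⊎-reflects test-reflects ψ ρ
... | false | ofⁿ a = ofⁿ a ⊎-reflects test-reflects ψ ρ
test-reflects (¬ᶠ φ)   ρ with ⟦ test φ ⟧ ρ | test-reflects φ ρ
... | true  | r = ¬-reflects r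
... | false | r = ¬-reflects r
test-reflects (∃ᶠ {σ} t φ) ρ = search (⟦ t ⟧ ρ)
  where
  search : ∀ xs → Reflects (Any (λ x → Holds φ (x ∷ ρ)) xs)
    (caseList (concatMap (λ x → if ⟦ test φ ⟧ (x ∷ ρ) then x ∷ [] else []) xs) false (λ _ _ → true))
  search [] = ofⁿ λ ()
  search (x ∷ xs) with ⟦ test φ ⟧ (x ∷ ρ) | test-reflects φ (x ∷ ρ)
  ... | true  | ofʸ a = ofʸ (here a)
  ... | false | ofⁿ a with caseList (concatMap (λ x → if ⟦ test φ ⟧ (x ∷ ρ) then x ∷ [] else []) xs) false
        (λ _ _ → true) | search xs
  ...   | true  | ofʸ as = ofʸ (there as)
  ...   | false | ofⁿ as = ofⁿ λ { (here a′) → a a′ ; (there as′) → as as′ }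

select : ∀ {Γ σ} → Tm Γ (listᵗ σ) → Fm (σ ∷ Γ) → Tm Γ (listᵗ σ)
select t φ = for t (ite (test φ) (cons v₀ nil) nil)

∈-concatMap⁻ : ∀ {X Y : Set} (f : X → List Y) xs {y} → y ∈ concatMap f xs → ∃[ x ] (x ∈ xs × y ∈ f x)
∈-concatMap⁻ f (x ∷ xs) y∈ with ∈-++⁻ (f x) y∈
... | inj₁ h = x , here refl , h
... | inj₂ h with ∈-concatMap⁻ f xs h
...   | x′ , x′∈ , h′ = x′ , there x′∈ , h′

∈-concatMap⁺ : ∀ {X Y : Set} (f : X → List Y) {xs x y} → x ∈ xs → y ∈ f x → y ∈ concatMap f xs
∈-concatMap⁺ f (here refl) h = ∈-++⁺ˡ h
∈-concatMap⁺ f {x′ ∷ _} (there x∈) h = ∈-++⁺ʳ (f x′) (∈-concatMap⁺ f x∈ h)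

module _ {Γ} (φ : Fm Γ) (ρ : Env Γ) {X : Set} where

  ∈-guard⁻ : ∀ {x y : X} → y ∈ (if ⟦ test φ ⟧ ρ then x ∷ [] else []) → y ≡ x × Holds φ ρ
  ∈-guard⁻ h with ⟦ test φ ⟧ ρ | test-reflects φ ρ
  ∈-guard⁻ (here eq) | true | ofʸ a = eq , a

  ∈-guard⁺ : ∀ {x : X} → Holds φ ρ → x ∈ (if ⟦ test φ ⟧ ρ then x ∷ [] else [])
  ∈-guard⁺ a with ⟦ test φ ⟧ ρ | test-reflects φ ρ
  ... | true  | _ = here refl
  ... | false | ofⁿ ¬a with () ← ¬a a

module _ {Γ σ} (t : Tm Γ (listᵗ σ)) (φ : Fm (σ ∷ Γ)) (ρ : Env Γ) where

  ∈-select⁻ : ∀ {x} → x ∈ ⟦ select t φ ⟧ ρ → x ∈ ⟦ t ⟧ ρ × Holds φ (x ∷ ρ)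
  ∈-select⁻ x∈ with ∈-concatMap⁻ _ (⟦ t ⟧ ρ) x∈
  ... | x′ , x′∈ , h with refl , a ← ∈-guard⁻ φ (x′ ∷ ρ) h = x′∈ , a

  ∈-select⁺ : ∀ {x} → x ∈ ⟦ t ⟧ ρ → Holds φ (x ∷ ρ) → x ∈ ⟦ select t φ ⟧ ρ
  ∈-select⁺ {x} x∈ a = ∈-concatMap⁺ _ x∈ (∈-guard⁺ φ (x ∷ ρ) a)

-- The algorithm

-- A slot is an edge uv directed from A towards B along its path.  A link is the slot traversed before
-- (BB if there is none) together with a slot.
point link edge : Ty
point = natᵗ ⊗ natᵗ
link  = point ⊗ point
edge  = natᵗ ⊗ (natᵗ ⊗ natᵗ)

Nats : ℕ → Ty
Nats zero    = natᵗ
Nats (suc k) = natᵗ ⊗ Nats k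

-- A fact proposes, for a slot uv: labels i₁, i₂ of the edge and times t₁, t₂ to which they are delayed, used in
-- reaching vertices from A and from B respectively; arrival times αu, αv from A and βu, βv from B; the global
-- values a (arrival at B from A), b (arrival at A from B) and T (deadline); and flags X and Y, which are nonzero
-- only if some slot so far is the last step of A's walk to B, respectively of B's walk to A.
fact : Ty
fact = link ⊗ Nats 13

Input : Ty
Input = (natᵗ ⊗ listᵗ edge) ⊗ listᵗ natᵗ

bothWays : ∀ {Γ} → Tm Γ (listᵗ edge) → Tm Γ (listᵗ point)
bothWays es = for es (cons ⟨ fst v₀ , fst (snd v₀) ⟩ (cons ⟨ fst (snd v₀) , fst v₀ ⟩ nil))

-- Before its first slot the walk counts as standing at `b`, as if a path had just been completed.
-- The first path then starts by the same rule as the others.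
lastSlot : ∀ {Γ} → Tm Γ (listᵗ link) → Tm Γ natᵗ → Tm Γ point
lastSlot acc b = caseˡ acc ⟨ b , b ⟩ (snd v₀)

_≐²_ : ∀ {Γ} → Tm Γ point → Tm Γ point → Fm Γ
p ≐² q = fst p ≐ fst q ∧ᶠ snd p ≐ snd q

-- e extends a walk that has traversed the slots in acc, the last one being h.
extends : ∀ {Γ} (a b : Tm Γ natᵗ) (acc : Tm Γ (listᵗ link)) (h e : Tm Γ point) → Fm Γ
extends a b acc h e =
  (snd h ≐ b ∧ᶠ fst e ≐ a ∧ᶠ ¬ᶠ ∃ᶠ acc (snd v₀ ≐² wk e)) ∨ᶠ
  (¬ᶠ (snd h ≐ b) ∧ᶠ fst e ≐ snd h ∧ᶠ ¬ᶠ (snd e ≐ fst h))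

Γ₃ Γ₄ Γ₅ Γ₆ Γ₇ : List Ty
Γ₃ = natᵗ ∷ natᵗ ∷ listᵗ edge ∷ Input ∷ []
Γ₄ = listᵗ link ∷ Γ₃
Γ₅ = listᵗ natᵗ ∷ Γ₄
Γ₆ = listᵗ fact ∷ Γ₅
Γ₇ = listᵗ fact ∷ Γ₆

slotsStep : Tm (listᵗ link ∷ point ∷ Γ₃) (listᵗ link)
slotsStep =
  lets (lastSlot v₀ v₂)
    (for (select (bothWays v₅) (extends v₅ v₄ v₂ v₁ v₀)) (cons ⟨ v₁ , v₀ ⟩ nil))

-- The list is only a clock. It allows one round more than there are directed edges, so a walk that
-- extended itself in every round would have to repeat a slot.
slotsT : Tm Γ₃ (listᵗ link)
slotsT = chain (cons ⟨ lit 0 , lit 0 ⟩ (bothWays v₂)) slotsStep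

labels₀ : ∀ {Γ} → Tm Γ (listᵗ edge) → Tm Γ (listᵗ natᵗ)
labels₀ es = cons (lit 0) (for es (cons (snd (snd v₀)) nil))

rampStep : ∀ {Γ σ} → Tm (listᵗ natᵗ ∷ σ ∷ natᵗ ∷ Γ) (listᵗ natᵗ)
rampStep = caseˡ v₀ (cons v₂ nil) (cons (inc v₀) nil)

-- For every base `l` the inner chain counts from `l` up to `l` plus the length of the edge list:
-- its clock, the labels with an extra 0, has one round more than there are edges in that list.
candT : Tm Γ₄ (listᵗ natᵗ)
candT = for (labels₀ v₃) (chain (labels₀ v₄) rampStep)

-- The exponent `k` is fixed, so there are polynomially many tuples. This is affordable because a
-- fact has a constant number of entries.
tuples : ∀ {Γ} k → Tm Γ (listᵗ natᵗ) → Tm Γ (listᵗ (Nats k))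
tuples zero    c = cons (lit 0) nil
tuples (suc k) c = for c (for (tuples k (wk c)) (cons ⟨ v₁ , v₀ ⟩ nil))

module _ {Γ} (f : Tm Γ fact) where
  prevᵉ slotᵉ : Tm Γ point
  prevᵉ = fst (fst f)
  slotᵉ = snd (fst f)
  uᵉ vᵉ i₁ᵉ t₁ᵉ i₂ᵉ t₂ᵉ αuᵉ αvᵉ βuᵉ βvᵉ aᵉ bᵉ Tᵉ Xᵉ Yᵉ : Tm Γ natᵗ
  uᵉ  = fst slotᵉ
  vᵉ  = snd slotᵉ
  i₁ᵉ = fst (snd f)
  t₁ᵉ = fst (snd (snd f))
  i₂ᵉ = fst (snd (snd (snd f)))
  t₂ᵉ = fst (snd (snd (snd (snd f))))
  αuᵉ = fst (snd (snd (snd (snd (snd f)))))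
  αvᵉ = fst (snd (snd (snd (snd (snd (snd f))))))
  βuᵉ = fst (snd (snd (snd (snd (snd (snd (snd f)))))))
  βvᵉ = fst (snd (snd (snd (snd (snd (snd (snd (snd f))))))))
  aᵉ  = fst (snd (snd (snd (snd (snd (snd (snd (snd (snd f)))))))))
  bᵉ  = fst (snd (snd (snd (snd (snd (snd (snd (snd (snd (snd f))))))))))
  Tᵉ  = fst (snd (snd (snd (snd (snd (snd (snd (snd (snd (snd (snd f)))))))))))
  Xᵉ  = fst (snd (snd (snd (snd (snd (snd (snd (snd (snd (snd (snd (snd f))))))))))))
  Yᵉ  = fst (snd (snd (snd (snd (snd (snd (snd (snd (snd (snd (snd (snd (snd f)))))))))))))

  fwdAᶠ bwdAᶠ fwdBᶠ bwdBᶠ : Fm Γ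
  fwdAᶠ = inc αuᵉ ≼ αvᵉ ∧ᶠ αvᵉ ≐ t₁ᵉ
  bwdAᶠ = inc αvᵉ ≼ αuᵉ ∧ᶠ αuᵉ ≐ t₁ᵉ
  fwdBᶠ = inc βuᵉ ≼ βvᵉ ∧ᶠ βvᵉ ≐ t₂ᵉ
  bwdBᶠ = inc βvᵉ ≼ βuᵉ ∧ᶠ βuᵉ ≐ t₂ᵉ

  module _ (a b : Tm Γ natᵗ) where
    -- No slot starts at `B`, so a preceding slot that does is the dummy one before the whole walk.
    initialᶠ : Fm Γ
    initialᶠ = fst prevᵉ ≐ b ∧ᶠ (Xᵉ ≐ lit 0 ∨ᶠ vᵉ ≐ b ∧ᶠ fwdAᶠ) ∧ᶠ (Yᵉ ≐ lit 0 ∨ᶠ uᵉ ≐ a ∧ᶠ bwdBᶠ)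

joins : ∀ {Γ} (e : Tm Γ edge) (f : Tm Γ fact) → Fm Γ
joins e f = fst e ≐ uᵉ f ∧ᶠ fst (snd e) ≐ vᵉ f ∨ᶠ fst e ≐ vᵉ f ∧ᶠ fst (snd e) ≐ uᵉ f

-- A single label cannot be moved to two different times, whence the condition on `i₁` and `i₂`. The
-- last two conditions tie the ends of every path to the same guessed values.
okᶠ : ∀ {Γ} (es : Tm Γ (listᵗ edge)) (a b : Tm Γ natᵗ) (f : Tm Γ fact) → Fm Γ
okᶠ es a b f =
  ∃ᶠ es (joins v₀ (wk f) ∧ᶠ snd (snd v₀) ≐ wk (i₁ᵉ f)) ∧ᶠ
  ∃ᶠ es (joins v₀ (wk f) ∧ᶠ snd (snd v₀) ≐ wk (i₂ᵉ f)) ∧ᶠ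
  i₁ᵉ f ≼ t₁ᵉ f ∧ᶠ i₂ᵉ f ≼ t₂ᵉ f ∧ᶠ
  (¬ᶠ (i₁ᵉ f ≐ i₂ᵉ f) ∨ᶠ t₁ᵉ f ≐ t₂ᵉ f) ∧ᶠ
  αuᵉ f ≼ Tᵉ f ∧ᶠ αvᵉ f ≼ Tᵉ f ∧ᶠ βuᵉ f ≼ Tᵉ f ∧ᶠ βvᵉ f ≼ Tᵉ f ∧ᶠ
  (¬ᶠ (uᵉ f ≐ a) ∨ᶠ αuᵉ f ≐ lit 0 ∧ᶠ βuᵉ f ≐ bᵉ f) ∧ᶠ
  (¬ᶠ (vᵉ f ≐ b) ∨ᶠ αvᵉ f ≐ aᵉ f ∧ᶠ βvᵉ f ≐ lit 0)

-- At the vertex shared by two slots of a path the times must agree, and the arrival from each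
-- source has its cause either in `g`, used forwards, or in `f`, used backwards. If `g` completes a
-- path, there is no shared vertex; the times at the endpoints are justified by the flags. A flag
-- may be set only if it was set before or the present slot earns it.
stepᶠ : ∀ {Γ} (a b : Tm Γ natᵗ) (g f : Tm Γ fact) → Fm Γ
stepᶠ a b g f =
  slotᵉ g ≐² prevᵉ f ∧ᶠ
  aᵉ g ≐ aᵉ f ∧ᶠ bᵉ g ≐ bᵉ f ∧ᶠ Tᵉ g ≐ Tᵉ f ∧ᶠ
  (Xᵉ f ≐ lit 0 ∨ᶠ lit 1 ≼ Xᵉ g ∨ᶠ vᵉ f ≐ b ∧ᶠ fwdAᶠ f) ∧ᶠ
  (Yᵉ f ≐ lit 0 ∨ᶠ lit 1 ≼ Yᵉ g ∨ᶠ uᵉ f ≐ a ∧ᶠ bwdBᶠ f) ∧ᶠ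
  (vᵉ g ≐ b ∨ᶠ αvᵉ g ≐ αuᵉ f ∧ᶠ βvᵉ g ≐ βuᵉ f ∧ᶠ (fwdAᶠ g ∨ᶠ bwdAᶠ f) ∧ᶠ (fwdBᶠ g ∨ᶠ bwdBᶠ f))

finalᶠ : ∀ {Γ} (ls : Tm Γ (listᵗ link)) (b : Tm Γ natᵗ) (f : Tm Γ fact) → Fm Γ
finalᶠ ls b f = slotᵉ f ≐² lastSlot ls b ∧ᶠ lit 1 ≼ Xᵉ f ∧ᶠ lit 1 ≼ Yᵉ f

allFacts : Tm Γ₅ (listᵗ fact)
allFacts = for v₁ (for (tuples 13 v₁) (cons ⟨ v₁ , v₀ ⟩ nil))

derivable : Fm (listᵗ fact ∷ fact ∷ Γ₅)
derivable = okᶠ v₆ v₅ v₄ v₁ ∧ᶠ (initialᶠ v₁ v₅ v₄ ∨ᶠ ∃ᶠ v₀ (stepᶠ v₆ v₅ v₀ v₂))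

-- The list of slots has the latest one first and `chain` starts from the end, so all facts for a
-- slot are decided before those for the slot that follows it in the walk.
factsT : Tm Γ₅ (listᵗ fact)
factsT = chain allFacts (ite (test derivable) (cons v₁ nil) nil)

minimalFinal : Fm (fact ∷ listᵗ fact ∷ link ∷ Γ₆)
minimalFinal = finalᶠ v₅ v₆ v₀ ∧ᶠ ¬ᶠ ∃ᶠ v₃ (finalᶠ v₆ v₇ v₀ ∧ᶠ inc (Tᵉ v₀) ≼ Tᵉ v₁)

-- The derivation is traced backwards from a final fact with the least deadline. No provenance is
-- stored: every fact that is not initial has a predecessor in the table, and any predecessor will
-- do.
selectStep : Tm (listᵗ fact ∷ link ∷ Γ₆) (listᵗ fact)
selectStep = caseˡ v₀ (select v₂ minimalFinal) (select v₄ (stepᶠ (wk v₈) v₈ v₀ v₁))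

selectT : Tm Γ₆ (listᵗ fact)
selectT = chain v₂ selectStep

newLabel : Tm (edge ∷ Γ₇) natᵗ
newLabel = caseˡ (select v₁ (joins v₁ v₀)) (snd (snd v₀))
  (ite (test (snd (snd v₂) ≐ i₁ᵉ v₀)) (t₁ᵉ v₀) (ite (test (snd (snd v₂) ≐ i₂ᵉ v₀)) (t₂ᵉ v₀) (snd (snd v₂))))

relabelled : Tm Γ₇ (listᵗ edge)
relabelled = for v₆ (cons ⟨ fst v₀ , ⟨ fst (snd v₀) , newLabel ⟩ ⟩ nil)

repeated : ∀ {Γ} → Fm (listᵗ edge ∷ edge ∷ Γ)
repeated = ∃ᶠ v₀ (fst v₀ ≐ fst v₂ ∧ᶠ fst (snd v₀) ≐ fst (snd v₂) ∧ᶠ snd (snd v₀) ≐ snd (snd v₂))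

-- Different labels of one edge may be delayed to the same time, while a temporal graph lists each
-- time edge once.
dedup : ∀ {Γ} → Tm Γ (listᵗ edge) → Tm Γ (listᵗ edge)
dedup es = chain es (ite (test (¬ᶠ repeated)) (cons v₁ nil) nil)

answerT : Tm Γ₇ (optᵗ natᵗ (listᵗ edge))
answerT = caseˡ v₀ none (some (fst (fst (wk (wk v₇)))) (wk (wk (dedup relabelled))))

-- The nested `lets` are named one by one so that the correctness proof can pass each of them with
-- its value replaced by a variable.
fromFacts : Tm Γ₆ (optᵗ natᵗ (listᵗ edge))
fromFacts = lets selectT answerT

fromCandidates : Tm Γ₅ (optᵗ natᵗ (listᵗ edge))
fromCandidates = lets factsT fromFacts

fromSlots : Tm Γ₄ (optᵗ natᵗ (listᵗ edge))
fromSlots = lets candT fromCandidates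

fromEnds : Tm Γ₃ (optᵗ natᵗ (listᵗ edge))
fromEnds = lets slotsT fromSlots

firstSource : Tm (listᵗ edge ∷ Input ∷ []) natᵗ
firstSource = caseˡ (snd v₁) (lit 0) v₀

secondSource : Tm (natᵗ ∷ listᵗ edge ∷ Input ∷ []) natᵗ
secondSource = caseˡ (snd v₂) (lit 0) (caseˡ v₁ (lit 0) v₀)

fromFirst : Tm (natᵗ ∷ listᵗ edge ∷ Input ∷ []) (optᵗ natᵗ (listᵗ edge))
fromFirst = lets secondSource fromEnds

fromEdges : Tm (listᵗ edge ∷ Input ∷ []) (optᵗ natᵗ (listᵗ edge))
fromEdges = lets firstSource fromFirst

reachFast : Tm (Input ∷ []) (optᵗ natᵗ (listᵗ edge))
reachFast = lets (snd (fst v₀)) fromEdges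

-- Disjoint paths as a set of arcs

TEdge : Set
TEdge = ⟦ edge ⟧ᵗ

-- The graph seen by the algorithm: edges on numbers, each directed from `A` towards `B`. Several
-- paths meet at the endpoints, hence the exceptions in the uniqueness fields. The field `induction`
-- says that every arc is found by following some path from `A`.
record Arcs (es : List TEdge) (A B : ℕ) : Set₁ where
  field
    Arc        : ℕ → ℕ → Set
    edge⇒arc   : ∀ {u v i} → (u , v , i) ∈ es → Arc u v ⊎ Arc v u
    arc⇒edge   : ∀ {u v} → Arc u v → ∃[ i ] ((u , v , i) ∈ es ⊎ (v , u , i) ∈ es)
    no-in      : ∀ {u} → ¬ Arc u A
    no-out     : ∀ {v} → ¬ Arc B v
    in-unique  : ∀ {u u′ v} → v ≢ B → Arc u v → Arc u′ v → u ≡ u′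
    out-unique : ∀ {u v v′} → u ≢ A → Arc u v → Arc u v′ → v ≡ v′
    antisym    : ∀ {u v} → Arc u v → ¬ Arc v u
    successor  : ∀ {u v} → Arc u v → v ≢ B → ∃[ w ] Arc v w
    induction  : (Q : ℕ → ℕ → Set) → (∀ {v} → Arc A v → Q A v) →
                 (∀ {u v w} → v ≢ B → Arc u v → Q u v → Arc v w → Q v w) →
                 ∀ {u v} → Arc u v → Q u v
    first      : ∃[ v ] Arc A v

-- The walk through all paths

Unique-⊆-length : ∀ {X : Set} {xs ys : List X} → Unique xs → xs ⊆ ys → length xs ≤ length ys
Unique-⊆-length [] _ = z≤n
Unique-⊆-length {xs = x ∷ xs} {ys} (x∉ ∷ u) sub with ∈-∃++ (sub (here refl))
... | as , bs , refl = begin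
  suc (length xs)               ≤⟨ s≤s (Unique-⊆-length u sub′) ⟩
  suc (length (as ++ bs))       ≡⟨ cong suc (length-++ as) ⟩
  suc (length as + length bs)   ≡⟨ +-suc (length as) (length bs) ⟨
  length as + suc (length bs)   ≡⟨ length-++ as ⟨
  length (as ++ x ∷ bs)         ∎
  where
  open ≤-Reasoning
  sub′ : xs ⊆ as ++ bs
  sub′ y∈ with ∈-++⁻ as (sub (there y∈))
  ... | inj₁ h = ∈-++⁺ˡ h
  ... | inj₂ (there h) = ∈-++⁺ʳ as h
  ... | inj₂ (here refl) = ⊥-elim (All.lookup x∉ y∈ refl)

Slot Link : Set
Slot = ⟦ point ⟧ᵗ
Link = ⟦ link ⟧ᵗ

_≟ˢ_ : (p q : Slot) → Dec (p ≡ q)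
_≟ˢ_ = ≡-dec _≟_ _≟_

slots : List Link → List Slot
slots = map proj₂

chain-invariant : ∀ {X Y : Set} (P : List Y → Set) (f : List Y → X → List Y) → P [] → ∀ xs →
  (∀ {acc x y} → x ∈ xs → P acc → y ∈ f acc x → P (y ∷ acc)) → P (chainList f xs)
chain-invariant P f p₀ [] ext = p₀
chain-invariant P f p₀ (x ∷ xs) ext with f (chainList f xs) x in eq | chain-invariant P f p₀ xs (λ x∈ → ext (there x∈))
... | []    | p = p
... | y ∷ _ | p = ext (here refl) p (subst (y ∈_) (sym eq) (here refl))

module Walk {es A B} (arcs : Arcs es A B) (input : ⟦ Input ⟧ᵗ) where
  open Arcs arcs

  ρ₃ : Env Γ₃
  ρ₃ = B ∷ A ∷ es ∷ input ∷ []

  E₂ : List Slot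
  E₂ = ⟦ bothWays v₂ ⟧ ρ₃

  last : List Link → Slot
  last acc = caseList acc (B , B) (λ l _ → proj₂ l)

  ∈E₂⇒arc : ∀ {u v} → (u , v) ∈ E₂ → Arc u v ⊎ Arc v u
  ∈E₂⇒arc h with ∈-concatMap⁻ _ es h
  ... | e , e∈ , here refl = edge⇒arc e∈
  ... | e , e∈ , there (here refl) with edge⇒arc e∈
  ...   | inj₁ a = inj₂ a
  ...   | inj₂ a = inj₁ a

  arc⇒∈E₂ : ∀ {u v} → Arc u v → (u , v) ∈ E₂
  arc⇒∈E₂ a with arc⇒edge a
  ... | i , inj₁ h = ∈-concatMap⁺ _ h (here refl)
  ... | i , inj₂ h = ∈-concatMap⁺ _ h (there (here refl))

  data Valid : List Link → Set where
    []  : Valid []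
    ext : ∀ {acc s} → Valid acc → Arc (proj₁ s) (proj₂ s) → s ∉ slots acc →
          (proj₂ (last acc) ≡ B × proj₁ s ≡ A) ⊎ (proj₂ (last acc) ≢ B × proj₁ s ≡ proj₂ (last acc)) →
          Valid ((last acc , s) ∷ acc)

  valid-arc : ∀ {acc s} → Valid acc → s ∈ slots acc → Arc (proj₁ s) (proj₂ s)
  valid-arc (ext _ a _ _) (here refl) = a
  valid-arc (ext h _ _ _) (there s∈)  = valid-arc h s∈

  last∈ : ∀ {acc} → proj₂ (last acc) ≢ B → last acc ∈ slots acc
  last∈ {[]}    q≢B = ⊥-elim (q≢B refl)
  last∈ {_ ∷ _} _   = here refl

  valid-suffix : ∀ front {rest} → Valid (front ++ rest) → Valid rest
  valid-suffix []          h             = h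
  valid-suffix (_ ∷ front) (ext h _ _ _) = valid-suffix front h

  valid-prev : ∀ {l acc} → Valid (l ∷ acc) → proj₁ l ≡ last acc
  valid-prev (ext _ _ _ _) = refl

  valid-start : ∀ {acc l} → Valid acc → l ∈ acc →
    (proj₂ (proj₁ l) ≡ B × proj₁ (proj₂ l) ≡ A) ⊎ (proj₂ (proj₁ l) ≢ B × proj₁ (proj₂ l) ≡ proj₂ (proj₁ l))
  valid-start (ext _ _ _ how) (here refl) = how
  valid-start (ext h _ _ _)   (there l∈)  = valid-start h l∈

  valid-fresh : ∀ {l acc} → Valid (l ∷ acc) → proj₂ l ∉ slots acc
  valid-fresh (ext _ _ s∉ _) = s∉

  valid-injective : ∀ {acc l l′} → Valid acc → l ∈ acc → l′ ∈ acc → proj₂ l ≡ proj₂ l′ → l ≡ l′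
  valid-injective h              (here refl) (here refl) _ = refl
  valid-injective (ext _ _ s∉ _) (here refl) (there l′∈) refl = ⊥-elim (s∉ (∈-map⁺ proj₂ l′∈))
  valid-injective (ext _ _ s∉ _) (there l∈) (here refl) refl = ⊥-elim (s∉ (∈-map⁺ proj₂ l∈))
  valid-injective (ext h _ _ _)  (there l∈) (there l′∈) eq = valid-injective h l∈ l′∈ eq

  valid-unique : ∀ {acc} → Valid acc → Unique (slots acc)
  valid-unique [] = []
  valid-unique (ext h _ s∉ _) = ¬Any⇒All¬ _ s∉ ∷ valid-unique h

  predecessor : ∀ {acc u v} → Valid acc → (u , v) ∈ slots acc → u ≢ A → ∃[ p ] (p , u) ∈ slots acc
  predecessor (ext h _ _ (inj₁ (_ , u≡A))) (here refl) u≢A = ⊥-elim (u≢A u≡A)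
  predecessor {acc = _ ∷ acc} (ext h _ _ (inj₂ (q≢B , refl))) (here refl) u≢A = proj₁ (last acc) , there (last∈ {acc} q≢B)
  predecessor (ext h _ _ _) (there s∈) u≢A with predecessor h s∈ u≢A
  ... | p , p∈ = p , there p∈

  follower : ∀ {acc u v} → Valid acc → (u , v) ∈ slots acc → v ≢ B → last acc ≡ (u , v) ⊎ ∃[ w ] (v , w) ∈ slots acc
  follower (ext _ _ _ _) (here refl) _ = inj₁ refl
  follower (ext {s = s} h _ _ how) (there s∈) v≢B with follower h s∈ v≢B | how
  ... | inj₂ (w , w∈) | _ = inj₂ (w , there w∈)
  ... | inj₁ eq | inj₁ (q≡B , _) = ⊥-elim (v≢B (trans (cong proj₂ (sym eq)) q≡B))
  ... | inj₁ eq | inj₂ (_ , u≡q) = inj₂ (proj₂ s , here (cong (_, proj₂ s) (trans (cong proj₂ (sym eq)) (sym u≡q))))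

  -- The unique arc into a vertex u ≢ B precedes every slot from u, and it is traversed only once.
  last-fresh : ∀ {acc v} → Valid acc → proj₂ (last acc) ≢ B → (proj₂ (last acc) , v) ∉ slots acc
  last-fresh []              q≢B _           = q≢B refl
  last-fresh (ext _ a _ _)   q≢B (here refl) = antisym a a
  last-fresh (ext h a s∉ _)  q≢B (there uv∈) with predecessor h uv∈ (λ { refl → no-in a })
  ... | p , pu∈ with refl ← in-unique q≢B (valid-arc h pu∈) a = s∉ pu∈

  module _ (acc : List Link) (x : Slot) where

    ρ′ : Env (point ∷ listᵗ link ∷ point ∷ Γ₃)
    ρ′ = last acc ∷ acc ∷ x ∷ ρ₃

    Extends : Slot → Set
    Extends s = Holds (extends v₅ v₄ v₂ v₁ v₀) (s ∷ ρ′)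

    ∈-step⁻ : ∀ {y} → y ∈ ⟦ slotsStep ⟧ (acc ∷ x ∷ ρ₃) → proj₁ y ≡ last acc × proj₂ y ∈ E₂ × Extends (proj₂ y)
    ∈-step⁻ h with ∈-concatMap⁻ _ (⟦ select (bothWays v₅) (extends v₅ v₄ v₂ v₁ v₀) ⟧ ρ′) h
    ... | s , s∈ , here refl with ∈-select⁻ (bothWays v₅) (extends v₅ v₄ v₂ v₁ v₀) ρ′ s∈
    ...   | s∈E₂ , e = refl , s∈E₂ , e

    ∈-step⁺ : ∀ {s} → s ∈ E₂ → Extends s → (last acc , s) ∈ ⟦ slotsStep ⟧ (acc ∷ x ∷ ρ₃)
    ∈-step⁺ s∈ e = ∈-concatMap⁺ _ (∈-select⁺ (bothWays v₅) (extends v₅ v₄ v₂ v₁ v₀) ρ′ s∈ e) (here refl)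

    step-valid : ∀ {y} → Valid acc → y ∈ ⟦ slotsStep ⟧ (acc ∷ x ∷ ρ₃) → Valid (y ∷ acc)
    step-valid {_ , (u , v)} h y∈ with ∈-step⁻ y∈
    ... | refl , s∈ , inj₁ (q≡B , refl , s∉) = ext h arc (λ s∈′ → s∉ (unmap s∈′)) (inj₁ (q≡B , refl))
      where
      arc : Arc u v
      arc with ∈E₂⇒arc s∈
      ... | inj₁ a = a
      ... | inj₂ a = ⊥-elim (no-in a)
      unmap : ∀ {s links} → s ∈ slots links → Any (λ l → proj₁ (proj₂ l) ≡ proj₁ s × proj₂ (proj₂ l) ≡ proj₂ s) links
      unmap s∈ = Any.map (λ { refl → refl , refl }) (AnyP.map⁻ s∈)
    ... | refl , s∈ , inj₂ (q≢B , refl , v≢p) = ext h arc (last-fresh h q≢B) (inj₂ (q≢B , refl))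
      where
      lastArc : Arc (proj₁ (last acc)) (proj₂ (last acc))
      lastArc = valid-arc h (last∈ {acc} q≢B)
      arc : Arc u v
      arc with ∈E₂⇒arc s∈
      ... | inj₁ a = a
      -- An edge taken against its direction would, by `in-unique`, lead back to the previous
      -- vertex, which the test excludes.
      ... | inj₂ a = ⊥-elim (v≢p (in-unique q≢B a lastArc))

  stepOf : List Link → Slot → List Link
  stepOf acc x = ⟦ slotsStep ⟧ (acc ∷ x ∷ ρ₃)

  Stuck : List Link → Set
  Stuck acc = ∀ x → stepOf acc x ≡ []

  progress : ∀ xs → Stuck (chainList stepOf xs) ⊎ length (chainList stepOf xs) ≡ length xs
  progress [] = inj₂ refl
  progress (x ∷ xs) with chainList stepOf xs | progress xs
  ... | acc | inj₁ stuck rewrite stuck x = inj₁ stuck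
  ... | acc | inj₂ len with stepOf acc x in eq
  ...   | []    = inj₁ λ _ → eq
  ...   | _ ∷ _ = inj₂ (cong suc len)

  length-valid : ∀ {acc} → Valid acc → length acc ≤ length E₂
  length-valid {acc} h = ≤-trans (≤-reflexive (sym (length-map proj₂ acc)))
    (Unique-⊆-length (valid-unique h) (λ s∈ → arc⇒∈E₂ (valid-arc h s∈)))

  record Traversal (acc : List Link) : Set where
    field
      valid    : Valid acc
      lastB    : proj₂ (last acc) ≡ B
      complete : ∀ {u v} → Arc u v → (u , v) ∈ slots acc

  -- A stuck walk is at `B`, since from any other vertex its path goes on. It has then taken all
  -- arcs out of `A`, and by `follower` it has followed each path it entered, so induction along the
  -- paths gives completeness. The pair `(0 , 0)` is arbitrary: a step does not look at the clock.
  stuck⇒traversal : ∀ acc → Valid acc → (∀ y → y ∉ stepOf acc (0 , 0)) → Traversal acc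
  stuck⇒traversal acc h stuck = record { valid = h ; lastB = lastB ; complete = induction _ fromA next }
    where
    lastB : proj₂ (last acc) ≡ B
    lastB with proj₂ (last acc) ≟ B
    ... | yes eq = eq
    ... | no q≢B with successor (valid-arc h (last∈ {acc} q≢B)) q≢B
    ...   | w , a = ⊥-elim (stuck _ (∈-step⁺ acc (0 , 0) (arc⇒∈E₂ a)
                      (inj₂ (q≢B , refl , λ { refl → antisym a (valid-arc h (last∈ {acc} q≢B)) }))))
    fromA : ∀ {v} → Arc A v → (A , v) ∈ slots acc
    fromA {v} a with member? _≟ˢ_ (A , v) (slots acc)
    ... | yes p = p
    ... | no ¬p = ⊥-elim (stuck _ (∈-step⁺ acc (0 , 0) (arc⇒∈E₂ a)
                    (inj₁ (lastB , refl , λ any → ¬p (AnyP.map⁺ (Any.map (λ { (refl , refl) → refl }) any))))))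
    next : ∀ {u v w} → v ≢ B → Arc u v → (u , v) ∈ slots acc → Arc v w → (v , w) ∈ slots acc
    next v≢B a uv∈ a′ with follower h uv∈ v≢B
    ... | inj₁ eq = ⊥-elim (v≢B (trans (cong proj₂ (sym eq)) lastB))
    ... | inj₂ (w′ , vw′∈) with refl ← out-unique (λ { refl → no-in a }) a′ (valid-arc h vw′∈) = vw′∈

  traversal : ∀ xs → length xs ≡ suc (length E₂) → Traversal (chainList stepOf xs)
  traversal xs len = stuck⇒traversal (chainList stepOf xs) h stuck
    where
    h : Valid (chainList stepOf xs)
    h = chain-invariant Valid stepOf [] xs (λ {acc} {x} _ → step-valid acc x)
    stuck : ∀ y → y ∉ stepOf (chainList stepOf xs) (0 , 0)
    stuck y y∈ with progress xs
    ... | inj₁ st with () ← subst (y ∈_) (st (0 , 0)) y∈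
    ... | inj₂ eq = <-irrefl refl (≤-trans (≤-reflexive (sym (trans eq len))) (length-valid h))

  slotsT-traversal : Traversal (⟦ slotsT ⟧ ρ₃)
  slotsT-traversal = traversal (⟦ cons ⟨ lit 0 , lit 0 ⟩ (bothWays v₂) ⟧ ρ₃) refl

-- Facts

Fact : Set
Fact = ⟦ fact ⟧ᵗ

module _ (f : Fact) where
  prev slot : Slot
  prev = ⟦ prevᵉ v₀ ⟧ (f ∷ [])
  slot = ⟦ slotᵉ v₀ ⟧ (f ∷ [])
  src tgt i₁ t₁ i₂ t₂ αu αv βu βv αB βA dl X Y : ℕ
  src = ⟦ uᵉ v₀ ⟧ (f ∷ [])
  tgt = ⟦ vᵉ v₀ ⟧ (f ∷ [])
  i₁ = ⟦ i₁ᵉ v₀ ⟧ (f ∷ [])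
  t₁ = ⟦ t₁ᵉ v₀ ⟧ (f ∷ [])
  i₂ = ⟦ i₂ᵉ v₀ ⟧ (f ∷ [])
  t₂ = ⟦ t₂ᵉ v₀ ⟧ (f ∷ [])
  αu = ⟦ αuᵉ v₀ ⟧ (f ∷ [])
  αv = ⟦ αvᵉ v₀ ⟧ (f ∷ [])
  βu = ⟦ βuᵉ v₀ ⟧ (f ∷ [])
  βv = ⟦ βvᵉ v₀ ⟧ (f ∷ [])
  αB = ⟦ aᵉ v₀ ⟧ (f ∷ [])
  βA = ⟦ bᵉ v₀ ⟧ (f ∷ [])
  dl = ⟦ Tᵉ v₀ ⟧ (f ∷ [])
  X  = ⟦ Xᵉ v₀ ⟧ (f ∷ [])
  Y  = ⟦ Yᵉ v₀ ⟧ (f ∷ [])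

  FwdA BwdA FwdB BwdB : Set
  FwdA = αu < αv × αv ≡ t₁
  BwdA = αv < αu × αu ≡ t₁
  FwdB = βu < βv × βv ≡ t₂
  BwdB = βv < βu × βu ≡ t₂

Joins : TEdge → Fact → Set
Joins (x , y , _) f = (x ≡ src f × y ≡ tgt f) ⊎ (x ≡ tgt f × y ≡ src f)

module Predicates (es : List TEdge) (A B : ℕ) where

  Ok : Fact → Set
  Ok f =
    Any (λ e → Joins e f × proj₂ (proj₂ e) ≡ i₁ f) es ×
    Any (λ e → Joins e f × proj₂ (proj₂ e) ≡ i₂ f) es ×
    i₁ f ≤ t₁ f × i₂ f ≤ t₂ f × (¬ (i₁ f ≡ i₂ f) ⊎ t₁ f ≡ t₂ f) ×
    αu f ≤ dl f × αv f ≤ dl f × βu f ≤ dl f × βv f ≤ dl f ×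
    (¬ (src f ≡ A) ⊎ αu f ≡ 0 × βu f ≡ βA f) ×
    (¬ (tgt f ≡ B) ⊎ αv f ≡ αB f × βv f ≡ 0)

  Initial : Fact → Set
  Initial f = proj₁ (prev f) ≡ B × (X f ≡ 0 ⊎ tgt f ≡ B × FwdA f) × (Y f ≡ 0 ⊎ src f ≡ A × BwdB f)

  Step : Fact → Fact → Set
  Step g f =
    (src g ≡ proj₁ (prev f) × tgt g ≡ proj₂ (prev f)) ×
    αB g ≡ αB f × βA g ≡ βA f × dl g ≡ dl f ×
    (X f ≡ 0 ⊎ 1 ≤ X g ⊎ tgt f ≡ B × FwdA f) ×
    (Y f ≡ 0 ⊎ 1 ≤ Y g ⊎ src f ≡ A × BwdB f) ×
    (tgt g ≡ B ⊎ αv g ≡ αu f × βv g ≡ βu f × (FwdA g ⊎ BwdA f) × (FwdB g ⊎ BwdB f))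

module Facts {es A B} (arcs : Arcs es A B) (input : ⟦ Input ⟧ᵗ) (ls : List Link) (cand : List ℕ) where
  open Arcs arcs
  open Walk arcs input
  open Predicates es A B

  ρ₅ : Env Γ₅
  ρ₅ = cand ∷ ls ∷ ρ₃

  factStep : List Fact → Fact → List Fact
  factStep acc f = ⟦ ite (test derivable) (cons v₁ nil) nil ⟧ (acc ∷ f ∷ ρ₅)

  ∈-factStep⁻ : ∀ acc f {y} → y ∈ factStep acc f → y ≡ f × Ok f × (Initial f ⊎ Any (λ g → Step g f) acc)
  ∈-factStep⁻ acc f = ∈-guard⁻ derivable (acc ∷ f ∷ ρ₅)

  ∈-factStep⁺ : ∀ acc f → Ok f → Initial f ⊎ Any (λ g → Step g f) acc → f ∈ factStep acc f
  ∈-factStep⁺ acc f ok how = ∈-guard⁺ derivable (acc ∷ f ∷ ρ₅) (ok , how)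

  factsOf : List Fact → List Fact
  factsOf = chainList factStep

  -- A derivation found while the table is growing survives, because a step only asks for one member
  -- of the table.
  facts-sound : ∀ xs {f} → f ∈ factsOf xs → f ∈ xs × Ok f × (Initial f ⊎ Any (λ g → Step g f) (factsOf xs))
  facts-sound xs f∈ = chain-invariant Sound factStep (λ ()) xs extend f∈
    where
    Sound : List Fact → Set
    Sound acc = ∀ {f} → f ∈ acc → f ∈ xs × Ok f × (Initial f ⊎ Any (λ g → Step g f) acc)
    weaken : ∀ {y f acc} → Initial f ⊎ Any (λ g → Step g f) acc → Initial f ⊎ Any (λ g → Step g f) (y ∷ acc)
    weaken (inj₁ i) = inj₁ i
    weaken (inj₂ a) = inj₂ (there a)
    extend : ∀ {acc x y} → x ∈ xs → Sound acc → y ∈ factStep acc x → Sound (y ∷ acc)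
    extend {acc} {x} x∈ h y∈ (here refl) with ∈-factStep⁻ acc x y∈
    ... | refl , ok , how = x∈ , ok , weaken {x} {x} {acc} how
    extend {acc} {y = y} x∈ h y∈ {f} (there f∈) with h f∈
    ... | f∈xs , ok , how = f∈xs , ok , weaken {y} {f} {acc} how

  push-⊇ : ∀ {Z : Set} (ys acc : List Z) → acc ⊆ push ys acc
  push-⊇ []      acc z∈ = z∈
  push-⊇ (_ ∷ _) acc z∈ = there z∈

  chain-⊇ : ∀ xs ys → factsOf ys ⊆ factsOf (xs ++ ys)
  chain-⊇ []       ys z∈ = z∈
  chain-⊇ (x ∷ xs) ys z∈ = push-⊇ (factStep (factsOf (xs ++ ys)) x) _ (chain-⊇ xs ys z∈)

  -- For use with `xs` as the block of one slot and `ys` as the blocks of all earlier slots: as the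
  -- derivation of `f` draws only on `ys`, the position of `f` in its own block does not matter.
  facts-complete : ∀ xs ys {f} → f ∈ xs → Ok f → Initial f ⊎ Any (λ g → Step g f) (factsOf ys) → f ∈ factsOf (xs ++ ys)
  facts-complete (x ∷ xs) ys (there f∈) ok how = push-⊇ (factStep (factsOf (xs ++ ys)) x) _ (facts-complete xs ys f∈ ok how)
  facts-complete (f ∷ xs) ys (here refl) ok how = pushed (factStep (factsOf (xs ++ ys)) f)
        (∈-factStep⁺ (factsOf (xs ++ ys)) f ok (later how)) (λ y∈ → proj₁ (∈-factStep⁻ (factsOf (xs ++ ys)) f y∈))
    where
    pushed : ∀ {Z : Set} {z : Z} zs {acc} → z ∈ zs → (∀ {y} → y ∈ zs → y ≡ z) → z ∈ push zs acc
    pushed (y ∷ _) _ unique = here (sym (unique (here refl)))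
    later : Initial f ⊎ Any (λ g → Step g f) (factsOf ys) → Initial f ⊎ Any (λ g → Step g f) (factsOf (xs ++ ys))
    later (inj₁ i) = inj₁ i
    later (inj₂ a) with find a
    ... | g , g∈ , st = inj₂ (lose (chain-⊇ xs ys g∈) st)

  block : Link → List Fact
  block l = ⟦ for (tuples 13 v₁) (cons ⟨ v₁ , v₀ ⟩ nil) ⟧ (l ∷ ρ₅)

  ∈-block⁻ : ∀ l {f} → f ∈ block l → proj₁ f ≡ l
  ∈-block⁻ l f∈ with ∈-concatMap⁻ (λ t → (l , t) ∷ []) (⟦ tuples 13 v₁ ⟧ (l ∷ ρ₅)) f∈
  ... | t , _ , here refl = refl

data Tuple (P : ℕ → Set) : ∀ k → ⟦ Nats k ⟧ᵗ → Set where
  []  : Tuple P 0 0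
  _∷_ : ∀ {k x t} → P x → Tuple P k t → Tuple P (suc k) (x , t)

∈-tuples : ∀ {Γ} k (c : Tm Γ (listᵗ natᵗ)) (ρ : Env Γ) {t} → Tuple (_∈ ⟦ c ⟧ ρ) k t → t ∈ ⟦ tuples k c ⟧ ρ
∈-tuples zero    c ρ []       = here refl
∈-tuples (suc k) c ρ (_∷_ {x = x} x∈ ts) =
  ∈-concatMap⁺ (λ x → concatMap (λ t → (x , t) ∷ []) (⟦ tuples k (wk c) ⟧ (x ∷ ρ))) x∈
    (∈-concatMap⁺ (λ t → (x , t) ∷ []) (∈-tuples k (wk c) (x ∷ ρ) ts) (here refl))

-- Selecting a derivation of an optimal final fact

module Selection {es A B} (arcs : Arcs es A B) (input : ⟦ Input ⟧ᵗ) (ls : List Link) (cand : List ℕ) (fs : List Fact) where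
  open Arcs arcs
  open Walk arcs input
  open Predicates es A B

  ρ₆ : Env Γ₆
  ρ₆ = fs ∷ cand ∷ ls ∷ ρ₃

  Final MinFinal : Fact → Set
  Final f = (src f ≡ proj₁ (last ls) × tgt f ≡ proj₂ (last ls)) × 1 ≤ X f × 1 ≤ Y f
  MinFinal f = Final f × ¬ Any (λ g → Final g × dl g < dl f) fs

  selStep : List Fact → Link → List Fact
  selStep acc x = ⟦ selectStep ⟧ (acc ∷ x ∷ ρ₆)

  ∈-selStep₀⁻ : ∀ x {f} → f ∈ selStep [] x → f ∈ fs × MinFinal f
  ∈-selStep₀⁻ x = ∈-select⁻ v₂ minimalFinal ([] ∷ x ∷ ρ₆)

  ∈-selStep₀⁺ : ∀ x {f} → f ∈ fs → MinFinal f → f ∈ selStep [] x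
  ∈-selStep₀⁺ x = ∈-select⁺ v₂ minimalFinal ([] ∷ x ∷ ρ₆)

  ∈-selStep⁻ : ∀ h acc x {g} → g ∈ selStep (h ∷ acc) x → g ∈ fs × Step g h
  ∈-selStep⁻ h acc x = ∈-select⁻ v₄ (stepᶠ (wk v₈) v₈ v₀ v₁) (h ∷ acc ∷ (h ∷ acc) ∷ x ∷ ρ₆)

  ∈-selStep⁺ : ∀ h acc x {g} → g ∈ fs → Step g h → g ∈ selStep (h ∷ acc) x
  ∈-selStep⁺ h acc x = ∈-select⁺ v₄ (stepᶠ (wk v₈) v₈ v₀ v₁) (h ∷ acc ∷ (h ∷ acc) ∷ x ∷ ρ₆)

  -- Descent on the deadline. The double negation avoids deciding minimality, and it is enough
  -- because the lemma only refutes an empty selection.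
  final⇒minFinal : ∀ {f} → f ∈ fs → Final f → ¬ ¬ (∃[ g ] (g ∈ fs × MinFinal g))
  final⇒minFinal {f} f∈ isFinal noMin = go f∈ isFinal (<-wellFounded (dl f))
    where
    go : ∀ {f} → f ∈ fs → Final f → Acc _<_ (dl f) → ⊥
    go {f} f∈ isFinal (accessible rs) = noMin (f , f∈ , isFinal , λ any → let (g , g∈ , fin′ , lt) = find any in go g∈
          fin′ (rs lt))

  module _ (trav : Traversal ls)
           (sound : ∀ {f} → f ∈ fs → proj₁ f ∈ ls × Ok f × (Initial f ⊎ Any (λ g → Step g f) fs)) where
    open Traversal trav

    -- A partial trace; `rest` consists of the links still without a fact. Since `ls` has the last
    -- slot first, the trace grows towards the start of the walk and its head belongs to the
    -- earliest slot reached so far.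
    data Sel : List Fact → List Link → Set where
      fin  : ∀ {f rest} → f ∈ fs → MinFinal f → ls ≡ proj₁ f ∷ rest → Sel (f ∷ []) rest
      more : ∀ {g h acc rest} → Sel (h ∷ acc) (proj₁ g ∷ rest) → g ∈ fs → Step g h → Sel (g ∷ h ∷ acc) rest

    sel-suffix : ∀ {h acc rest} → Sel (h ∷ acc) rest → ∃[ front ] ls ≡ front ++ proj₁ h ∷ rest
    sel-suffix (fin _ _ eq) = [] , eq
    sel-suffix (more {g} {h} {rest = rest} s _ _) with sel-suffix s
    ... | front , eq = front ++ proj₁ h ∷ [] , trans eq (assoc front)
      where
      assoc : ∀ (xs : List Link) → xs ++ proj₁ h ∷ proj₁ g ∷ rest ≡ (xs ++ proj₁ h ∷ []) ++ proj₁ g ∷ rest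
      assoc []       = refl
      assoc (x ∷ xs) = cong (x ∷_) (assoc xs)

    sel-valid : ∀ {h acc rest} → Sel (h ∷ acc) rest → Valid (proj₁ h ∷ rest)
    sel-valid s with sel-suffix s
    ... | front , eq = valid-suffix front (subst Valid eq valid)

    sel-∈ : ∀ {acc rest x} → Sel acc rest → x ∈ acc → x ∈ fs
    sel-∈ (fin f∈ _ _)  (here refl) = f∈
    sel-∈ (more _ g∈ _) (here refl) = g∈
    sel-∈ (more s _ _)  (there x∈)  = sel-∈ s x∈

    module _ {m} (m∈ : m ∈ fs) (min : MinFinal m) where

      sel-run : ∀ x xs → suc (length xs) ≤ length ls →
                ∃[ rest ] (Sel (chainList selStep (x ∷ xs)) rest × length rest + suc (length xs) ≡ length ls)
      sel-run x [] _ with selStep [] x in eq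
      ... | [] with () ← subst (m ∈_) eq (∈-selStep₀⁺ x m∈ min)
      ... | f ∷ _ with ∈-selStep₀⁻ x (subst (f ∈_) (sym eq) (here refl))
      ...   | f∈ , minf@(((u≡ , v≡) , _) , _) with proj₁ (sound f∈)
      ...     | l∈ = start-at ls refl l∈
        where
        start-at : ∀ ks → ks ≡ ls → proj₁ f ∈ ks → ∃[ rest ] (Sel (f ∷ []) rest × length rest + 1 ≡ length ls)
        start-at (l ∷ ks) refl l∈ with valid-injective valid l∈ (here refl) (cong₂ _,_ u≡ v≡)
        ... | refl = ks , fin f∈ minf refl , +-comm (length ks) 1
      sel-run x (x′ ∷ xs) len≤ with chainList selStep (x′ ∷ xs) | sel-run x′ xs (≤-trans (n≤1+n _) len≤)
      ... | _ | [] , _ , len = ⊥-elim (<-irrefl len len≤)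
      ... | h ∷ acc | l ∷ rest , s , len with selStep (h ∷ acc) x in eq
      ...   | [] with proj₂ (proj₂ (sound (sel-∈ s (here refl))))
      -- The link `l` precedes `h`, so the previous slot of `h` is an arc and cannot start at `B`;
      -- hence `h` is not initial and the trace goes on.
      ...     | inj₁ (pu≡B , _) = ⊥-elim (no-out (subst (λ z → Arc z (proj₂ (proj₂ l)))
            (trans (cong proj₁ (sym (valid-prev (sel-valid s)))) pu≡B) (valid-arc (sel-valid s) (there (here refl)))))
      ...     | inj₂ any with find any
      ...       | g , g∈ , st with () ← subst (g ∈_) eq (∈-selStep⁺ h acc x g∈ st)
      sel-run x (x′ ∷ xs) len≤ | h ∷ acc | l ∷ rest , s , len | g ∷ _ with ∈-selStep⁻ h acc x (subst (g ∈_) (sym eq) (here refl))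
      ...   | g∈ , st@((u≡ , v≡) , _) = rest , more (subst (λ z → Sel (h ∷ acc) (z ∷ rest)) (sym link≡) s) g∈ st ,
            trans (+-suc (length rest) (suc (length xs))) len
        where
        l∈ : l ∈ ls
        l∈ with sel-suffix s
        ... | front , eq′ = subst (l ∈_) (sym eq′) (∈-++⁺ʳ front (there (here refl)))
        link≡ : proj₁ g ≡ l
        link≡ = valid-injective valid (proj₁ (sound g∈)) l∈ (trans (cong₂ _,_ u≡ v≡) (valid-prev (sel-valid s)))

-- Properties of a completed selection

record Plan {es A B} (arcs : Arcs es A B) (sel : List Fact) : Set where
  open Arcs arcs
  open Predicates es A B
  field
    ok        : ∀ {x} → x ∈ sel → Ok x
    arc       : ∀ {x} → x ∈ sel → Arc (src x) (tgt x)
    injective : ∀ {x y} → x ∈ sel → y ∈ sel → slot x ≡ slot y → x ≡ y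
    covers    : ∀ {u v} → Arc u v → ∃[ x ] (x ∈ sel × slot x ≡ (u , v))
    before    : ∀ {x} → x ∈ sel → src x ≢ A → ∃[ y ] (y ∈ sel × tgt y ≢ B × src x ≡ tgt y × Step y x)
    after     : ∀ {x} → x ∈ sel → tgt x ≢ B → ∃[ y ] (y ∈ sel × src y ≡ tgt x × Step x y)
    same      : ∀ {x y} → x ∈ sel → y ∈ sel → αB x ≡ αB y × βA x ≡ βA y × dl x ≡ dl y
    parentB   : ∃[ x ] (x ∈ sel × tgt x ≡ B × FwdA x)
    parentA   : ∃[ x ] (x ∈ sel × src x ≡ A × BwdB x)

module Selected {es A B} (arcs : Arcs es A B) (input : ⟦ Input ⟧ᵗ) (ls : List Link) (cand : List ℕ) (fs : List Fact)
  (trav : Walk.Traversal arcs input ls)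
  (sound : ∀ {f} → f ∈ fs → proj₁ f ∈ ls × Predicates.Ok es A B f ×
        (Predicates.Initial es A B f ⊎ Any (λ g → Predicates.Step es A B g f) fs)) where
  open Arcs arcs
  open Walk arcs input
  open Predicates es A B
  open Selection arcs input ls cand fs
  open Traversal trav

  S : List Fact → List Link → Set
  S = Sel trav sound

  sel-link : ∀ {acc rest x} → S acc rest → x ∈ acc → proj₁ x ∈ ls
  sel-link s x∈ = proj₁ (sound (sel-∈ trav sound s x∈))

  sel-covers : ∀ {acc rest l} → S acc rest → l ∈ ls → l ∈ rest ⊎ l ∈ map proj₁ acc
  sel-covers (fin _ _ eq) l∈ with subst (_ ∈_) eq l∈
  ... | here refl = inj₂ (here refl)
  ... | there h   = inj₁ h
  sel-covers (more s _ _) l∈ with sel-covers s l∈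
  ... | inj₁ (here refl) = inj₂ (here refl)
  ... | inj₁ (there h)   = inj₁ h
  ... | inj₂ h           = inj₂ (there h)

  sel-fresh : ∀ {acc rest x} → S acc rest → x ∈ acc → slot x ∉ slots rest
  sel-fresh s@(fin _ _ _)  (here refl) h = valid-fresh (sel-valid trav sound s) h
  sel-fresh s@(more _ _ _) (here refl) h = valid-fresh (sel-valid trav sound s) h
  sel-fresh (more s _ _)   (there x∈)  h = sel-fresh s x∈ (there h)

  sel-injective : ∀ {acc rest x y} → S acc rest → x ∈ acc → y ∈ acc → slot x ≡ slot y → x ≡ y
  sel-injective s (here refl) (here refl) _ = refl
  sel-injective (more s _ _) (here refl) (there y∈) eq = ⊥-elim (sel-fresh s y∈ (here (sym eq)))
  sel-injective (more s _ _) (there x∈) (here refl) eq = ⊥-elim (sel-fresh s x∈ (here eq))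
  sel-injective (more s _ _) (there x∈) (there y∈) eq = sel-injective s x∈ y∈ eq

  sel-before : ∀ {acc rest x} → S acc rest → x ∈ acc → (∃[ tl ] acc ≡ x ∷ tl) ⊎ ∃[ y ] (y ∈ acc × Step y x)
  sel-before _ (here refl) = inj₁ (_ , refl)
  sel-before (more s _ st) (there x∈) with sel-before s x∈
  ... | inj₁ (_ , refl)      = inj₂ (_ , here refl , st)
  ... | inj₂ (y , y∈ , st′) = inj₂ (y , there y∈ , st′)

  sel-after : ∀ {acc rest x} → S acc rest → x ∈ acc → tgt x ≡ B ⊎ ∃[ y ] (y ∈ acc × Step x y)
  sel-after (fin _ (((_ , v≡) , _) , _) _) (here refl) = inj₁ (trans v≡ lastB)
  sel-after (more s _ st) (here refl) = inj₂ (_ , there (here refl) , st)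
  sel-after (more s _ _)  (there x∈) with sel-after s x∈
  ... | inj₁ eq            = inj₁ eq
  ... | inj₂ (y , y∈ , st) = inj₂ (y , there y∈ , st)

  SameGlobals : Fact → Fact → Set
  SameGlobals x y = αB x ≡ αB y × βA x ≡ βA y × dl x ≡ dl y

  sel-last : ∀ {acc rest} → S acc rest → ∃[ m ] (m ∈ acc × MinFinal m × (∀ {x} → x ∈ acc → SameGlobals x m))
  sel-last (fin _ min _) = _ , here refl , min , λ { (here refl) → refl , refl , refl }
  sel-last (more s _ (_ , ea , eb , et , _)) with sel-last s
  ... | m , m∈ , min , same = m , there m∈ , min , λ where
    (here refl) → let (a , b , t) = same (here refl) in trans ea a , trans eb b , trans et t
    (there x∈)  → same x∈

  -- Read backwards along the trace, a set flag is passed to the preceding slot until some slot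
  -- earns it. At the first slot the initial condition leaves no one to pass it to.
  sel-X : ∀ {h acc rest} → S (h ∷ acc) rest → 1 ≤ X h ⊎ ∃[ x ] (x ∈ h ∷ acc × tgt x ≡ B × FwdA x)
  sel-X (fin _ ((_ , x , _) , _) _) = inj₁ x
  sel-X (more s _ (_ , _ , _ , _ , flag , _)) with sel-X s | flag
  ... | inj₂ (x , x∈ , h) | _               = inj₂ (x , there x∈ , h)
  ... | inj₁ 1≤X          | inj₁ X≡0        = ⊥-elim (<⇒≢ 1≤X (sym X≡0))
  ... | inj₁ _            | inj₂ (inj₁ 1≤X) = inj₁ 1≤X
  ... | inj₁ _            | inj₂ (inj₂ h)   = inj₂ (_ , there (here refl) , h)

  sel-Y : ∀ {h acc rest} → S (h ∷ acc) rest → 1 ≤ Y h ⊎ ∃[ x ] (x ∈ h ∷ acc × src x ≡ A × BwdB x)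
  sel-Y (fin _ ((_ , _ , y) , _) _) = inj₁ y
  sel-Y (more s _ (_ , _ , _ , _ , _ , flag , _)) with sel-Y s | flag
  ... | inj₂ (x , x∈ , h) | _               = inj₂ (x , there x∈ , h)
  ... | inj₁ 1≤Y          | inj₁ Y≡0        = ⊥-elim (<⇒≢ 1≤Y (sym Y≡0))
  ... | inj₁ _            | inj₂ (inj₁ 1≤Y) = inj₁ 1≤Y
  ... | inj₁ _            | inj₂ (inj₂ h)   = inj₂ (_ , there (here refl) , h)

  -- A predecessor would be a fact for the dummy slot before the walk, but facts are about arcs and
  -- no arc leaves `B`.
  head-initial : ∀ {h acc} → S (h ∷ acc) [] → Initial h
  head-initial {h} s with proj₂ (proj₂ (sound (sel-∈ trav sound s (here refl))))
  ... | inj₁ i = i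
  ... | inj₂ any with find any
  ...   | g , g∈ , ((u≡ , _) , _) = ⊥-elim (no-out (subst (λ z → Arc z (tgt g))
        (trans u≡ (cong proj₁ (valid-prev (sel-valid trav sound s))))
            (valid-arc valid (∈-map⁺ proj₂ (proj₁ (sound g∈))))))

  sel⇒plan : ∀ {h acc} → S (h ∷ acc) [] → Plan arcs (h ∷ acc)
  sel⇒plan {h} {acc} s = record
    { ok        = λ x∈ → proj₁ (proj₂ (sound (sel-∈ trav sound s x∈)))
    ; arc       = λ x∈ → valid-arc valid (∈-map⁺ proj₂ (sel-link s x∈))
    ; injective = sel-injective s
    ; covers    = covers
    ; before    = before
    ; after     = after
    ; same      = same
    ; parentB   = parentB
    ; parentA   = parentA
    }
    where
    covers : ∀ {u v} → Arc u v → ∃[ x ] (x ∈ h ∷ acc × slot x ≡ (u , v))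
    covers a with ∈-map⁻ proj₂ (complete a)
    ... | l , l∈ , refl with sel-covers s l∈
    ...   | inj₂ l∈′ with ∈-map⁻ proj₁ l∈′
    ...     | x , x∈ , refl = x , x∈ , refl
    before : ∀ {x} → x ∈ h ∷ acc → src x ≢ A → ∃[ y ] (y ∈ h ∷ acc × tgt y ≢ B × src x ≡ tgt y × Step y x)
    before x∈ u≢A with valid-start valid (sel-link s x∈) | sel-before s x∈
    ... | inj₁ (_ , u≡A) | _ = ⊥-elim (u≢A u≡A)
    ... | inj₂ (q≢B , _) | inj₁ (_ , refl) = ⊥-elim (q≢B (cong proj₂ (valid-prev (sel-valid trav sound s))))
    ... | inj₂ (q≢B , u≡q) | inj₂ (y , y∈ , st@((_ , v≡) , _)) = y , y∈ , (λ v≡B → q≢B (trans (sym v≡) v≡B)) , trans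
          u≡q (sym v≡) , st
    after : ∀ {x} → x ∈ h ∷ acc → tgt x ≢ B → ∃[ y ] (y ∈ h ∷ acc × src y ≡ tgt x × Step x y)
    after x∈ v≢B with sel-after s x∈
    ... | inj₁ v≡B = ⊥-elim (v≢B v≡B)
    ... | inj₂ (y , y∈ , st@((_ , v≡) , _)) with valid-start valid (sel-link s y∈)
    ...   | inj₁ (q≡B , _) = ⊥-elim (v≢B (trans v≡ q≡B))
    ...   | inj₂ (_ , u≡q) = y , y∈ , trans u≡q (sym v≡) , st
    same : ∀ {x y} → x ∈ h ∷ acc → y ∈ h ∷ acc → SameGlobals x y
    same x∈ y∈ with sel-last s
    ... | m , _ , _ , eqs with eqs x∈ | eqs y∈
    ...   | a , b , t | a′ , b′ , t′ = trans a (sym a′) , trans b (sym b′) , trans t (sym t′)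
    parentB : ∃[ x ] (x ∈ h ∷ acc × tgt x ≡ B × FwdA x)
    parentB with sel-X s | head-initial s
    ... | inj₂ p   | _ = p
    ... | inj₁ 1≤X | _ , inj₁ X≡0 , _ = ⊥-elim (<⇒≢ 1≤X (sym X≡0))
    ... | inj₁ _   | _ , inj₂ p , _   = h , here refl , p
    parentA : ∃[ x ] (x ∈ h ∷ acc × src x ≡ A × BwdB x)
    parentA with sel-Y s | head-initial s
    ... | inj₂ p   | _ = p
    ... | inj₁ 1≤Y | _ , _ , inj₁ Y≡0 = ⊥-elim (<⇒≢ 1≤Y (sym Y≡0))
    ... | inj₁ _   | _ , _ , inj₂ p   = h , here refl , p

  ls-nonempty : ls ≢ []
  ls-nonempty eq with first
  ... | v , a with () ← subst (λ z → (A , v) ∈ slots z) eq (complete a)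

  Outcome : List Fact → Set
  Outcome sel = ((∀ {f} → f ∈ fs → ¬ Final f) × sel ≡ []) ⊎
                ∃[ m ] ((∀ {f} → f ∈ fs → Final f → dl m ≤ dl f) × m ∈ sel × Plan arcs sel)

  no-elements : ∀ {Z : Set} {zs : List Z} → (∀ {z} → z ∉ zs) → zs ≡ []
  no-elements {zs = []}    _ = refl
  no-elements {zs = _ ∷ _} h = ⊥-elim (h (here refl))

  selection : Outcome (chainList selStep ls)
  selection = run ls refl
    where
    nothing-selected : (∀ {m} → m ∈ fs → ¬ MinFinal m) → ∀ xs → chainList selStep xs ≡ []
    nothing-selected _    []       = refl
    nothing-selected noMin (x ∷ xs) with chainList selStep xs | nothing-selected noMin xs
    ... | _ | refl with selStep [] x | no-elements {zs = selStep [] x}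
          (λ y∈ → let (y∈fs , min) = ∈-selStep₀⁻ x y∈ in noMin y∈fs min)
    ...   | _ | refl = refl
    selected : ∀ acc → ∃[ rest ] (S acc rest × rest ≡ []) → Outcome acc
    selected (h ∷ acc) (_ , s , refl) with sel-last s
    ... | m , m∈ , (_ , min) , _ = inj₂ (m , (λ f∈ f-final → ≮⇒≥ (λ lt → min (lose f∈ (f-final , lt)))) , m∈ , sel⇒plan s)
    run : ∀ ks → ks ≡ ls → Outcome (chainList selStep ks)
    run [] eq = ⊥-elim (ls-nonempty (sym eq))
    run (l ∷ ks) eq = decide (selStep [] l) refl
      where
      empty : ∀ rest → length rest + suc (length ks) ≡ length ls → rest ≡ []
      empty []         _   = refl
      empty (x ∷ rest) len = ⊥-elim (<⇒≢ (s≤s (m≤n+m (suc (length ks)) (length rest))) (trans (cong length eq) (sym len)))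
      decide : ∀ ys → selStep [] l ≡ ys → Outcome (chainList selStep (l ∷ ks))
      decide [] found = inj₁ ((λ f∈ f-final → final⇒minFinal f∈ f-final (λ (m , m∈ , min) → noMin m∈ min)) ,
            nothing-selected noMin (l ∷ ks))
        where
        noMin : ∀ {m} → m ∈ fs → ¬ MinFinal m
        noMin m∈ min with () ← subst (_ ∈_) found (∈-selStep₀⁺ l m∈ min)
      decide (m ∷ _) found with ∈-selStep₀⁻ l (subst (m ∈_) (sym found) (here refl))
      ... | m∈ , min with sel-run trav sound m∈ min l ks (≤-reflexive (cong length eq))
      ...   | rest , s , len = selected (chainList selStep (l ∷ ks)) (rest , s , empty rest len)

-- Completeness: deriving a final fact from arrival times

Joined : List TEdge → ℕ → ℕ → ℕ → Set
Joined es u v i = (u , v , i) ∈ es ⊎ (v , u , i) ∈ es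

record Uses (es : List TEdge) (A B : ℕ) (cand : List ℕ) (α β pA pB : ℕ → ℕ) (u v : ℕ) : Set where
  field
    i₁′ t₁′ i₂′ t₂′ : ℕ
    i₁∈ : i₁′ ∈ cand
    t₁∈ : t₁′ ∈ cand
    i₂∈ : i₂′ ∈ cand
    t₂∈ : t₂′ ∈ cand
    joined₁ : Joined es u v i₁′
    joined₂ : Joined es u v i₂′
    i₁≤t₁ : i₁′ ≤ t₁′
    i₂≤t₂ : i₂′ ≤ t₂′
    consistent : i₁′ ≡ i₂′ → t₁′ ≡ t₂′
    forwardA  : pA v ≡ u → α v ≡ t₁′
    backwardA : u ≢ A → pA u ≡ v → α u ≡ t₁′
    forwardB  : v ≢ B → pB v ≡ u → β v ≡ t₂′
    backwardB : pB u ≡ v → β u ≡ t₂′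

-- α and β are arrival times from A and from B, pA and pB the preceding vertices.
record Certificate {es A B} (arcs : Arcs es A B) (cand : List ℕ) (T : ℕ) : Set where
  open Arcs arcs
  field
    α β pA pB : ℕ → ℕ
    uses    : ∀ {u v} → Arc u v → Uses es A B cand α β pA pB u v
    parentA : ∀ {u v} → Arc u v → (Arc (pA v) v ⊎ Arc v (pA v)) × α (pA v) < α v
    parentB : ∀ {u v} → Arc u v → (Arc (pB u) u ⊎ Arc u (pB u)) × β (pB u) < β u
    αA≡0    : α A ≡ 0
    βB≡0    : β B ≡ 0
    α∈      : ∀ u → α u ∈ cand
    β∈      : ∀ u → β u ∈ cand
    T∈      : T ∈ cand
    0∈      : 0 ∈ cand
    1∈      : 1 ∈ cand
    α≤T     : ∀ u → α u ≤ T
    β≤T     : ∀ u → β u ≤ T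

module Complete {es A B} (arcs : Arcs es A B) (input : ⟦ Input ⟧ᵗ) (ls : List Link) (cand : List ℕ) {T : ℕ}
  (trav : Walk.Traversal arcs input ls) (cert : Certificate arcs cand T) where
  open Arcs arcs
  open Walk arcs input
  open Predicates es A B
  open Facts arcs input ls cand
  open Selection arcs input ls cand (factsOf (concatMap block ls)) using (Final)
  open Traversal trav
  open Certificate cert
  open Uses

  record Good (ks : List Link) (f : Fact) : Set where
    field
      linked : ∃[ rest ] ks ≡ proj₁ f ∷ rest
      αu≡ : αu f ≡ α (src f)
      αv≡ : αv f ≡ α (tgt f)
      βu≡ : βu f ≡ β (src f)
      βv≡ : βv f ≡ β (tgt f)
      αB≡ : αB f ≡ α B
      βA≡ : βA f ≡ β A
      dl≡ : dl f ≡ T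
      X∈  : X f ∈ cand
      Y∈  : Y f ∈ cand
      X≥1 : (pA B , B) ∈ slots ks → 1 ≤ X f
      Y≥1 : (A , pB A) ∈ slots ks → 1 ≤ Y f
      fA  : pA (tgt f) ≡ src f → FwdA f
      bA  : src f ≢ A → pA (src f) ≡ tgt f → BwdA f
      fB  : tgt f ≢ B → pB (tgt f) ≡ src f → FwdB f
      bB  : pB (src f) ≡ tgt f → BwdB f

  open Good

  module _ (p : Slot) {u v : ℕ} (a : Arc u v) (x y : ℕ) where

    private w = uses a

    factOf : Fact
    factOf = (p , u , v) , i₁′ w , t₁′ w , i₂′ w , t₂′ w , α u , α v , β u , β v , α B , β A , T , x , y , 0

    factOf∈ : x ∈ cand → y ∈ cand → factOf ∈ block (p , u , v)
    factOf∈ x∈ y∈ = ∈-concatMap⁺ (λ t → ((p , u , v) , t) ∷ [])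
      (∈-tuples 13 v₁ ((p , u , v) ∷ ρ₅) (i₁∈ w ∷ t₁∈ w ∷ i₂∈ w ∷ t₂∈ w ∷ α∈ u ∷ α∈ v ∷ β∈ u ∷ β∈ v ∷ α∈ B ∷ β∈ A ∷ T∈
            ∷ x∈ ∷ y∈ ∷ []))
      (here refl)

    factOf-ok : Ok factOf
    factOf-ok = edgeOf (joined₁ w) , edgeOf (joined₂ w) , i₁≤t₁ w , i₂≤t₂ w , together , α≤T u , α≤T v , β≤T u , β≤T v , atA , atB
      where
      edgeOf : ∀ {i} → Joined es u v i → Any (λ e → Joins e factOf × proj₂ (proj₂ e) ≡ i) es
      edgeOf (inj₁ e∈) = lose e∈ (inj₁ (refl , refl) , refl)
      edgeOf (inj₂ e∈) = lose e∈ (inj₂ (refl , refl) , refl)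
      together : ¬ (i₁′ w ≡ i₂′ w) ⊎ t₁′ w ≡ t₂′ w
      together with i₁′ w ≟ i₂′ w
      ... | yes eq = inj₂ (consistent w eq)
      ... | no neq = inj₁ neq
      atA : ¬ (u ≡ A) ⊎ α u ≡ 0 × β u ≡ β A
      atA with u ≟ A
      ... | yes refl = inj₂ (αA≡0 , refl)
      ... | no neq   = inj₁ neq
      atB : ¬ (v ≡ B) ⊎ α v ≡ α B × β v ≡ 0
      atB with v ≟ B
      ... | yes refl = inj₂ (refl , βB≡0)
      ... | no neq   = inj₁ neq

    factOf-good : ∀ {acc} → x ∈ cand → y ∈ cand →
      ((pA B , B) ∈ slots ((p , u , v) ∷ acc) → 1 ≤ x) → ((A , pB A) ∈ slots ((p , u , v) ∷ acc) → 1 ≤ y) →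
      Good ((p , u , v) ∷ acc) factOf
    factOf-good x∈ y∈ x≥1 y≥1 = record
      { linked = _ , refl ; αu≡ = refl ; αv≡ = refl ; βu≡ = refl ; βv≡ = refl ; αB≡ = refl ; βA≡ = refl ; dl≡ = refl
      ; X∈ = x∈ ; Y∈ = y∈ ; X≥1 = x≥1 ; Y≥1 = y≥1
      ; fA = λ eq → subst (λ z → α z < α v) eq (proj₂ (parentA a)) , forwardA w eq
      ; bA = bwdA
      ; fB = fwdB
      ; bB = λ eq → subst (λ z → β z < β u) eq (proj₂ (parentB a)) , backwardB w eq
      }
      where
      bwdA : u ≢ A → pA u ≡ v → BwdA factOf
      bwdA u≢A eq = subst (λ z → α z < α u) eq (proj₂ (parentA (proj₂ (predecessorArc u≢A)))) , backwardA w u≢A eq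
        where
        predecessorArc : u ≢ A → ∃[ q ] Arc q u
        predecessorArc u≢A with predecessor valid (complete a) u≢A
        ... | q , q∈ = q , valid-arc valid q∈
      fwdB : v ≢ B → pB v ≡ u → FwdB factOf
      fwdB v≢B eq = subst (λ z → β z < β v) eq (proj₂ (parentB (proj₂ (successor a v≢B)))) , forwardB w v≢B eq

  -- The target slot sets the flag and all others hand it on, so it remains set once the target has
  -- been passed. The targets are the arc from `pA B` to `B` and the arc from `A` to `pB A`, the
  -- last steps of the two walks.
  flag : Slot → Slot → ℕ → ℕ
  flag s target x with s ≟ˢ target
  ... | yes _ = 1
  ... | no _  = x

  flag∈ : ∀ s target {x} → x ∈ cand → flag s target x ∈ cand
  flag∈ s target x∈ with s ≟ˢ target
  ... | yes _ = 1∈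
  ... | no _  = x∈

  flag≥1 : ∀ s target {x p acc} → (target ∈ slots acc → 1 ≤ x) → target ∈ slots ((p , s) ∷ acc) → 1 ≤ flag s target x
  flag≥1 s target h t∈ with s ≟ˢ target | t∈
  ... | yes _ | _          = ≤-refl
  ... | no ne | here eq    = ⊥-elim (ne (sym eq))
  ... | no _  | there t∈′  = h t∈′

  flag-set : ∀ s target x → s ≡ target ⊎ flag s target x ≡ x
  flag-set s target x with s ≟ˢ target
  ... | yes eq = inj₁ eq
  ... | no _   = inj₂ refl

  zero-or-set : ∀ x → x ≡ 0 ⊎ 1 ≤ x
  zero-or-set zero    = inj₁ refl
  zero-or-set (suc x) = inj₂ (s≤s z≤n)

  derived : ∀ l rest → Valid (l ∷ rest) → ∃[ f ] (f ∈ factsOf (concatMap block (l ∷ rest)) × Good (l ∷ rest) f)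
  derived (_ , u , v) [] (ext _ a _ _) = f , facts-complete (block _) [] (factOf∈ (B , B) a x y x∈ y∈)
        (factOf-ok (B , B) a x y) (inj₁ (refl , fx , fy)) , good
    where
    x = flag (u , v) (pA B , B) 0
    y = flag (u , v) (A , pB A) 0
    x∈ = flag∈ (u , v) (pA B , B) 0∈
    y∈ = flag∈ (u , v) (A , pB A) 0∈
    f = factOf (B , B) a x y
    good : Good (((B , B) , u , v) ∷ []) f
    good = factOf-good (B , B) a x y {[]} x∈ y∈ (flag≥1 (u , v) (pA B , B) {p = B , B} {[]} (λ ()))
          (flag≥1 (u , v) (A , pB A) {p = B , B} {[]} (λ ()))
    fx : x ≡ 0 ⊎ v ≡ B × FwdA f
    fx with flag-set (u , v) (pA B , B) 0
    ... | inj₁ refl = inj₂ (refl , fA good refl)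
    ... | inj₂ eq   = inj₁ eq
    fy : y ≡ 0 ⊎ u ≡ A × BwdB f
    fy with flag-set (u , v) (A , pB A) 0
    ... | inj₁ refl = inj₂ (refl , bB good refl)
    ... | inj₂ eq   = inj₁ eq
  derived (_ , u , v) (l′ ∷ rest) (ext valid′ a _ how) with derived l′ rest valid′
  ... | g , g∈ , gg with linked gg
  ...   | _ , refl = f , facts-complete (block _) (concatMap block (l′ ∷ rest)) (factOf∈ s′ a x y x∈ y∈) (factOf-ok s′ a x y)
                           (inj₂ (lose g∈ ((refl , refl) , αB≡ gg , βA≡ gg , dl≡ gg , fx , fy , join how))) , good
    where
    s′ = proj₂ l′
    x = flag (u , v) (pA B , B) (X g)
    y = flag (u , v) (A , pB A) (Y g)
    x∈ = flag∈ (u , v) (pA B , B) (X∈ gg)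
    y∈ = flag∈ (u , v) (A , pB A) (Y∈ gg)
    f = factOf s′ a x y
    good : Good ((s′ , u , v) ∷ l′ ∷ rest) f
    good = factOf-good s′ a x y {l′ ∷ rest} x∈ y∈ (flag≥1 (u , v) (pA B , B) {p = s′} {l′ ∷ rest} (X≥1 gg))
          (flag≥1 (u , v) (A , pB A) {p = s′} {l′ ∷ rest} (Y≥1 gg))
    fx : x ≡ 0 ⊎ 1 ≤ X g ⊎ v ≡ B × FwdA f
    fx with flag-set (u , v) (pA B , B) (X g) | zero-or-set (X g)
    ... | inj₁ refl | _        = inj₂ (inj₂ (refl , fA good refl))
    ... | inj₂ eq   | inj₁ x≡0 = inj₁ (trans eq x≡0)
    ... | inj₂ _    | inj₂ 1≤x = inj₂ (inj₁ 1≤x)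
    fy : y ≡ 0 ⊎ 1 ≤ Y g ⊎ u ≡ A × BwdB f
    fy with flag-set (u , v) (A , pB A) (Y g) | zero-or-set (Y g)
    ... | inj₁ refl | _        = inj₂ (inj₂ (refl , bB good refl))
    ... | inj₂ eq   | inj₁ y≡0 = inj₁ (trans eq y≡0)
    ... | inj₂ _    | inj₂ 1≤y = inj₂ (inj₁ 1≤y)
    arc-g : Arc (src g) (tgt g)
    arc-g = valid-arc valid′ (here refl)
    join : (tgt g ≡ B × u ≡ A) ⊎ (tgt g ≢ B × u ≡ tgt g) →
           tgt g ≡ B ⊎ αv g ≡ α u × βv g ≡ β u × (FwdA g ⊎ BwdA f) × (FwdB g ⊎ BwdB f)
    join (inj₁ (v≡B , _))    = inj₁ v≡B
    join (inj₂ (v≢B , u≡w)) = inj₂ (trans (αv≡ gg) (cong α (sym u≡w)) , trans (βv≡ gg) (cong β (sym u≡w)) , joinA , joinB)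
      where
      u≢A : u ≢ A
      u≢A u≡A = no-in (subst (Arc (src g)) (trans (sym u≡w) u≡A) arc-g)
      -- The parent of the shared vertex is one of its neighbours: on an arc into the vertex it is
      -- the source of `g` by `in-unique`, on an arc out of it the target of `f` by `out-unique`.
      joinA : FwdA g ⊎ BwdA f
      joinA with proj₁ (parentA arc-g)
      ... | inj₁ arc = inj₁ (fA gg (in-unique v≢B arc arc-g))
      ... | inj₂ arc = inj₂ (bA good u≢A (out-unique u≢A (subst (λ z → Arc z (pA z)) (sym u≡w) arc) a))
      joinB : FwdB g ⊎ BwdB f
      joinB with proj₁ (parentB a)
      ... | inj₁ arc = inj₁ (fB gg v≢B (in-unique v≢B (subst (λ z → Arc (pB z) z) u≡w arc) arc-g))
      ... | inj₂ arc = inj₂ (bB good (out-unique u≢A arc a))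

  final-exists : ∃[ f ] (f ∈ factsOf (concatMap block ls) × Final f × dl f ≡ T)
  final-exists = go ls refl
    where
    go : ∀ ks → ks ≡ ls → ∃[ f ] (f ∈ factsOf (concatMap block ks) × Final f × dl f ≡ T)
    go [] eq with first
    ... | v , a with () ← subst (λ z → (A , v) ∈ slots z) (sym eq) (complete a)
    go (l ∷ rest) eq with derived l rest (subst Valid (sym eq) valid)
    ... | f , f∈ , good with linked good
    ...   | _ , refl = f , f∈ , ((cong (λ z → proj₁ (last z)) eq , cong (λ z → proj₂ (last z)) eq) , X≥1 good
          (subst (λ z → (pA B , B) ∈ slots z) (sym eq) (complete intoB)) , Y≥1 good
          (subst (λ z → (A , pB A) ∈ slots z) (sym eq) (complete outOfA))) , dl≡ good
      where
      arcB : Arc (proj₁ (last ls)) B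
      arcB = subst (Arc (proj₁ (last ls))) lastB (valid-arc valid (subst (λ z → last z ∈ slots z) eq (here refl)))
      intoB : Arc (pA B) B
      intoB with proj₁ (parentA arcB)
      ... | inj₁ arc = arc
      ... | inj₂ arc = ⊥-elim (no-out arc)
      outOfA : Arc A (pB A)
      outOfA with proj₁ (parentB (proj₂ first))
      ... | inj₁ arc = ⊥-elim (no-in arc)
      ... | inj₂ arc = arc

-- Temporal reachability

least : (P : ℕ → Set) → (∀ n → Dec (P n)) → ∀ n → P n → ∃[ m ] (P m × m ≤ n × (∀ k → P k → m ≤ k))
least P P? zero    p = 0 , p , z≤n , λ _ _ → z≤n
least P P? (suc n) p with P? 0
... | yes p₀ = 0 , p₀ , z≤n , λ _ _ → z≤n
... | no ¬p₀ with least (λ k → P (suc k)) (λ k → P? (suc k)) n p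
...   | m , pm , m≤n , min = suc m , pm , s≤s m≤n , λ where
        zero    p₀ → ⊥-elim (¬p₀ p₀)
        (suc k) pk → s≤s (min k pk)

module _ {n : ℕ} (G : TemporalGraph n) (s : Fin n) where

  visited : ∀ {v t vs w} → TemporalPath G s v t vs → w ∈ vs → ReachesBy G s t w
  visited start (here refl) = 0 , _ , start , z≤n
  visited p@(step _ _ _ _) (here refl) = _ , _ , p , ≤-refl
  visited (step p _ t<i _) (there w∈) with visited p w∈
  ... | a , ws , q , a≤t = a , ws , q , ≤-trans a≤t (<⇒≤ t<i)

  reach-mono : ∀ {t t′ v} → t ≤ t′ → ReachesBy G s t v → ReachesBy G s t′ v
  reach-mono t≤t′ (a , vs , p , a≤t) = a , vs , p , ≤-trans a≤t t≤t′

  reach-start : ∀ {t} → ReachesBy G s t s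
  reach-start = 0 , _ , start , z≤n

  -- Temporal paths may not revisit vertices. If `v` already lies on the path, the initial segment
  -- up to `v` is a path that arrives even earlier.
  reach-step : ∀ {t u v i} → ReachesBy G s t u → HasLabel G u v i → t < i → ReachesBy G s i v
  reach-step {v = v} (a , vs , p , a≤t) lab t<i with member? Fin._≟_ v vs
  ... | yes v∈ = reach-mono (≤-trans a≤t (<⇒≤ t<i)) (visited p v∈)
  ... | no  v∉ = _ , _ , step p lab (≤-<-trans a≤t t<i) v∉ , ≤-refl

  hasLabel? : ∀ u v i → Dec (HasLabel G u v i)
  hasLabel? u v i = mem (u , v , i) ⊎-dec mem (v , u , i)
    where
    mem : ∀ e → Dec (e ∈ timeEdges G)
    mem e = member? (≡-dec Fin._≟_ (≡-dec Fin._≟_ _≟_)) e (timeEdges G)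

  -- Induction on time: a path arriving exactly at `suc t` has a last edge with that label, leaving
  -- a vertex reached by time `t`.
  reaches? : ∀ t v → Dec (ReachesBy G s t v)
  reaches? zero v with v Fin.≟ s
  ... | yes refl = yes reach-start
  ... | no v≢s = no λ where
    (_ , _ , start , _) → v≢s refl
    (_ , _ , step _ _ t<i _ , i≤0) → <⇒≱ (≤-<-trans z≤n t<i) i≤0
  reaches? (suc t) v with reaches? t v
  ... | yes r = yes (reach-mono (n≤1+n t) r)
  ... | no ¬r with any? (λ u → reaches? t u ×-dec hasLabel? u v (suc t))
  ...   | yes (u , r , lab) = yes (reach-step r lab ≤-refl)
  ...   | no ¬any = no λ where
          (_ , _ , start , _) → ¬r reach-start
          (i , vs , p@(step {u} q lab t<i _) , i≤) → late i vs p q lab t<i i≤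
    where
    late : ∀ {u t′ vs′} i vs → TemporalPath G s v i vs → TemporalPath G s u t′ vs′ → HasLabel G u v i → t′ < i → i ≤ suc t → ⊥
    late i vs p q lab t<i i≤ with m≤n⇒m<n∨m≡n i≤
    ... | inj₁ (s≤s i≤t) = ¬r (i , vs , p , i≤t)
    ... | inj₂ refl = ¬any (_ , (_ , _ , q , ≤-pred t<i) , lab)

  module Arrival {T : ℕ} (reached : ∀ v → ReachesBy G s T v) where

    private
      earliest : ∀ v → ∃[ m ] (ReachesBy G s m v × m ≤ T × (∀ k → ReachesBy G s k v → m ≤ k))
      earliest v = least (λ t → ReachesBy G s t v) (λ t → reaches? t v) T (reached v)

    arrival : Fin n → ℕ
    arrival v = proj₁ (earliest v)

    arrival≤ : ∀ v → arrival v ≤ T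
    arrival≤ v = proj₁ (proj₂ (proj₂ (earliest v)))

    arrival-min : ∀ {v k} → ReachesBy G s k v → arrival v ≤ k
    arrival-min {v} r = proj₂ (proj₂ (proj₂ (earliest v))) _ r

    arrival-source : arrival s ≡ 0
    arrival-source = n≤0⇒n≡0 (arrival-min reach-start)

    private
      parentOf : ∀ v → v ≢ s → ∃[ u ] (HasLabel G u v (arrival v) × arrival u < arrival v)
      parentOf v v≢s with proj₁ (proj₂ (earliest v))
      ... | _ , _ , start , _ = ⊥-elim (v≢s refl)
      -- By minimality the last label of the path found is the earliest arrival time itself, so the
      -- arrival coincides with a label.
      ... | i , vs , p@(step {u} {t = t} q lab t<i _) , i≤ with ≤-antisym i≤ (arrival-min (i , vs , p , ≤-refl))
      ...   | refl = u , lab , ≤-<-trans (arrival-min (t , _ , q , ≤-refl)) t<i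

    -- The source is its own parent.
    parent : Fin n → Fin n
    parent v with v Fin.≟ s
    ... | yes _  = v
    ... | no v≢s = proj₁ (parentOf v v≢s)

    parent-label : ∀ {v} → v ≢ s → HasLabel G (parent v) v (arrival v) × arrival (parent v) < arrival v
    parent-label {v} v≢s with v Fin.≟ s
    ... | yes eq  = ⊥-elim (v≢s eq)
    ... | no v≢s′ = proj₂ (parentOf v v≢s′)

-- Compressing times

module Compression (L U : List ℕ) where

  -- Labels stay put and every other time slides down as far as the order of the used times permits.
  compress : ℕ → ℕ
  compress zero = 0
  compress (suc t) with member? _≟_ (suc t) L | member? _≟_ (suc t) U
  ... | yes _ | _     = suc t
  ... | no _  | yes _ = suc (compress t)
  ... | no _  | no _  = compress t

  compress≤ : ∀ t → compress t ≤ t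
  compress≤ zero = z≤n
  compress≤ (suc t) with member? _≟_ (suc t) L | member? _≟_ (suc t) U
  ... | yes _ | _     = ≤-refl
  ... | no _  | yes _ = s≤s (compress≤ t)
  ... | no _  | no _  = m≤n⇒m≤1+n (compress≤ t)

  -- Together with monotonicity, fixing the original labels ensures that compressed delays never
  -- fall below the label they started from.
  compress-label : ∀ {l} → l ∈ L → compress l ≡ l
  compress-label {zero} _ = refl
  compress-label {suc t} l∈ with member? _≟_ (suc t) L
  ... | yes _ = refl
  ... | no l∉ = ⊥-elim (l∉ l∈)

  compress-suc : ∀ t → compress t ≤ compress (suc t)
  compress-suc t with member? _≟_ (suc t) L | member? _≟_ (suc t) U
  ... | yes _ | _     = m≤n⇒m≤1+n (compress≤ t)
  ... | no _  | yes _ = n≤1+n _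
  ... | no _  | no _  = ≤-refl

  compress-mono′ : ∀ {s t} → s ≤′ t → compress s ≤ compress t
  compress-mono′ (≤′-reflexive refl) = ≤-refl
  compress-mono′ (≤′-step s≤t) = ≤-trans (compress-mono′ s≤t) (compress-suc _)

  compress-mono : ∀ {s t} → s ≤ t → compress s ≤ compress t
  compress-mono s≤t = compress-mono′ (≤⇒≤′ s≤t)

  -- Temporal paths need strict inequality only where the later time is a label of the solution, and
  -- `U` will contain all of these.
  compress-strict : ∀ {s t} → s < t → t ∈ U → compress s < compress t
  compress-strict {s} {suc t} (s≤s s≤t) t∈ = ≤-<-trans (compress-mono s≤t) jump
    where
    jump : compress t < compress (suc t)
    jump with member? _≟_ (suc t) L | member? _≟_ (suc t) U
    ... | yes _ | _     = s≤s (compress≤ t)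
    ... | no _  | yes _ = ≤-refl
    ... | no _  | no t∉ = ⊥-elim (t∉ t∈)

  count : List ℕ → ℕ → ℕ
  count []       t = 0
  count (x ∷ xs) t with x ≤? t
  ... | yes _ = suc (count xs t)
  ... | no _  = count xs t

  count≤length : ∀ xs t → count xs t ≤ length xs
  count≤length []       t = z≤n
  count≤length (x ∷ xs) t with x ≤? t
  ... | yes _ = s≤s (count≤length xs t)
  ... | no _  = m≤n⇒m≤1+n (count≤length xs t)

  count-suc : ∀ xs t → count xs t ≤ count xs (suc t)
  count-suc []       t = z≤n
  count-suc (x ∷ xs) t with x ≤? t | x ≤? suc t
  ... | yes _   | yes _ = s≤s (count-suc xs t)
  ... | yes x≤t | no x≰ = ⊥-elim (x≰ (m≤n⇒m≤1+n x≤t))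
  ... | no _    | yes _ = m≤n⇒m≤1+n (count-suc xs t)
  ... | no _    | no _  = count-suc xs t

  count-jump : ∀ {xs t} → suc t ∈ xs → count xs t < count xs (suc t)
  count-jump {x ∷ xs} {t} (here refl) with x ≤? t | x ≤? suc t
  ... | yes x≤t | _     = ⊥-elim (<-irrefl refl x≤t)
  ... | no _    | yes _ = s≤s (count-suc xs t)
  ... | no _    | no x≰ = ⊥-elim (x≰ ≤-refl)
  count-jump {x ∷ xs} {t} (there t∈) with x ≤? t | x ≤? suc t
  ... | yes _   | yes _ = s≤s (count-jump t∈)
  ... | yes x≤t | no x≰ = ⊥-elim (x≰ (m≤n⇒m≤1+n x≤t))
  ... | no _    | yes _ = m≤n⇒m≤1+n (count-jump t∈)
  ... | no _    | no _  = count-jump t∈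

  -- Let `l` be the last label up to `t`, or 0. Each increment since then is charged to a different
  -- element of `U`, which `count` keeps track of; at a label the count `j` starts again from 0.
  compress-form : ∀ t → ∃[ l ] ∃[ j ] (l ∈ 0 ∷ L × j ≤ length U × compress t ≡ j + l)
  compress-form t with form t
    where
    form : ∀ t → ∃[ l ] ∃[ j ] (l ∈ 0 ∷ L × j ≤ count U t × compress t ≡ j + l)
    form zero = 0 , 0 , here refl , z≤n , refl
    form (suc t) with member? _≟_ (suc t) L | member? _≟_ (suc t) U | form t
    ... | yes l∈ | _      | _                    = suc t , 0 , there l∈ , z≤n , refl
    ... | no _   | yes t∈ | l , j , l∈ , j≤ , eq = l , suc j , l∈ , ≤-<-trans j≤ (count-jump t∈) , cong suc eq
    ... | no _   | no _   | l , j , l∈ , j≤ , eq = l , j , l∈ , ≤-trans j≤ (count-suc U t) , eq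
  ... | l , j , l∈ , j≤ , eq = l , j , l∈ , ≤-trans j≤ (count≤length U t) , eq

-- Candidate times

labelsOf : List TEdge → List ℕ
labelsOf = map (λ e → proj₂ (proj₂ e))

labels₀-map : ∀ (es : List TEdge) → concatMap (λ e → proj₂ (proj₂ e) ∷ []) es ≡ labelsOf es
labels₀-map []       = refl
labels₀-map (e ∷ es) = cong (proj₂ (proj₂ e) ∷_) (labels₀-map es)

ramp : ℕ → List ℕ → ℕ → List ℕ
ramp l acc _ = caseList acc (l ∷ []) (λ m _ → suc m ∷ [])

ramp-head : ∀ l x xs → chainList (ramp l) (x ∷ xs) ≡ (length xs + l) ∷ chainList (ramp l) xs
ramp-head l x []        = refl
ramp-head l x (x′ ∷ xs) rewrite ramp-head l x′ xs = refl

∈-ramp : ∀ l xs {j} → j < length xs → j + l ∈ chainList (ramp l) xs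
∈-ramp l (x ∷ xs) {j} (s≤s j≤) rewrite ramp-head l x xs with m≤n⇒m<n∨m≡n j≤
... | inj₁ j<  = there (∈-ramp l xs j<)
... | inj₂ refl = here refl

∈-cand : ∀ (ls : List Link) (B A : ℕ) es (input : ⟦ Input ⟧ᵗ) {l j} → l ∈ 0 ∷ labelsOf es → j ≤ length es →
         j + l ∈ ⟦ candT ⟧ (ls ∷ B ∷ A ∷ es ∷ input ∷ [])
∈-cand ls B A es input {l} {j} l∈ j≤ =
  ∈-concatMap⁺ (λ l → chainList (ramp l) (0 ∷ concatMap (λ e → proj₂ (proj₂ e) ∷ []) es))
    (subst (λ z → l ∈ 0 ∷ z) (sym (labels₀-map es)) l∈)
    (∈-ramp l (0 ∷ concatMap (λ e → proj₂ (proj₂ e) ∷ []) es)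
      (s≤s (≤-trans j≤ (≤-reflexive (sym (trans (cong length (labels₀-map es)) (length-map (λ e → proj₂ (proj₂ e)) es)))))))

-- From a solution to a certificate

raw : ∀ {n} → TimeEdge n → TEdge
raw (u , v , i) = toℕ u , toℕ v , i

edgesOf : ∀ {n} → TemporalGraph n → List TEdge
edgesOf G = map raw (timeEdges G)

raw-injective : ∀ {n} {e e′ : TimeEdge n} → raw e ≡ raw e′ → e ≡ e′
raw-injective eq = cong₂ _,_ (toℕ-injective (cong proj₁ eq))
  (cong₂ _,_ (toℕ-injective (cong (λ e → proj₁ (proj₂ e)) eq)) (cong (λ e → proj₂ (proj₂ e)) eq))

∈-edgesOf⁻ : ∀ {n} (G : TemporalGraph n) {u v : Fin n} {i} → (toℕ u , toℕ v , i) ∈ edgesOf G → (u , v , i) ∈ timeEdges G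
∈-edgesOf⁻ G e∈ with ∈-map⁻ raw e∈
... | e , e∈′ , eq = subst (_∈ timeEdges G) (sym (raw-injective eq)) e∈′

-- The value 0 outside the vertex set is a candidate and meets every deadline, so the fields of a
-- certificate can speak of all numbers.
extend : ∀ {n} → (Fin n → ℕ) → ℕ → ℕ
extend {n} f u with u <? n
... | yes u<n = f (fromℕ< u<n)
... | no _    = 0

extend-toℕ : ∀ {n} (f : Fin n → ℕ) v → extend f (toℕ v) ≡ f v
extend-toℕ {n} f v with toℕ v <? n
... | yes v<n = cong f (fromℕ<-toℕ v v<n)
... | no v≮n  = ⊥-elim (v≮n (toℕ<n v))

extend-all : ∀ {n} (P : ℕ → Set) (f : Fin n → ℕ) → P 0 → (∀ v → P (f v)) → ∀ u → P (extend f u)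
extend-all {n} P f p₀ p u with u <? n
... | yes u<n = p (fromℕ< u<n)
... | no _    = p₀

module FromSolution {n} (G H : TemporalGraph n) (A B : Fin n) (arcs : Arcs (edgesOf G) (toℕ A) (toℕ B)) (delays : G DelaysTo H)
  {T : ℕ} (reachA : ∀ v → ReachesBy H A T v) (reachB : ∀ v → ReachesBy H B T v)
  (cand : List ℕ) (∈cand : ∀ {l j} → l ∈ 0 ∷ labelsOf (edgesOf G) → j ≤ length (edgesOf G) → j + l ∈ cand) where
  open Arcs arcs

  private
    es = edgesOf G
    δ = proj₁ delays

  newTime : TimeEdge n → ℕ
  newTime e@(_ , _ , i) = i + δ e

  open Compression (labelsOf es) (map newTime (timeEdges G))

  compress∈ : ∀ t → compress t ∈ cand
  compress∈ t with compress-form t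
  ... | l , j , l∈ , j≤ , eq = subst (_∈ cand) (sym eq)
    (∈cand l∈ (≤-trans j≤ (≤-reflexive (trans (length-map newTime (timeEdges G)) (sym (length-map raw (timeEdges G)))))))

  _between_and_ : TimeEdge n → Fin n → Fin n → Set
  e between u and v = e ∈ timeEdges G × ((proj₁ e ≡ u × proj₁ (proj₂ e) ≡ v) ⊎ (proj₁ e ≡ v × proj₁ (proj₂ e) ≡ u))

  swap : ∀ {e u v} → e between u and v → e between v and u
  swap (e∈ , inj₁ eqs) = e∈ , inj₂ eqs
  swap (e∈ , inj₂ eqs) = e∈ , inj₁ eqs

  -- The fixed orientation of time edges leaves only one way to store an edge with a given label.
  -- Hence if both sources use the same label, they see the same delay.
  between-unique : ∀ {e e′ u v} → e between u and v → e′ between u and v → proj₂ (proj₂ e) ≡ proj₂ (proj₂ e′) → e ≡ e′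
  between-unique (_ , inj₁ (refl , refl)) (_ , inj₁ (refl , refl)) refl = refl
  between-unique (_ , inj₂ (refl , refl)) (_ , inj₂ (refl , refl)) refl = refl
  between-unique (e∈ , inj₁ (refl , refl)) (e′∈ , inj₂ (refl , refl)) _ = ⊥-elim
        (<-asym (All.lookup (oriented G) e∈) (All.lookup (oriented G) e′∈))
  between-unique (e∈ , inj₂ (refl , refl)) (e′∈ , inj₁ (refl , refl)) _ = ⊥-elim
        (<-asym (All.lookup (oriented G) e∈) (All.lookup (oriented G) e′∈))

  label-source : ∀ {u v j} → HasLabel H u v j → ∃[ e ] (e between u and v × j ≡ newTime e)
  label-source (inj₁ h) with Equivalence.to (proj₂ delays _ _ _) h
  ... | i , e∈ , eq = _ , (e∈ , inj₁ (refl , refl)) , eq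
  label-source (inj₂ h) with Equivalence.to (proj₂ delays _ _ _) h
  ... | i , e∈ , eq = _ , (e∈ , inj₂ (refl , refl)) , eq

  between⇒joined : ∀ {e u v} → e between u and v → Joined es (toℕ u) (toℕ v) (proj₂ (proj₂ e))
  between⇒joined (e∈ , inj₁ (refl , refl)) = inj₁ (∈-map⁺ raw e∈)
  between⇒joined (e∈ , inj₂ (refl , refl)) = inj₂ (∈-map⁺ raw e∈)

  between⇒arc : ∀ {e u v} → e between u and v → Arc (toℕ u) (toℕ v) ⊎ Arc (toℕ v) (toℕ u)
  between⇒arc b with between⇒joined b
  ... | inj₁ e∈ = edge⇒arc e∈
  ... | inj₂ e∈ with edge⇒arc e∈
  ...   | inj₁ a = inj₂ a
  ...   | inj₂ a = inj₁ a

  label≤compress : ∀ {e} → e ∈ timeEdges G → proj₂ (proj₂ e) ≤ compress (newTime e)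
  label≤compress {e} e∈ = ≤-trans (≤-reflexive (sym (compress-label
        (∈-map⁺ (λ e → proj₂ (proj₂ e)) (∈-map⁺ raw e∈)))))
        (compress-mono {proj₂ (proj₂ e)} {newTime e} (m≤m+n _ (δ e)))

  label∈ : ∀ {e} → e ∈ timeEdges G → proj₂ (proj₂ e) ∈ cand
  label∈ e∈ = ∈cand (there (∈-map⁺ (λ e → proj₂ (proj₂ e)) (∈-map⁺ raw e∈))) z≤n

  data OnFin : ℕ → ℕ → Set where
    onFin : ∀ {e} u v → e between u and v → OnFin (toℕ u) (toℕ v)

  arc⇒onFin : ∀ {u v} → Arc u v → OnFin u v
  arc⇒onFin a with arc⇒edge a
  ... | i , inj₁ h with ∈-map⁻ raw h
  ...   | e , e∈ , refl = onFin _ _ (e∈ , inj₁ (refl , refl))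
  arc⇒onFin a | i , inj₂ h with ∈-map⁻ raw h
  ...   | e , e∈ , refl = onFin _ _ (e∈ , inj₂ (refl , refl))

  module FromSource (s : Fin n) (reach : ∀ v → ReachesBy H s T v) where
    open Arrival H s reach public

    used : ∀ {e u v} → e between u and v → newTime e ∈ map newTime (timeEdges G)
    used (e∈ , _) = ∈-map⁺ newTime e∈

    times : ℕ → ℕ
    times = extend (λ v → compress (arrival v))

    parents : ℕ → ℕ
    parents = extend (λ v → toℕ (parent v))

    times-toℕ : ∀ v → times (toℕ v) ≡ compress (arrival v)
    times-toℕ = extend-toℕ _

    parents-toℕ : ∀ v → parents (toℕ v) ≡ toℕ (parent v)
    parents-toℕ = extend-toℕ _

    times∈ : ∀ u → times u ∈ cand
    times∈ = extend-all (_∈ cand) _ (compress∈ 0) (λ v → compress∈ (arrival v))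

    times≤ : ∀ u → times u ≤ compress T
    times≤ = extend-all (_≤ compress T) _ z≤n (λ v → compress-mono (arrival≤ v))

    parent-arc : ∀ {v} → v ≢ s →
      (Arc (parents (toℕ v)) (toℕ v) ⊎ Arc (toℕ v) (parents (toℕ v))) × times (parents (toℕ v)) < times (toℕ v)
    parent-arc {v} v≢s with label-source (proj₁ (parent-label v≢s))
    ... | e , b , eq rewrite parents-toℕ v | times-toℕ (parent v) | times-toℕ v =
      between⇒arc b , compress-strict (proj₂ (parent-label v≢s)) (subst (_∈ map newTime (timeEdges G)) (sym eq) (used b))

    -- One label per source is enough on an edge: its two ends cannot be parents of each other,
    -- because a parent is reached strictly earlier. If neither end is the parent of the other, the
    -- given `e₀` fills the place.
    useAt : ∀ {e₀} u v → e₀ between u and v → Dec (v ≢ s × parent v ≡ u) → Dec (u ≢ s × parent u ≡ v) → ∃[ e ]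
          (e between u and v ×
      (v ≢ s → parent v ≡ u → arrival v ≡ newTime e) × (u ≢ s → parent u ≡ v → arrival u ≡ newTime e))
    useAt u v _ (yes (v≢s , refl)) _ with label-source (proj₁ (parent-label v≢s))
    ... | e , b , eq = e , b , (λ _ _ → eq) , λ u≢s p → ⊥-elim (<-asym (proj₂ (parent-label v≢s))
            (subst (λ z → arrival z < arrival (parent v)) p (proj₂ (parent-label u≢s))))
    useAt u v _ (no ¬v) (yes (u≢s , refl)) with label-source (proj₁ (parent-label u≢s))
    ... | e , b , eq = e , swap b , (λ v≢s p → ⊥-elim (¬v (v≢s , p))) , λ _ _ → eq
    useAt u v b (no ¬v) (no ¬u) = _ , b , (λ v≢s p → ⊥-elim (¬v (v≢s , p))) , λ u≢s p → ⊥-elim (¬u (u≢s , p))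

    use : ∀ {e₀} u v → e₀ between u and v → ∃[ e ] (e between u and v ×
      (v ≢ s → parents (toℕ v) ≡ toℕ u → times (toℕ v) ≡ compress (newTime e)) ×
      (u ≢ s → parents (toℕ u) ≡ toℕ v → times (toℕ u) ≡ compress (newTime e)))
    use u v b₀ with useAt u v b₀ (¬? (v Fin.≟ s) ×-dec parent v Fin.≟ u) (¬? (u Fin.≟ s) ×-dec parent u Fin.≟ v)
    ... | e , b , fwd , bwd = e , b ,
      (λ v≢s p → trans (times-toℕ v) (cong compress (fwd v≢s (toℕ-injective (trans (sym (parents-toℕ v)) p))))) ,
      (λ u≢s p → trans (times-toℕ u) (cong compress (bwd u≢s (toℕ-injective (trans (sym (parents-toℕ u)) p)))))

  module FA = FromSource A reachA
  module FB = FromSource B reachB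

  certificate : Certificate arcs cand (compress T)
  certificate = record
    { α = FA.times ; β = FB.times ; pA = FA.parents ; pB = FB.parents
    ; uses    = uses
    ; parentA = λ a → parentA a (arc⇒onFin a)
    ; parentB = λ a → parentB a (arc⇒onFin a)
    ; αA≡0    = trans (FA.times-toℕ A) (cong compress FA.arrival-source)
    ; βB≡0    = trans (FB.times-toℕ B) (cong compress FB.arrival-source)
    ; α∈      = FA.times∈
    ; β∈      = FB.times∈
    ; T∈      = compress∈ T
    ; 0∈      = compress∈ 0
    -- The value 1 occurs as a flag, and flags are drawn from the candidates like all other entries
    -- of a fact. It is the sum of the base 0 and one, available because there is at least one edge.
    ; 1∈      = ∈cand (here refl) nonempty
    ; α≤T     = FA.times≤
    ; β≤T     = FB.times≤
    }
    where
    nonempty : 1 ≤ length es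
    nonempty with es | arc⇒edge (proj₂ first)
    ... | _ ∷ _ | _ = s≤s z≤n
    ... | [] | _ , inj₁ ()
    ... | [] | _ , inj₂ ()
    parentA : ∀ {u v} → Arc u v → OnFin u v → (Arc (FA.parents v) v ⊎ Arc v (FA.parents v)) × FA.times (FA.parents v) < FA.times v
    parentA a (onFin u v _) = FA.parent-arc λ { refl → no-in a }
    parentB : ∀ {u v} → Arc u v → OnFin u v → (Arc (FB.parents u) u ⊎ Arc u (FB.parents u)) × FB.times (FB.parents u) < FB.times u
    parentB a (onFin u v _) = FB.parent-arc λ { refl → no-out a }
    usesAt : ∀ {u v} → Arc u v → OnFin u v → Uses es (toℕ A) (toℕ B) cand FA.times FB.times FA.parents FB.parents u v
    usesAt a (onFin u v b₀) with FA.use u v b₀ | FB.use u v b₀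
    ... | e₁ , b₁ , fwdA , bwdA | e₂ , b₂ , fwdB , bwdB = record
      { i₁′ = proj₂ (proj₂ e₁) ; t₁′ = compress (newTime e₁) ; i₂′ = proj₂ (proj₂ e₂) ; t₂′ = compress (newTime e₂)
      ; i₁∈ = label∈ (proj₁ b₁) ; t₁∈ = compress∈ (newTime e₁) ; i₂∈ = label∈ (proj₁ b₂) ; t₂∈ = compress∈ (newTime e₂)
      ; joined₁ = between⇒joined b₁ ; joined₂ = between⇒joined b₂
      ; i₁≤t₁ = label≤compress (proj₁ b₁) ; i₂≤t₂ = label≤compress (proj₁ b₂)
      ; consistent = λ eq → cong (λ e → compress (newTime e)) (between-unique b₁ b₂ eq)
      ; forwardA  = fwdA (λ { refl → no-in a })
      ; backwardA = λ u≢A → bwdA (λ { refl → u≢A refl })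
      ; forwardB  = λ v≢B → fwdB (λ { refl → v≢B refl })
      ; backwardB = bwdB (λ { refl → no-out a })
      }
    uses : ∀ {u v} → Arc u v → Uses es (toℕ A) (toℕ B) cand FA.times FB.times FA.parents FB.parents u v
    uses a = usesAt a (arc⇒onFin a)

-- Removing repetitions

module Dedup {Γ} (ρ : Env Γ) where

  dedupStep : List TEdge → TEdge → List TEdge
  dedupStep acc y = ⟦ ite (test (¬ᶠ repeated)) (cons v₁ nil) nil ⟧ (acc ∷ y ∷ ρ)

  deduped : List TEdge → List TEdge
  deduped = chainList dedupStep

  ∈-dedupStep⁻ : ∀ acc y {z} → z ∈ dedupStep acc y → z ≡ y × y ∉ acc
  ∈-dedupStep⁻ acc y z∈ with ∈-guard⁻ (¬ᶠ repeated) (acc ∷ y ∷ ρ) z∈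
  ... | eq , ¬rep = eq , λ y∈ → ¬rep (lose y∈ (refl , refl , refl))

  dedupStep-or-∈ : ∀ acc y → y ∈ push (dedupStep acc y) acc
  dedupStep-or-∈ acc y with ⟦ test repeated ⟧ (acc ∷ y ∷ ρ) | test-reflects repeated (acc ∷ y ∷ ρ)
  ... | false | _ = here refl
  ... | true  | ofʸ rep = Any.map (λ { (refl , refl , refl) → refl }) rep

  deduped-unique : ∀ xs → Unique (deduped xs)
  deduped-unique xs = chain-invariant Unique dedupStep [] xs extended
    where
    extended : ∀ {acc x y} → x ∈ xs → Unique acc → y ∈ dedupStep acc x → Unique (y ∷ acc)
    extended {acc} {x} _ u y∈ with ∈-dedupStep⁻ acc x y∈
    ... | refl , x∉ = ¬Any⇒All¬ _ x∉ ∷ u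

  deduped-⊆ : ∀ xs → deduped xs ⊆ xs
  deduped-⊆ xs = chain-invariant (_⊆ xs) dedupStep (λ ()) xs extended
    where
    extended : ∀ {acc x y} → x ∈ xs → acc ⊆ xs → y ∈ dedupStep acc x → y ∷ acc ⊆ xs
    extended {acc} {x} x∈ sub y∈ (here refl) with ∈-dedupStep⁻ acc x y∈
    ... | refl , _ = x∈
    extended x∈ sub y∈ (there z∈) = sub z∈

  deduped-⊇ : ∀ xs → xs ⊆ deduped xs
  deduped-⊇ (x ∷ xs) (here refl) = dedupStep-or-∈ (deduped xs) x
  deduped-⊇ (x ∷ xs) (there y∈)  = keep (dedupStep (deduped xs) x) (deduped-⊇ xs y∈)
    where
    keep : ∀ zs {acc z} → z ∈ acc → z ∈ push zs acc
    keep []      z∈ = z∈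
    keep (_ ∷ _) z∈ = there z∈

-- The relabelled graph and its temporal paths

preimages : ∀ {n} (ys : List TEdge) → (∀ {y} → y ∈ ys → ∃[ e ] raw {n} e ≡ y) → ∃[ xs ] map (raw {n}) xs ≡ ys
preimages []       _ = [] , refl
preimages (y ∷ ys) h with h (here refl) | preimages ys (λ y∈ → h (there y∈))
... | e , refl | xs , refl = e ∷ xs , refl

renew : Fact → ℕ → ℕ
renew x i = if ⟦ test (v₁ ≐ i₁ᵉ v₀) ⟧ (x ∷ i ∷ []) then t₁ x else (if ⟦ test (v₁ ≐ i₂ᵉ v₀) ⟧ (x ∷ i ∷ []) then t₂ x else i)

renew₁ : ∀ x {i} → i ≡ i₁ x → renew x i ≡ t₁ x
renew₁ x {i} eq with ⟦ test (v₁ ≐ i₁ᵉ v₀) ⟧ (x ∷ i ∷ []) | test-reflects (v₁ ≐ i₁ᵉ v₀) (x ∷ i ∷ [])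
... | true  | _      = refl
... | false | ofⁿ ne = ⊥-elim (ne eq)

-- If the two labels coincide, the test for `i₁` comes first and answers `t₁`; consistency makes
-- this equal to `t₂`.
renew₂ : ∀ x {i} → ¬ (i₁ x ≡ i₂ x) ⊎ t₁ x ≡ t₂ x → i ≡ i₂ x → renew x i ≡ t₂ x
renew₂ x {i} consistent eq with ⟦ test (v₁ ≐ i₁ᵉ v₀) ⟧ (x ∷ i ∷ []) | test-reflects (v₁ ≐ i₁ᵉ v₀) (x ∷ i ∷ []) | consistent
... | true  | ofʸ eq₁ | inj₁ ne = ⊥-elim (ne (trans (sym eq₁) eq))
... | true  | _       | inj₂ t≡ = t≡
... | false | _       | _ with ⟦ test (v₁ ≐ i₂ᵉ v₀) ⟧ (x ∷ i ∷ []) | test-reflects (v₁ ≐ i₂ᵉ v₀) (x ∷ i ∷ [])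
...   | true  | _      = refl
...   | false | ofⁿ ne = ⊥-elim (ne eq)

renew≥ : ∀ x i → i₁ x ≤ t₁ x → i₂ x ≤ t₂ x → i ≤ renew x i
renew≥ x i h₁ h₂ with ⟦ test (v₁ ≐ i₁ᵉ v₀) ⟧ (x ∷ i ∷ []) | test-reflects (v₁ ≐ i₁ᵉ v₀) (x ∷ i ∷ [])
... | true  | ofʸ eq = ≤-trans (≤-reflexive eq) h₁
... | false | _ with ⟦ test (v₁ ≐ i₂ᵉ v₀) ⟧ (x ∷ i ∷ []) | test-reflects (v₁ ≐ i₂ᵉ v₀) (x ∷ i ∷ [])
...   | true  | ofʸ eq = ≤-trans (≤-reflexive eq) h₂
...   | false | _      = ≤-refl

renewBy : List Fact → ℕ → ℕ
renewBy xs i = caseList xs i (λ x _ → renew x i)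

relabelBy : (TEdge → ℕ) → TEdge → TEdge
relabelBy new e = proj₁ e , proj₁ (proj₂ e) , new e

module Build {n} (G : TemporalGraph n) (new : TEdge → ℕ) (new≥ : ∀ e → proj₂ (proj₂ e) ≤ new e)
  (out : List TEdge) (unique-out : Unique out)
  (∈-out⁺ : ∀ {e} → e ∈ edgesOf G → relabelBy new e ∈ out)
  (∈-out⁻ : ∀ {y} → y ∈ out → ∃[ e ] (e ∈ timeEdges G × y ≡ relabelBy new (raw e))) where

  private
    pre : ∃[ xs ] map raw xs ≡ out
    pre = preimages out λ y∈ → let ((u , v , _) , _ , eq) = ∈-out⁻ y∈ in (u , v , _) , sym eq

  outEdges : List (TimeEdge n)
  outEdges = proj₁ pre

  ∈-outEdges : ∀ {e} → e ∈ outEdges → ∃[ i ] ((proj₁ e , proj₁ (proj₂ e) , i) ∈ timeEdges G × proj₂ (proj₂ e) ≡ new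
        (raw (proj₁ e , proj₁ (proj₂ e) , i)))
  ∈-outEdges {u , v , j} e∈ with ∈-out⁻ (subst (raw (u , v , j) ∈_) (proj₂ pre) (∈-map⁺ raw e∈))
  ... | (u′ , v′ , i) , e′∈ , eq with toℕ-injective (cong proj₁ eq) | toℕ-injective (cong (λ e → proj₁ (proj₂ e)) eq)
  ...   | refl | refl = i , e′∈ , cong (λ e → proj₂ (proj₂ e)) eq

  output : TemporalGraph n
  output = record
    { timeEdges = outEdges
    ; oriented  = All.tabulate λ e∈ → All.lookup (oriented G) (proj₁ (proj₂ (∈-outEdges e∈)))
    ; positive  = All.tabulate λ { {u , v , _} e∈ → let (i , e′∈ , eq) = ∈-outEdges e∈ in
                    ≤-trans (All.lookup (positive G) e′∈) (≤-trans (new≥ (raw (u , v , i))) (≤-reflexive (sym eq))) }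
    ; unique    = UniqueP.map⁻ (subst Unique (sym (proj₂ pre)) unique-out)
    }

  delayed : G DelaysTo output
  delayed = (λ e → new (raw e) ∸ proj₂ (proj₂ e)) , λ u v j → mk⇔
    (λ e∈ → let (i , e′∈ , eq) = ∈-outEdges e∈ in i , e′∈ , trans eq (sym (m+[n∸m]≡n (new≥ (raw (u , v , i))))))
    (λ { (i , e∈ , refl) → ∈-edgesOf⁻ output (subst (λ z → (toℕ u , toℕ v , z) ∈ map raw outEdges)
          (sym (m+[n∸m]≡n (new≥ (raw (u , v , i)))))
                              (subst (relabelBy new (raw (u , v , i)) ∈_) (sym (proj₂ pre)) (∈-out⁺ (∈-map⁺ raw e∈)))) })

  encoded : encodeGraph output ≡ enc (natᵗ ⊗ listᵗ edge) (n , out)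
  encoded = cong (num n ∙_) (trans (go outEdges) (cong (enc (listᵗ edge)) (proj₂ pre)))
    where
    go : ∀ xs → encodeList (map encodeTimeEdge xs) ≡ enc (listᵗ edge) (map (raw {n}) xs)
    go []       = refl
    go (x ∷ xs) = cong (enc edge (raw x) ∙_) (go xs)

  Lab : ℕ → ℕ → ℕ → Set
  Lab x y t = (x , y , t) ∈ out ⊎ (y , x , t) ∈ out

  lab-sym : ∀ {x y t} → Lab x y t → Lab y x t
  lab-sym (inj₁ h) = inj₂ h
  lab-sym (inj₂ h) = inj₁ h

  module FromSource (s : Fin n) where

    RB : ℕ → ℕ → Set
    RB x t = ∃[ v ] (toℕ v ≡ x × ReachesBy output s t v)

    rb-step : ∀ {x y t t′} → RB x t → t < t′ → Lab x y t′ → RB y t′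
    rb-step (v , refl , r) t<t′ (inj₁ h) with ∈-map⁻ raw (subst (_ ∈_) (sym (proj₂ pre)) h)
    ... | (u , w , _) , e∈ , eq with toℕ-injective (cong proj₁ eq) | cong (λ e → proj₂ (proj₂ e)) eq
    ...   | refl | refl = w , sym (cong (λ e → proj₁ (proj₂ e)) eq) , reach-step output s r (inj₁ e∈) t<t′
    rb-step (v , refl , r) t<t′ (inj₂ h) with ∈-map⁻ raw (subst (_ ∈_) (sym (proj₂ pre)) h)
    ... | (w , u , _) , e∈ , eq with toℕ-injective (cong (λ e → proj₁ (proj₂ e)) eq) | cong (λ e → proj₂ (proj₂ e)) eq
    ...   | refl | refl = w , sym (cong proj₁ eq) , reach-step output s r (inj₂ e∈) t<t′

    Preceded : (ℕ → ℕ → Set) → ℕ → ℕ → Set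
    Preceded Occ x t = x ≡ toℕ s ⊎ ∃[ y ] ∃[ t′ ] (Occ y t′ × t′ < t × Lab y x t)

    -- Causes have strictly smaller times, so well-founded induction on the time builds a temporal
    -- path. No minimality of the times is involved.
    occurs⇒reached : (Occ : ℕ → ℕ → Set) → (∀ {x t} → Occ x t → Preceded Occ x t) → ∀ {x t} → Occ x t → RB x t
    occurs⇒reached Occ preceded {x} {t} occ = <-rec (λ t → ∀ {x} → Occ x t → RB x t) go t occ
      where
      go : ∀ t → (∀ {t′} → t′ < t → ∀ {x} → Occ x t′ → RB x t′) → ∀ {x} → Occ x t → RB x t
      go t ih occ with preceded occ
      ... | inj₁ refl = s , refl , reach-start output s
      ... | inj₂ (y , t′ , occ′ , t′<t , lab) = rb-step (ih t′<t occ′) t′<t lab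

module Reaching {n} (G : TemporalGraph n) (A B : Fin n) (arcs : Arcs (edgesOf G) (toℕ A) (toℕ B))
  (touched : ∀ (v : Fin n) → ∃[ w ] (Arcs.Arc arcs (toℕ v) w ⊎ Arcs.Arc arcs w (toℕ v)))
  (sel : List Fact) (plan : Plan arcs sel)
  (new : TEdge → ℕ) (new≥ : ∀ e → proj₂ (proj₂ e) ≤ new e)
  (out : List TEdge) (unique-out : Unique out)
  (∈-out⁺ : ∀ {e} → e ∈ edgesOf G → relabelBy new e ∈ out)
  (∈-out⁻ : ∀ {y} → y ∈ out → ∃[ e ] (e ∈ timeEdges G × y ≡ relabelBy new (raw e)))
  (new≡renew : ∀ e {x} → x ∈ sel → Joins e x → new e ≡ renew x (proj₂ (proj₂ e))) where
  open Arcs arcs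
  open Predicates (edgesOf G) (toℕ A) (toℕ B)
  open Plan plan
  open Build G new new≥ out unique-out ∈-out⁺ ∈-out⁻

  lab₁ : ∀ {x} → x ∈ sel → Lab (src x) (tgt x) (t₁ x)
  lab₁ {x} x∈ with find (proj₁ (ok x∈))
  ... | e , e∈ , j , i≡ = at j (subst (λ z → (proj₁ e , proj₁ (proj₂ e) , z) ∈ out)
        (trans (new≡renew e x∈ j) (renew₁ x i≡)) (∈-out⁺ e∈))
    where
    at : Joins e x → (proj₁ e , proj₁ (proj₂ e) , t₁ x) ∈ out → Lab (src x) (tgt x) (t₁ x)
    at (inj₁ (refl , refl)) h = inj₁ h
    at (inj₂ (refl , refl)) h = inj₂ h

  lab₂ : ∀ {x} → x ∈ sel → Lab (src x) (tgt x) (t₂ x)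
  lab₂ {x} x∈ with ok x∈
  ... | _ , any , _ , _ , consistent , _ with find any
  ...   | e , e∈ , j , i≡ = at j (subst (λ z → (proj₁ e , proj₁ (proj₂ e) , z) ∈ out)
        (trans (new≡renew e x∈ j) (renew₂ x consistent i≡)) (∈-out⁺ e∈))
    where
    at : Joins e x → (proj₁ e , proj₁ (proj₂ e) , t₂ x) ∈ out → Lab (src x) (tgt x) (t₂ x)
    at (inj₁ (refl , refl)) h = inj₁ h
    at (inj₂ (refl , refl)) h = inj₂ h

  Occ : (Fact → ℕ) → (Fact → ℕ) → ℕ → ℕ → Set
  Occ τu τv x t = ∃[ f ] (f ∈ sel × ((x ≡ src f × t ≡ τu f) ⊎ (x ≡ tgt f × t ≡ τv f)))

  module Symmetric (τu τv τe : Fact → ℕ) (lab : ∀ {x} → x ∈ sel → Lab (src x) (tgt x) (τe x)) (s : Fin n) where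
    open FromSource s using (Preceded)

    forward : ∀ {x t} f → f ∈ sel → τu f < τv f × τv f ≡ τe f → x ≡ tgt f → t ≡ τv f → Preceded (Occ τu τv) x t
    forward f f∈ (lt , eq) refl refl = inj₂ (src f , τu f , (f , f∈ , inj₁ (refl , refl)) , lt , subst
          (Lab (src f) (tgt f)) (sym eq) (lab f∈))

    backward : ∀ {x t} f → f ∈ sel → τv f < τu f × τu f ≡ τe f → x ≡ src f → t ≡ τu f → Preceded (Occ τu τv) x t
    backward f f∈ (lt , eq) refl refl = inj₂ (tgt f , τv f , (f , f∈ , inj₂ (refl , refl)) , lt , lab-sym
          (subst (Lab (src f) (tgt f)) (sym eq) (lab f∈)))

  module SA = Symmetric αu αv t₁ lab₁ A
  module SB = Symmetric βu βv t₂ lab₂ B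

  -- At an interior vertex the cause lies in one of the two incident slots, as the step condition
  -- says. At `B` all facts claim the same time, and the fact from `parentB`, possibly on another
  -- path, has an actual arrival at that time.
  precededA : ∀ {x t} → Occ αu αv x t → FromSource.Preceded A (Occ αu αv) x t
  precededA (f , f∈ , inj₁ (refl , refl)) with src f ≟ toℕ A
  ... | yes eq = inj₁ eq
  ... | no u≢A with before f∈ u≢A
  ...   | y , y∈ , v≢B , u≡v , (_ , _ , _ , _ , _ , _ , inj₁ v≡B) = ⊥-elim (v≢B v≡B)
  ...   | y , y∈ , v≢B , u≡v , (_ , _ , _ , _ , _ , _ , inj₂ (α≡ , _ , inj₁ fwd , _)) = SA.forward y y∈ fwd u≡v (sym α≡)
  ...   | y , y∈ , v≢B , u≡v , (_ , _ , _ , _ , _ , _ , inj₂ (α≡ , _ , inj₂ bwd , _)) = SA.backward f f∈ bwd refl refl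
  precededA (f , f∈ , inj₂ (refl , refl)) with tgt f ≟ toℕ B
  ... | yes v≡B = atB (ok f∈) parentB
    where
    atB : Ok f → ∃[ x ] (x ∈ sel × tgt x ≡ toℕ B × FwdA x) → FromSource.Preceded A (Occ αu αv) (tgt f) (αv f)
    atB (_ , _ , _ , _ , _ , _ , _ , _ , _ , _ , inj₁ v≢B) _ = ⊥-elim (v≢B v≡B)
    atB (_ , _ , _ , _ , _ , _ , _ , _ , _ , _ , inj₂ (α≡ , _)) (x , x∈ , x≡B , fwd) with ok x∈
    ... | _ , _ , _ , _ , _ , _ , _ , _ , _ , _ , inj₁ x≢B = ⊥-elim (x≢B x≡B)
    ... | _ , _ , _ , _ , _ , _ , _ , _ , _ , _ , inj₂ (α≡′ , _) =
      SA.forward x x∈ fwd (trans v≡B (sym x≡B)) (trans α≡ (trans (proj₁ (same f∈ x∈)) (sym α≡′)))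
  ... | no v≢B with after f∈ v≢B
  ...   | y , y∈ , u≡v , (_ , _ , _ , _ , _ , _ , inj₁ v≡B) = ⊥-elim (v≢B v≡B)
  ...   | y , y∈ , u≡v , (_ , _ , _ , _ , _ , _ , inj₂ (α≡ , _ , inj₁ fwd , _)) = SA.forward f f∈ fwd refl refl
  ...   | y , y∈ , u≡v , (_ , _ , _ , _ , _ , _ , inj₂ (α≡ , _ , inj₂ bwd , _)) = SA.backward y y∈ bwd (sym u≡v) α≡

  precededB : ∀ {x t} → Occ βu βv x t → FromSource.Preceded B (Occ βu βv) x t
  precededB (f , f∈ , inj₂ (refl , refl)) with tgt f ≟ toℕ B
  ... | yes eq = inj₁ eq
  ... | no v≢B with after f∈ v≢B
  ...   | y , y∈ , u≡v , (_ , _ , _ , _ , _ , _ , inj₁ v≡B) = ⊥-elim (v≢B v≡B)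
  ...   | y , y∈ , u≡v , (_ , _ , _ , _ , _ , _ , inj₂ (_ , β≡ , _ , inj₁ fwd)) = SB.forward f f∈ fwd refl refl
  ...   | y , y∈ , u≡v , (_ , _ , _ , _ , _ , _ , inj₂ (_ , β≡ , _ , inj₂ bwd)) = SB.backward y y∈ bwd (sym u≡v) β≡
  precededB (f , f∈ , inj₁ (refl , refl)) with src f ≟ toℕ A
  ... | yes u≡A = atA (ok f∈) parentA
    where
    atA : Ok f → ∃[ x ] (x ∈ sel × src x ≡ toℕ A × BwdB x) → FromSource.Preceded B (Occ βu βv) (src f) (βu f)
    atA (_ , _ , _ , _ , _ , _ , _ , _ , _ , inj₁ u≢A , _) _ = ⊥-elim (u≢A u≡A)
    atA (_ , _ , _ , _ , _ , _ , _ , _ , _ , inj₂ (_ , β≡) , _) (x , x∈ , x≡A , bwd) with ok x∈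
    ... | _ , _ , _ , _ , _ , _ , _ , _ , _ , inj₁ x≢A , _ = ⊥-elim (x≢A x≡A)
    ... | _ , _ , _ , _ , _ , _ , _ , _ , _ , inj₂ (_ , β≡′) , _ =
      SB.backward x x∈ bwd (trans u≡A (sym x≡A)) (trans β≡ (trans (proj₁ (proj₂ (same f∈ x∈))) (sym β≡′)))
  ... | no u≢A with before f∈ u≢A
  ...   | y , y∈ , v≢B , u≡v , (_ , _ , _ , _ , _ , _ , inj₁ v≡B) = ⊥-elim (v≢B v≡B)
  ...   | y , y∈ , v≢B , u≡v , (_ , _ , _ , _ , _ , _ , inj₂ (_ , β≡ , _ , inj₁ fwd)) = SB.forward y y∈ fwd u≡v (sym β≡)
  ...   | y , y∈ , v≢B , u≡v , (_ , _ , _ , _ , _ , _ , inj₂ (_ , β≡ , _ , inj₂ bwd)) = SB.backward f f∈ bwd refl refl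

  occurrence : ∀ (v : Fin n) → ∃[ f ] (f ∈ sel × (toℕ v ≡ src f ⊎ toℕ v ≡ tgt f))
  occurrence v with touched v
  ... | w , inj₁ a with covers a
  ...   | f , f∈ , eq = f , f∈ , inj₁ (sym (cong proj₁ eq))
  occurrence v | w , inj₂ a with covers a
  ...   | f , f∈ , eq = f , f∈ , inj₂ (sym (cong proj₂ eq))

  module _ {m} (m∈ : m ∈ sel) where

    within-deadline : ∀ s {f t} (v : Fin n) → f ∈ sel → FromSource.RB s (toℕ v) t → t ≤ dl f → ReachesBy output s (dl m) v
    within-deadline s v f∈ (w , eq , r) t≤ with toℕ-injective eq
    ... | refl = reach-mono output s (≤-trans t≤ (≤-reflexive (proj₂ (proj₂ (same f∈ m∈))))) r

    reachedA : ∀ v → ReachesBy output A (dl m) v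
    reachedA v with occurrence v
    ... | f , f∈ , at with ok f∈ | at
    ...   | _ , _ , _ , _ , _ , hu , hv , _ | inj₁ eq = within-deadline A v f∈
          (FromSource.occurs⇒reached A (Occ αu αv) precededA (f , f∈ , inj₁ (eq , refl))) hu
    ...   | _ , _ , _ , _ , _ , hu , hv , _ | inj₂ eq = within-deadline A v f∈
          (FromSource.occurs⇒reached A (Occ αu αv) precededA (f , f∈ , inj₂ (eq , refl))) hv

    reachedB : ∀ v → ReachesBy output B (dl m) v
    reachedB v with occurrence v
    ... | f , f∈ , at with ok f∈ | at
    ...   | _ , _ , _ , _ , _ , _ , _ , hu , hv , _ | inj₁ eq = within-deadline B v f∈
          (FromSource.occurs⇒reached B (Occ βu βv) precededB (f , f∈ , inj₁ (eq , refl))) hu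
    ...   | _ , _ , _ , _ , _ , _ , _ , hu , hv , _ | inj₂ eq = within-deadline B v f∈
          (FromSource.occurs⇒reached B (Occ βu βv) precededB (f , f∈ , inj₂ (eq , refl))) hv

module Relabelling {n} (G : TemporalGraph n) (A B : Fin n) (arcs : Arcs (edgesOf G) (toℕ A) (toℕ B))
  (input : ⟦ Input ⟧ᵗ) (ls : List Link) (cand : List ℕ) (fs sel : List Fact) (plan : Plan arcs sel) where
  open Arcs arcs
  open Predicates (edgesOf G) (toℕ A) (toℕ B)
  open Plan plan

  ρ₇ : Env Γ₇
  ρ₇ = sel ∷ fs ∷ cand ∷ ls ∷ toℕ B ∷ toℕ A ∷ edgesOf G ∷ input ∷ []

  matching : TEdge → List Fact
  matching e = ⟦ select v₁ (joins v₁ v₀) ⟧ (e ∷ ρ₇)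

  new : TEdge → ℕ
  new e = renewBy (matching e) (proj₂ (proj₂ e))

  -- Since `antisym` excludes facts for both directions of an edge, an edge matches at most one
  -- selected fact, and taking the first match in `newLabel` loses nothing.
  same-slot : ∀ {e x y} → x ∈ sel → y ∈ sel → Joins e x → Joins e y → x ≡ y
  same-slot x∈ y∈ (inj₁ (refl , refl)) (inj₁ (p , q)) = injective x∈ y∈ (cong₂ _,_ p q)
  same-slot x∈ y∈ (inj₂ (refl , refl)) (inj₂ (p , q)) = injective x∈ y∈ (cong₂ _,_ q p)
  same-slot x∈ y∈ (inj₁ (refl , refl)) (inj₂ (p , q)) = ⊥-elim (antisym (arc x∈) (subst₂ Arc (sym q) (sym p) (arc y∈)))
  same-slot x∈ y∈ (inj₂ (refl , refl)) (inj₁ (p , q)) = ⊥-elim (antisym (arc x∈) (subst₂ Arc (sym p) (sym q) (arc y∈)))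

  new≡renew : ∀ e {x} → x ∈ sel → Joins e x → new e ≡ renew x (proj₂ (proj₂ e))
  new≡renew e {x} x∈ j = go (matching e) (∈-select⁺ v₁ (joins v₁ v₀) (e ∷ ρ₇) x∈ j)
        (λ y∈ → ∈-select⁻ v₁ (joins v₁ v₀) (e ∷ ρ₇) y∈)
    where
    go : ∀ ms → x ∈ ms → (∀ {y} → y ∈ ms → y ∈ sel × Joins e y) → renewBy ms (proj₂ (proj₂ e)) ≡ renew x (proj₂ (proj₂ e))
    go (y ∷ _) _ h with h (here refl)
    ... | y∈ , j′ = cong (λ z → renew z (proj₂ (proj₂ e))) (same-slot {e} y∈ x∈ j′ j)

  new≥ : ∀ e → proj₂ (proj₂ e) ≤ new e
  new≥ e = go (matching e) (λ y∈ → proj₁ (∈-select⁻ v₁ (joins v₁ v₀) (e ∷ ρ₇) y∈))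
    where
    go : ∀ ms → (∀ {y} → y ∈ ms → y ∈ sel) → proj₂ (proj₂ e) ≤ renewBy ms (proj₂ (proj₂ e))
    go []      _ = ≤-refl
    go (y ∷ _) h with ok (h (here refl))
    ... | _ , _ , h₁ , h₂ , _ = renew≥ y _ h₁ h₂

  relabel : TEdge → TEdge
  relabel = relabelBy new

  relabelledEdges : List TEdge
  relabelledEdges = concatMap (λ e → relabel e ∷ []) (edgesOf G)

  ∈-relabelled⁺ : ∀ {e} → e ∈ edgesOf G → relabel e ∈ relabelledEdges
  ∈-relabelled⁺ e∈ = ∈-concatMap⁺ (λ e → relabel e ∷ []) e∈ (here refl)

  ∈-relabelled⁻ : ∀ {y} → y ∈ relabelledEdges → ∃[ e ] (e ∈ timeEdges G × y ≡ relabel (raw e))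
  ∈-relabelled⁻ y∈ with ∈-concatMap⁻ (λ e → relabel e ∷ []) (edgesOf G) y∈
  ... | e , e∈ , here refl with ∈-map⁻ raw e∈
  ...   | e′ , e′∈ , refl = e′ , e′∈ , refl

-- Consecutive elements of a list

-- An inductive form of `Consecutive`, which allows recursion along a route.
data Next {X : Set} (u v : X) : List X → Set where
  here  : ∀ {xs} → Next u v (u ∷ v ∷ xs)
  there : ∀ {x xs} → Next u v xs → Next u v (x ∷ xs)

module _ {X : Set} where

  next-++ : ∀ {u v : X} xs {ys} → Next u v (xs ++ u ∷ v ∷ ys)
  next-++ []       = here
  next-++ (x ∷ xs) = there (next-++ xs)

  next-source : ∀ {u v : X} {xs} → Next u v xs → u ∈ xs
  next-source here      = here refl
  next-source (there n) = there (next-source n)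

  next-target : ∀ {u v x : X} {xs} → Next u v (x ∷ xs) → v ∈ xs
  next-target here = here refl
  next-target (there {xs = _ ∷ _} n) = there (next-target n)

  ∉-head : ∀ {x y : X} {xs} → Unique (x ∷ xs) → y ∈ xs → x ≢ y
  ∉-head (x∉ ∷ _) y∈ = All.lookup x∉ y∈

  next-in-unique : ∀ {u u′ v : X} {xs} → Unique xs → Next u v xs → Next u′ v xs → u ≡ u′
  next-in-unique _        here      here      = refl
  next-in-unique (_ ∷ un) here      (there n) = ⊥-elim (∉-head un (next-target n) refl)
  next-in-unique (_ ∷ un) (there n) here      = ⊥-elim (∉-head un (next-target n) refl)
  next-in-unique (_ ∷ un) (there n) (there m) = next-in-unique un n m

  next-out-unique : ∀ {u v v′ : X} {xs} → Unique xs → Next u v xs → Next u v′ xs → v ≡ v′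
  next-out-unique _        here      here      = refl
  next-out-unique un       here      (there n) = ⊥-elim (∉-head un (next-source n) refl)
  next-out-unique un       (there n) here      = ⊥-elim (∉-head un (next-source n) refl)
  next-out-unique (_ ∷ un) (there n) (there m) = next-out-unique un n m

  next-antisym : ∀ {u v : X} {xs} → Unique xs → Next u v xs → ¬ Next v u xs
  next-antisym un       here      here      = ∉-head un (here refl) refl
  next-antisym un       here      (there n) = ∉-head un (there (next-target n)) refl
  next-antisym un       (there n) here      = ∉-head un (there (next-target n)) refl
  next-antisym (_ ∷ un) (there n) (there m) = next-antisym un n m

  next-last : ∀ {b v : X} xs → Unique (xs ∷ʳ b) → ¬ Next b v (xs ∷ʳ b)
  next-last []           _        (there ())
  next-last (x ∷ [])     un       here      = ∉-head un (here refl) refl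
  next-last (x ∷ [])     (_ ∷ un) (there n) = next-last [] un n
  next-last (x ∷ y ∷ xs) un       here      = ∉-head un (there (∈-++⁺ʳ xs (here refl))) refl
  next-last (x ∷ y ∷ xs) (_ ∷ un) (there n) = next-last (y ∷ xs) un n

  has-next : ∀ {b v : X} xs → v ∈ xs ∷ʳ b → v ≢ b → ∃[ w ] Next v w (xs ∷ʳ b)
  has-next []           (here eq)   v≢b = ⊥-elim (v≢b eq)
  has-next (x ∷ [])     (here refl) _   = _ , here
  has-next (x ∷ y ∷ xs) (here refl) _   = _ , here
  has-next (x ∷ xs)     (there v∈)  v≢b with has-next xs v∈ v≢b
  ... | w , n = w , there n

  before-last : ∀ {b : X} x xs → ∃[ w ] Next w b (x ∷ (xs ∷ʳ b))
  before-last x []       = x , here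
  before-last x (y ∷ xs) with before-last y xs
  ... | w , n = w , there n

  linked-next : ∀ {R : X → X → Set} {u v xs} → Linked R xs → Next u v xs → R u v
  linked-next (r ∷ _) here = r
  linked-next (_ ∷ l) (there n) = linked-next l n

-- Directing the disjoint paths from A to B

module FromPaths {n} (G : TemporalGraph n) (A B : Fin n) (interiors : List (List (Fin n)))
                 (paths-between : IsDisjointPathsBetween G A B interiors) where
  open IsDisjointPathsBetween paths-between

  On : List (Fin n) → Fin n → Fin n → Set
  On p u v = p ∈ interiors × Next u v (route p)

  route-unique : ∀ {p} → p ∈ interiors → Unique (route p)
  route-unique = All.lookup simple

  same-path : ∀ {p q w} → p ∈ interiors → q ∈ interiors → w ∈ p → w ∈ q → p ≡ q
  same-path = go disjoint
    where
    go : ∀ {ps p q w} → AllPairs Disjoint ps → p ∈ ps → q ∈ ps → w ∈ p → w ∈ q → p ≡ q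
    go (_ ∷ _)  (here refl) (here refl) _ _ = refl
    go (ds ∷ _) (here refl) (there q∈) w∈p w∈q = ⊥-elim (All.lookup ds q∈ (w∈p , w∈q))
    go (ds ∷ _) (there p∈) (here refl) w∈p w∈q = ⊥-elim (All.lookup ds p∈ (w∈q , w∈p))
    go (_ ∷ ap) (there p∈) (there q∈) w∈p w∈q = go ap p∈ q∈ w∈p w∈q

  interior : ∀ {p w} → w ∈ route p → w ≢ A → w ≢ B → w ∈ p
  interior (here eq) w≢A _ = ⊥-elim (w≢A eq)
  interior {p} (there w∈) _ w≢B with ∈-++⁻ p w∈
  ... | inj₁ w∈p = w∈p
  ... | inj₂ (here eq) = ⊥-elim (w≢B eq)

  not-into-A : ∀ {p u} → ¬ On p u A
  not-into-A (p∈ , n) = ∉-head (route-unique p∈) (next-target n) refl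

  not-out-of-B : ∀ {p v} → ¬ On p B v
  not-out-of-B {p} (p∈ , n) = next-last (A ∷ p) (route-unique p∈) n

  source-interior : ∀ {p u v} → On p u v → u ≢ A → u ∈ p
  source-interior o@(p∈ , n) u≢A = interior (next-source n) u≢A (λ { refl → not-out-of-B o })

  target-interior : ∀ {p u v} → On p u v → v ≢ B → v ∈ p
  target-interior o@(p∈ , n) v≢B = interior (there (next-target n)) (λ { refl → not-into-A o }) v≢B

  onPath : ∀ {u v} → Adjacent G u v → (∃[ p ] On p u v) ⊎ (∃[ p ] On p v u)
  onPath adj with find (coversAllEdges _ _ adj)
  ... | p , p∈ , inj₁ (xs , ys , eq) = inj₁ (p , p∈ , subst (Next _ _) (sym eq) (next-++ xs))
  ... | p , p∈ , inj₂ (xs , ys , eq) = inj₂ (p , p∈ , subst (Next _ _) (sym eq) (next-++ xs))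

  path-induction : (Q : Fin n → Fin n → Set) → (∀ {p v} → On p A v → Q A v) →
    (∀ {p u v w} → v ≢ B → On p u v → Q u v → On p v w → Q v w) → ∀ {p u v} → On p u v → Q u v
  path-induction Q base next {p} (p∈ , n) = along A (p ∷ʳ B) (λ m → p∈ , m) (λ m → base (p∈ , m)) n
    where
    along : ∀ x xs → (∀ {u v} → Next u v (x ∷ xs) → On p u v) → (∀ {v} → Next x v (x ∷ xs) → Q x v) → ∀ {u v} → Next u
          v (x ∷ xs) → Q u v
    along x (y ∷ ys) on q here = q here
    along x (y ∷ ys) on q (there m) = along y ys (λ m′ → on (there m′))
          (λ m′ → next (λ { refl → not-out-of-B (on (there m′)) }) (on here) (q here) (on (there m′))) m

  record ArcOf (x y : ℕ) : Set where
    constructor arcOf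
    field
      {u v} : Fin n
      {p}   : List (Fin n)
      x≡    : toℕ u ≡ x
      y≡    : toℕ v ≡ y
      on    : On p u v

  arcs : Arcs (edgesOf G) (toℕ A) (toℕ B)
  arcs = record
    { Arc        = ArcOf
    ; edge⇒arc   = edge⇒arc
    ; arc⇒edge   = arc⇒edge
    ; no-in      = λ { (arcOf refl eq o) → not-into-A (subst (On _ _) (toℕ-injective eq) o) }
    ; no-out     = λ { (arcOf eq refl o) → not-out-of-B (subst (λ z → On _ z _) (toℕ-injective eq) o) }
    ; in-unique  = in-unique
    ; out-unique = out-unique
    ; antisym    = antisym
    ; successor  = successor
    ; induction  = induction
    ; first      = first
    }
    where
    edge⇒arc : ∀ {x y i} → (x , y , i) ∈ edgesOf G → ArcOf x y ⊎ ArcOf y x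
    edge⇒arc e∈ with ∈-map⁻ raw e∈
    ... | (u , v , i) , e∈′ , refl with onPath (i , inj₁ e∈′)
    ...   | inj₁ (_ , o) = inj₁ (arcOf refl refl o)
    ...   | inj₂ (_ , o) = inj₂ (arcOf refl refl o)
    arc⇒edge : ∀ {x y} → ArcOf x y → ∃[ i ] ((x , y , i) ∈ edgesOf G ⊎ (y , x , i) ∈ edgesOf G)
    arc⇒edge (arcOf refl refl (p∈ , n)) with linked-next (All.lookup paths p∈) n
    ... | i , inj₁ e∈ = i , inj₁ (∈-map⁺ raw e∈)
    ... | i , inj₂ e∈ = i , inj₂ (∈-map⁺ raw e∈)
    in-unique : ∀ {x x′ y} → y ≢ toℕ B → ArcOf x y → ArcOf x′ y → x ≡ x′
    in-unique y≢B (arcOf {v = v} refl refl o) (arcOf refl eq o′) with toℕ-injective eq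
    ... | refl with same-path (proj₁ o) (proj₁ o′) (target-interior o v≢B) (target-interior o′ v≢B)
      where
      v≢B : v ≢ B
      v≢B v≡B = y≢B (cong toℕ v≡B)
    ...   | refl = cong toℕ (next-in-unique (route-unique (proj₁ o)) (proj₂ o) (proj₂ o′))
    out-unique : ∀ {x y y′} → x ≢ toℕ A → ArcOf x y → ArcOf x y′ → y ≡ y′
    out-unique x≢A (arcOf {u = u} refl refl o) (arcOf eq refl o′) with toℕ-injective eq
    ... | refl with same-path (proj₁ o) (proj₁ o′) (source-interior o u≢A) (source-interior o′ u≢A)
      where
      u≢A : u ≢ A
      u≢A u≡A = x≢A (cong toℕ u≡A)
    ...   | refl = cong toℕ (next-out-unique (route-unique (proj₁ o)) (proj₂ o) (proj₂ o′))
    antisym : ∀ {x y} → ArcOf x y → ¬ ArcOf y x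
    antisym (arcOf refl refl o) (arcOf eq eq′ o′) with toℕ-injective eq | toℕ-injective eq′
    -- The vertex `v` is entered by one arc and left by the other, so it is neither `A` nor `B`;
    -- being interior, it lies on one path only.
    ... | refl | refl with same-path (proj₁ o) (proj₁ o′) (target-interior o (λ { refl → not-out-of-B o′ }))
          (source-interior o′ (λ { refl → not-into-A o }))
    ...   | refl = next-antisym (route-unique (proj₁ o)) (proj₂ o) (proj₂ o′)
    successor : ∀ {x y} → ArcOf x y → y ≢ toℕ B → ∃[ z ] ArcOf y z
    successor (arcOf {p = p} refl refl (p∈ , n)) y≢B with has-next (A ∷ p) (there (next-target n)) (λ v≡B → y≢B (cong toℕ v≡B))
    ... | w , m = toℕ w , arcOf refl refl (p∈ , m)
    induction : (Q : ℕ → ℕ → Set) → (∀ {y} → ArcOf (toℕ A) y → Q (toℕ A) y) →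
                (∀ {x y z} → y ≢ toℕ B → ArcOf x y → Q x y → ArcOf y z → Q y z) → ∀ {x y} → ArcOf x y → Q x y
    induction Q base next (arcOf refl refl o) = path-induction (λ u v → Q (toℕ u) (toℕ v)) (λ o → base (arcOf refl refl o))
      (λ v≢B o q o′ → next (λ eq → v≢B (toℕ-injective eq)) (arcOf refl refl o) q (arcOf refl refl o′)) o
    first : ∃[ y ] ArcOf (toℕ A) y
    first = go interiors nonempty (λ p∈ → p∈)
      where
      go : ∀ ps → ps ≢ [] → (∀ {p} → p ∈ ps → p ∈ interiors) → ∃[ y ] ArcOf (toℕ A) y
      go []             ne _   = ⊥-elim (ne refl)
      go ([] ∷ ps)      _  sub = toℕ B , arcOf refl refl (sub (here refl) , here)
      go ((v ∷ p) ∷ ps) _  sub = toℕ v , arcOf refl refl (sub (here refl) , here)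

  touched : ∀ (v : Fin n) → ∃[ w ] (Arcs.Arc arcs (toℕ v) w ⊎ Arcs.Arc arcs w (toℕ v))
  touched v with find (coversAllVertices v)
  ... | p , p∈ , v∈ with v Fin.≟ B
  ...   | no v≢B with has-next (A ∷ p) v∈ v≢B
  ...     | w , m = toℕ w , inj₁ (arcOf refl refl (p∈ , m))
  touched v | p , p∈ , v∈ | yes refl with before-last A p
  ...     | w , m = toℕ w , inj₂ (arcOf refl refl (p∈ , m))

-- Reachtimes and solutions

bounded : ∀ {n} (f : Fin n → ℕ) → ∃[ T ] (∀ v → f v ≤ T)
bounded {zero}  f = 0 , λ ()
bounded {suc n} f with bounded (λ v → f (suc v))
... | T , h = f zero ⊔ T , λ where
  zero    → m≤m⊔n (f zero) T
  (suc v) → ≤-trans (h v) (m≤n⊔m (f zero) T)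

reaches⇒reachesBy : ∀ {n} (G : TemporalGraph n) s → (∀ v → Reaches G s v) → ∃[ T ] (∀ v → ReachesBy G s T v)
reaches⇒reachesBy G s r with bounded (λ v → proj₁ (r v))
... | T , h = T , λ v → proj₁ (r v) , proj₁ (proj₂ (r v)) , proj₂ (proj₂ (r v)) , h v

reachtime : ∀ {n} (G : TemporalGraph n) s {T} → (∀ v → ReachesBy G s T v) → ∃[ r ] (IsReachtime G s r × r ≤ T)
reachtime G s {T} reached with least (λ t → ∀ v → ReachesBy G s t v) (λ t → all? (reaches? G s t)) T reached
... | r , reached′ , r≤T , min = r , (reached′ , min) , r≤T

record BothReach {n} (H : TemporalGraph n) (A B : Fin n) (T : ℕ) : Set where
  constructor both
  field
    fromA : ∀ v → ReachesBy H A T v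
    fromB : ∀ v → ReachesBy H B T v

module _ (I : Instance) {A B : Fin (order I)} (sources≡ : sources I ≡ A ∷ B ∷ []) where

  solution⇒bothReach : ∀ {H} → IsSolution I H → ∃[ T ] BothReach H A B T
  solution⇒bothReach {H} (_ , reached) with subst (All (λ s → ∀ v → Reaches H s v)) sources≡ reached
  ... | rA ∷ rB ∷ [] with reaches⇒reachesBy H A rA | reaches⇒reachesBy H B rB
  ...   | T₁ , h₁ | T₂ , h₂ = T₁ ⊔ T₂ , both (λ v → reach-mono H A (m≤m⊔n T₁ T₂) (h₁ v))
        (λ v → reach-mono H B (m≤n⊔m T₁ T₂) (h₂ v))

  value⇒bothReach : ∀ {H t} → IsValue I H t → BothReach H A B t
  value⇒bothReach {H} {t} (bounds , _) with subst (All (λ s → ∃[ r ] (IsReachtime H s r × r ≤ t))) sources≡ bounds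
  ... | (r₁ , (h₁ , _) , r₁≤) ∷ (r₂ , (h₂ , _) , r₂≤) ∷ [] =
    both (λ v → reach-mono H A r₁≤ (h₁ v)) (λ v → reach-mono H B r₂≤ (h₂ v))

  bothReach⇒value : ∀ {H T} → BothReach H A B T → ∃[ t ] (IsValue I H t × t ≤ T)
  bothReach⇒value {H} (both a b) with reachtime H A a | reachtime H B b
  ... | r₁ , h₁ , r₁≤ | r₂ , h₂ , r₂≤ = r₁ ⊔ r₂ ,
    (subst (All (λ s → ∃[ r ] (IsReachtime H s r × r ≤ r₁ ⊔ r₂))) (sym sources≡)
          ((r₁ , h₁ , m≤m⊔n r₁ r₂) ∷ (r₂ , h₂ , m≤n⊔m r₁ r₂) ∷ []) ,
     subst (Any (λ s → IsReachtime H s (r₁ ⊔ r₂))) (sym sources≡) attained) ,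
    ⊔-lub r₁≤ r₂≤
    where
    attained : Any (λ s → IsReachtime H s (r₁ ⊔ r₂)) (A ∷ B ∷ [])
    attained with ⊔-sel r₁ r₂
    ... | inj₁ eq = here (subst (IsReachtime H A) (sym eq) h₁)
    ... | inj₂ eq = there (here (subst (IsReachtime H B) (sym eq) h₂))

  -- The value of `H` is only known to be at most `T`. As `T` is also a lower bound for all
  -- solutions, including `H`, this suffices.
  optimal : ∀ {H T} → graph I DelaysTo H → BothReach H A B T →
            (∀ {H′ t′} → graph I DelaysTo H′ → BothReach H′ A B t′ → T ≤ t′) → IsOptimalSolution I H
  optimal {H} delays br min with bothReach⇒value {H} br
  ... | t , value , t≤T =
    (delays , subst (All (λ s → ∀ v → Reaches H s v)) (sym sources≡)
          ((λ v → reaches (BothReach.fromA br v)) ∷ (λ v → reaches (BothReach.fromB br v)) ∷ [])) ,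
    t , value , λ H′ t′ (delays′ , _) value′ → ≤-trans t≤T (min delays′ (value⇒bothReach {H′} value′))
    where
    reaches : ∀ {s v T} → ReachesBy H s T v → Reaches H s v
    reaches (a , vs , p , _) = a , vs , p

-- Correctness of the algorithm

inputOf : ∀ {n} → TemporalGraph n → Fin n → Fin n → ⟦ Input ⟧ᵗ
inputOf {n} G A B = (n , edgesOf G) , (toℕ A ∷ toℕ B ∷ [])

Answers : Instance → Maybe (ℕ × List TEdge) → Set
Answers I result = ∃[ answer ] (enc (optᵗ natᵗ (listᵗ edge)) result ≡ encodeAnswer answer × IsCorrectAnswer I answer)

module Assembly (I : Instance) {A B : Fin (order I)} (sources≡ : sources I ≡ A ∷ B ∷ [])
  (arcs : Arcs (edgesOf (graph I)) (toℕ A) (toℕ B))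
  (touched : ∀ (v : Fin (order I)) → ∃[ w ] (Arcs.Arc arcs (toℕ v) w ⊎ Arcs.Arc arcs w (toℕ v)))
  (ls : List Link) (trav : Walk.Traversal arcs (inputOf (graph I) A B) ls)
  (cand : List ℕ) (∈cand : ∀ {l j} → l ∈ 0 ∷ labelsOf (edgesOf (graph I)) → j ≤ length (edgesOf (graph I)) → j + l ∈ cand) where

  private
    input = inputOf (graph I) A B

  open Walk arcs input using (ρ₃; Traversal)
  open Facts arcs input ls cand
  open Predicates (edgesOf (graph I)) (toℕ A) (toℕ B)

  module _ (fs : List Fact) (fs≡ : fs ≡ factsOf (concatMap block ls)) where

    Derived : Fact → List Fact → Set
    Derived f gs = Initial f ⊎ Any (λ g → Step g f) gs

    fs-sound : ∀ {f} → f ∈ fs → proj₁ f ∈ ls × Ok f × Derived f fs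
    fs-sound {f} f∈ with facts-sound (concatMap block ls) (subst (f ∈_) fs≡ f∈)
    ... | f∈′ , ok , how with ∈-concatMap⁻ block ls f∈′
    ...   | l , l∈ , f∈l = subst (_∈ ls) (sym (∈-block⁻ l f∈l)) l∈ , ok , subst (Derived f) (sym fs≡) how

    open Selection arcs input ls cand fs using (Final; selStep)
    open Selected arcs input ls cand fs trav fs-sound using (Outcome; selection)

    -- The deadline of the fact is the compressed `t`, which is not above `t`: restricting all times
    -- to candidates never makes the optimum worse.
    final-below : ∀ {H t} → graph I DelaysTo H → BothReach H A B t → ∃[ f ] (f ∈ fs × Final f × dl f ≤ t)
    final-below {H} {t} delays (both a b) with Complete.final-exists arcs input ls cand trav
          (FromSolution.certificate (graph I) H A B arcs delays a b cand ∈cand)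
    ... | f , f∈ , isFinal , eq = f , subst (f ∈_) (sym fs≡) f∈ , isFinal , ≤-trans (≤-reflexive eq) (Compression.compress≤ _ _ t)

    answerOf : List Fact → Maybe (ℕ × List TEdge)
    answerOf sel = ⟦ answerT ⟧ (sel ∷ fs ∷ cand ∷ ls ∷ ρ₃)

    selected-correct : ∀ sel m → m ∈ sel → Plan arcs sel → (∀ {f} → f ∈ fs → Final f → dl m ≤ dl f) →
      Answers I (answerOf sel)
    selected-correct sel@(_ ∷ _) m m∈ plan min = just H , sym R.encoded , optimal I sources≡ {H} {dl m} R.delayed
          (both (R.reachedA m∈) (R.reachedB m∈)) below
      where
      open Relabelling (graph I) A B arcs input ls cand fs sel plan
      module D = Dedup ρ₇
      module R where
        open Build (graph I) new new≥ (D.deduped relabelledEdges) (D.deduped-unique relabelledEdges)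
          (λ e∈ → D.deduped-⊇ relabelledEdges (∈-relabelled⁺ e∈)) (λ y∈ → ∈-relabelled⁻ (D.deduped-⊆ relabelledEdges y∈)) public
        open Reaching (graph I) A B arcs touched sel plan new new≥ (D.deduped relabelledEdges) (D.deduped-unique relabelledEdges)
          (λ e∈ → D.deduped-⊇ relabelledEdges (∈-relabelled⁺ e∈))
                (λ y∈ → ∈-relabelled⁻ (D.deduped-⊆ relabelledEdges y∈)) new≡renew public
      H : TemporalGraph (order I)
      H = R.output
      below : ∀ {H′ t′} → graph I DelaysTo H′ → BothReach H′ A B t′ → dl m ≤ t′
      below delays′ br with final-below delays′ br
      ... | f , f∈ , isFinal , f≤ = ≤-trans (min f∈ isFinal) f≤

    correct : ∀ sel → Outcome sel → Answers I (answerOf sel)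
    correct sel (inj₂ (m , min , m∈ , plan)) = selected-correct sel m m∈ plan min
    correct _   (inj₁ (noFinal , refl)) = nothing , refl , unsolvable
      where
      unsolvable : ∀ H → ¬ IsSolution I H
      unsolvable H sol with final-below (proj₁ sol) (proj₂ (solution⇒bothReach I sources≡ {H} sol))
      ... | f , f∈ , isFinal , _ = noFinal f∈ isFinal

    answer-correct : ∀ sel → sel ≡ chainList selStep ls →
      Answers I (answerOf sel)
    answer-correct sel sel≡ = correct sel (subst Outcome (sym sel≡) selection)

-- Comparing two instances of this type does not evaluate the terms.
record Solves (I : Instance) {Γ : List Ty} (t : Tm Γ (optᵗ natᵗ (listᵗ edge))) (ρ : Env Γ) : Set where
  constructor solves
  field
    answers : Answers I (⟦ t ⟧ ρ)

solves-lets : ∀ {I Γ σ} {t : Tm Γ σ} {u} {ρ : Env Γ} → (∀ x → x ≡ ⟦ t ⟧ ρ → Solves I u (x ∷ ρ)) → Solves I (lets t u) ρ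
solves-lets h = solves (Solves.answers (h _ refl))

encodeInstance-enc : ∀ I {A B} → sources I ≡ A ∷ B ∷ [] → encodeInstance I ≡ enc Input (inputOf (graph I) A B)
encodeInstance-enc I {A} {B} eq = cong₂ (λ x vs → (num (order I) ∙ x) ∙ encodeList (map encodeVertex vs))
      (edges (timeEdges (graph I))) eq
  where
  edges : ∀ es → encodeList (map encodeTimeEdge es) ≡ enc (listᵗ edge) (map (raw {order I}) es)
  edges []       = refl
  edges (e ∷ es) = cong (enc edge (raw e) ∙_) (edges es)

reachFast-correct : (I : Instance) (A B : Fin (order I)) → ConsistsOfDisjointPathsBetween (graph I) A B → sources I ≡ A ∷ B ∷ [] →
  Solves I reachFast (inputOf (graph I) A B ∷ [])
reachFast-correct I A B (interiors , paths-between) sources≡ =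
  solves-lets λ { _ refl → solves-lets λ { _ refl → solves-lets λ { _ refl →
  -- The edges and the two sources above are replaced by their values; the slots, candidates, facts
  -- and selection remain variables with defining equations.
  solves-lets λ ls ls≡ → solves-lets λ cand cand≡ → solves-lets λ fs fs≡ → solves-lets λ sel sel≡ →
  solves (Assembly.answer-correct I sources≡ arcs touched ls (subst Traversal (sym ls≡) slotsT-traversal) cand
    (λ {l} {j} l∈ j≤ → subst (j + l ∈_) (sym cand≡) (∈-cand ls (toℕ B) (toℕ A) (edgesOf (graph I)) (inputOf (graph I) A B) l∈ j≤))
    fs fs≡ sel sel≡) }}}
  where
  open FromPaths (graph I) A B interiors paths-between
  open Walk arcs (inputOf (graph I) A B) using (Traversal; slotsT-traversal)

theorem5 : Σ[ algorithm ∈ Program ] Σ[ c ∈ ℕ ] Σ[ d ∈ ℕ ]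
    ((I : Instance) (A B : Fin (order I)) →
    ConsistsOfDisjointPathsBetween (graph I) A B →
    sources I ≡ A ∷ B ∷ [] →
    ∃[ answer ]
    ((algorithm on encodeInstance I outputs encodeAnswer answer
    within (c * size (encodeInstance I) ^ d))
    × IsCorrectAnswer I answer))
theorem5 = programOf reachFast , proj₁ bound , proj₁ (proj₂ bound) , λ I A B paths-between sources≡ →
  let (answer , output≡ , isCorrect) = Solves.answers (reachFast-correct I A B paths-between sources≡) in
  answer , proj₂ (proj₂ bound) (inputOf (graph I) A B) (encodeInstance-enc I sources≡) output≡ , isCorrect
  where
  bound = polynomial-time reachFast
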